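{- Let $n\geq 2$ and let $\mathcal{G}=\{G_1, G_2, \ldots , G_{2n}\}$ be a family of (not necessarily distinct) balanced bipartite graphs on the common vertex set $[2n]$ with the common bipartition $(X, Y)$. If $$\rho (G_i) \geq \rho(K_{1, n-1}\sqcup \widehat{K_{n-1, 1}})$$ for every $i\in [2n]$, then $\mathcal{G}$ admits a rainbow Hamilton cycle unless $G_1=G_2=\cdots =G_{2n}\cong K_{1, n-1}\sqcup \widehat{K_{n-1, 1}}$.
   Context: All graphs are simple and undirected. $[k]=\{1,2,\ldots,k\}$. A bipartite graph with bipartition $(X,Y)$ is balanced if $|X|=|Y|$. $\rho(G)$ is the spectral radius of $G$, i.e. the maximum modulus of the eigenvalues of its adjacency matrix. $K_{s,t}$ is the complete bipartite graph with first part of size $s$ and second part of size $t$. For a bipartite graph $G$ with bipartition $(X,Y)$, its quasi-complement $\widehat{G}$ has the same vertex set and bipartition, and for $x\in X,y\in Y$, $xy\in E(\widehat G)$ iff $xy\notin E(G)$. For bipartite graphs $G_1,G_2$ with bipartitions $(X_1,Y_1)$, $(X_2,Y_2)$, $G_1\sqcup G_2$ is the bipartite graph obtained from the disjoint union $G_1\cup G_2$ by adding all edges between $X_1$ and $Y_2$ and all edges between $Y_1$ and $X_2$. (So $K_{1, n-1}\sqcup \widehat{K_{n-1, 1}}$ is $K_{n,n}$ with $n-1$ of the $n$ edges at one fixed vertex removed.) $G_i=G_j$ means equality as graphs on the labelled vertex set (same edge set), while $\cong$ denotes isomorphism. For a family $\mathcal{G}=\{G_1,\ldots,G_k\}$ of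 not necessarily distinct graphs on the same vertex set $V$ and a graph $H$ with $k$ edges and $V(H)\subseteq V$, $H$ is a rainbow copy in $\mathcal{G}$ if there is a bijection $\phi:E(H)\to[k]$ with $e\in E(G_{\phi(e)})$ for all $e\in E(H)$. A rainbow Hamilton cycle in $\mathcal{G}$ is such an $H$ that is a cycle visiting every vertex of $V$ exactly once. -}

module Defs where

open import Algebra.Bundles using (CommutativeMonoid)
import Algebra.Properties.CommutativeSemigroup as CommutativeSemigroupProperties
open import Data.Bool.Base using (Bool; true; false; not; _∧_; _xor_; if_then_else_)
open import Data.Bool.Properties using (xor-comm; xor-same)
open import Data.Fin.Base as Fin using (Fin; toℕ; splitAt)
open import Data.Fin.Permutation using (Permutation; Permutation′; _⟨$⟩ʳ_)
open import Data.Fin.Subset using (Subset; inside; outside)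
open import Data.Nat.Base as ℕ using (ℕ; suc)
import Data.Nat.Properties as ℕₚ
open import Data.Product.Base using (Σ; ∃; ∃₂; _×_; _,_)
open import Data.Rational.Base as ℚ using (ℚ; 0ℚ; 1ℚ; ½)
import Data.Rational.Properties as ℚₚ
open import Data.Sum.Base using (_⊎_; inj₁; inj₂; [_,_]′)
open import Data.Vec.Base using (lookup; replicate; _++_)
open import Data.Vec.Properties using (lookup-splitAt)
import Data.Vec.Functional as Vector
open import Function.Bundles using (_⤖_; _⇔_; Bijection)
open import Relation.Binary.PropositionalEquality
  using (_≡_; refl; sym; trans; cong; cong₂; subst)
open import Relation.Nullary.Negation using (¬_)

------------------------------------------------------------------------
-- Real numbers, as Cauchy sequences of rationals up to _≈_

record ℝ : Set where
  constructor mkℝ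
  field
    seq    : ℕ → ℚ
    cauchy : ∀ ε → 0ℚ ℚ.< ε →
             ∃ λ N → ∀ m n → N ℕ.≤ m → N ℕ.≤ n → ℚ.∣ seq m ℚ.- seq n ∣ ℚ.< ε

open ℝ public

infix 4 _≈_ _≤_

_≈_ : ℝ → ℝ → Set
x ≈ y = ∀ ε → 0ℚ ℚ.< ε →
        ∃ λ N → ∀ n → N ℕ.≤ n → ℚ.∣ seq x n ℚ.- seq y n ∣ ℚ.< ε

_≤_ : ℝ → ℝ → Set
x ≤ y = ∀ ε → 0ℚ ℚ.< ε →
        ∃ λ N → ∀ n → N ℕ.≤ n → seq x n ℚ.≤ seq y n ℚ.+ ε

private
  open CommutativeSemigroupProperties
    (CommutativeMonoid.commutativeSemigroup ℚₚ.+-0-commutativeMonoid)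
    using (interchange)

  half>0 : ∀ {ε} → 0ℚ ℚ.< ε → 0ℚ ℚ.< ½ ℚ.* ε
  half>0 {ε} ε>0 =
    ℚₚ.positive⁻¹ (½ ℚ.* ε) {{ℚₚ.pos*pos⇒pos ½ ε {{ℚ.positive ε>0}}}}

  half+half : ∀ ε → ½ ℚ.* ε ℚ.+ ½ ℚ.* ε ≡ ε
  half+half ε = trans (sym (ℚₚ.*-distribʳ-+ ε ½ ½)) (ℚₚ.*-identityˡ ε)

  +-rearrange : ∀ a b c d → (a ℚ.+ b) ℚ.- (c ℚ.+ d) ≡ (a ℚ.- c) ℚ.+ (b ℚ.- d)
  +-rearrange a b c d = trans
    (cong ((a ℚ.+ b) ℚ.+_) (ℚₚ.neg-distrib-+ c d))
    (interchange a b (ℚ.- c) (ℚ.- d))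

  -‿rearrange : ∀ a b → (ℚ.- a) ℚ.- (ℚ.- b) ≡ ℚ.- (a ℚ.- b)
  -‿rearrange a b = sym (ℚₚ.neg-distrib-+ a (ℚ.- b))

  split-eq : ∀ a b → a ≡ (a ℚ.- b) ℚ.+ b
  split-eq a b = sym (trans (ℚₚ.+-assoc a (ℚ.- b) b)
    (trans (cong (a ℚ.+_) (ℚₚ.+-inverseˡ b)) (ℚₚ.+-identityʳ a)))

  telescope : ∀ p q r → p ℚ.- r ≡ (p ℚ.- q) ℚ.+ (q ℚ.- r)
  telescope p q r = trans (cong (ℚ._- r) (split-eq p q))
    (ℚₚ.+-assoc (p ℚ.- q) q (ℚ.- r))

  factorˡ : ∀ a b d → a ℚ.* b ℚ.- a ℚ.* d ≡ a ℚ.* (b ℚ.- d)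
  factorˡ a b d = trans (cong (a ℚ.* b ℚ.+_) (ℚₚ.neg-distribʳ-* a d))
    (sym (ℚₚ.*-distribˡ-+ a b (ℚ.- d)))

  *-rearrange : ∀ a b c d →
    (a ℚ.* b) ℚ.- (c ℚ.* d) ≡ a ℚ.* (b ℚ.- d) ℚ.+ d ℚ.* (a ℚ.- c)
  *-rearrange a b c d = trans (telescope (a ℚ.* b) (a ℚ.* d) (c ℚ.* d))
    (cong₂ ℚ._+_ (factorˡ a b d)
      (trans (cong₂ ℚ._-_ (ℚₚ.*-comm a d) (ℚₚ.*-comm c d)) (factorˡ d a c)))

  eventually-bounded : ∀ x → Σ ℚ λ B → 0ℚ ℚ.< B ×
    ∃ λ N → ∀ n → N ℕ.≤ n → ℚ.∣ seq x n ∣ ℚ.≤ B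
  eventually-bounded x with cauchy x 1ℚ (ℚₚ.positive⁻¹ 1ℚ)
  ... | N , close = 1ℚ ℚ.+ ℚ.∣ seq x N ∣ ,
    ℚₚ.+-mono-<-≤ (ℚₚ.positive⁻¹ 1ℚ) (ℚₚ.0≤∣p∣ (seq x N)) , N , λ n N≤n → begin
      ℚ.∣ seq x n ∣
        ≡⟨ cong ℚ.∣_∣ (split-eq (seq x n) (seq x N)) ⟩
      ℚ.∣ (seq x n ℚ.- seq x N) ℚ.+ seq x N ∣
        ≤⟨ ℚₚ.∣p+q∣≤∣p∣+∣q∣ (seq x n ℚ.- seq x N) (seq x N) ⟩
      ℚ.∣ seq x n ℚ.- seq x N ∣ ℚ.+ ℚ.∣ seq x N ∣
        ≤⟨ ℚₚ.+-monoˡ-≤ ℚ.∣ seq x N ∣ (ℚₚ.<⇒≤ (close n N N≤n ℕₚ.≤-refl)) ⟩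
      1ℚ ℚ.+ ℚ.∣ seq x N ∣ ∎
    where open ℚₚ.≤-Reasoning

  -- A tolerance δ such that B * δ is ε.
  scaled : ∀ {B ε} → 0ℚ ℚ.< B → 0ℚ ℚ.< ε → Σ ℚ λ δ → 0ℚ ℚ.< δ × B ℚ.* δ ≡ ε
  scaled {B} {ε} B>0 ε>0 = 1/B ℚ.* ε ,
    ℚₚ.positive⁻¹ (1/B ℚ.* ε)
      {{ℚₚ.pos*pos⇒pos 1/B {{ℚₚ.1/pos⇒pos B {{posB}}}} ε {{ℚ.positive ε>0}}}} ,
    trans (sym (ℚₚ.*-assoc B 1/B ε))
      (trans (cong (ℚ._* ε) (ℚₚ.*-inverseʳ B {{nzB}})) (ℚₚ.*-identityˡ ε))
    where
    posB = ℚ.positive B>0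
    nzB  = ℚₚ.pos⇒nonZero B {{posB}}
    1/B  = ℚ.1/_ B {{nzB}}

  scaled-< : ∀ {B δ p q} → 0ℚ ℚ.< B → ℚ.∣ p ∣ ℚ.≤ B → ℚ.∣ q ∣ ℚ.< δ →
             ℚ.∣ p ℚ.* q ∣ ℚ.< B ℚ.* δ
  scaled-< {B} {δ} {p} {q} B>0 p≤B q<δ = begin-strict
    ℚ.∣ p ℚ.* q ∣
      ≡⟨ ℚₚ.∣p*q∣≡∣p∣*∣q∣ p q ⟩
    ℚ.∣ p ∣ ℚ.* ℚ.∣ q ∣
      ≤⟨ ℚₚ.*-monoʳ-≤-nonNeg ℚ.∣ q ∣ {{ℚₚ.∣-∣-nonNeg q}} p≤B ⟩
    B ℚ.* ℚ.∣ q ∣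
      <⟨ ℚₚ.*-monoʳ-<-pos B {{ℚ.positive B>0}} q<δ ⟩
    B ℚ.* δ ∎
    where open ℚₚ.≤-Reasoning

  sum-< : ∀ {ε} p q → ℚ.∣ p ∣ ℚ.< ½ ℚ.* ε → ℚ.∣ q ∣ ℚ.< ½ ℚ.* ε →
          ℚ.∣ p ℚ.+ q ∣ ℚ.< ε
  sum-< {ε} p q p<ε q<ε = begin-strict
    ℚ.∣ p ℚ.+ q ∣          ≤⟨ ℚₚ.∣p+q∣≤∣p∣+∣q∣ p q ⟩
    ℚ.∣ p ∣ ℚ.+ ℚ.∣ q ∣    <⟨ ℚₚ.+-mono-< p<ε q<ε ⟩
    ½ ℚ.* ε ℚ.+ ½ ℚ.* ε    ≡⟨ half+half ε ⟩
    ε                      ∎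
    where open ℚₚ.≤-Reasoning

fromℚ : ℚ → ℝ
fromℚ q = mkℝ (λ _ → q) λ ε ε>0 →
  0 , λ _ _ _ _ → subst (λ d → ℚ.∣ d ∣ ℚ.< ε) (sym (ℚₚ.+-inverseʳ q)) ε>0

0ℝ 1ℝ : ℝ
0ℝ = fromℚ 0ℚ
1ℝ = fromℚ 1ℚ

infixl 6 _+_ _-_
infixl 7 _*_
infix  8 -_

_+_ : ℝ → ℝ → ℝ
seq (x + y) n = seq x n ℚ.+ seq y n
cauchy (x + y) ε ε>0
  with cauchy x (½ ℚ.* ε) (half>0 ε>0) | cauchy y (½ ℚ.* ε) (half>0 ε>0)
... | M , closeˣ | N , closeʸ = M ℕ.⊔ N , λ m n m≥ n≥ →
  subst (λ d → ℚ.∣ d ∣ ℚ.< ε)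
    (sym (+-rearrange (seq x m) (seq y m) (seq x n) (seq y n)))
    (sum-< (seq x m ℚ.- seq x n) (seq y m ℚ.- seq y n)
      (closeˣ m n (ℕₚ.m⊔n≤o⇒m≤o M N m≥) (ℕₚ.m⊔n≤o⇒m≤o M N n≥))
      (closeʸ m n (ℕₚ.m⊔n≤o⇒n≤o M N m≥) (ℕₚ.m⊔n≤o⇒n≤o M N n≥)))

-_ : ℝ → ℝ
seq (- x) n = ℚ.- seq x n
cauchy (- x) ε ε>0 with cauchy x ε ε>0
... | N , close = N , λ m n m≥ n≥ → subst (ℚ._< ε)
  (sym (trans (cong ℚ.∣_∣ (-‿rearrange (seq x m) (seq x n)))
              (ℚₚ.∣-p∣≡∣p∣ (seq x m ℚ.- seq x n))))
  (close m n m≥ n≥)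

_-_ : ℝ → ℝ → ℝ
x - y = x + (- y)

_*_ : ℝ → ℝ → ℝ
seq (x * y) n = seq x n ℚ.* seq y n
cauchy (x * y) ε ε>0
  with eventually-bounded x | eventually-bounded y
... | A , A>0 , Nᴬ , ≤A | B , B>0 , Nᴮ , ≤B
  with scaled B>0 (half>0 ε>0) | scaled A>0 (half>0 ε>0)
... | α , α>0 , Bα≡ | β , β>0 , Aβ≡
  with cauchy x α α>0 | cauchy y β β>0
... | M , closeˣ | N , closeʸ =
  (Nᴬ ℕ.⊔ Nᴮ) ℕ.⊔ (M ℕ.⊔ N) , λ m n m≥ n≥ →
    let boundsᵐ = ℕₚ.m⊔n≤o⇒m≤o (Nᴬ ℕ.⊔ Nᴮ) (M ℕ.⊔ N) m≥
        boundsⁿ = ℕₚ.m⊔n≤o⇒m≤o (Nᴬ ℕ.⊔ Nᴮ) (M ℕ.⊔ N) n≥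
        closeᵐ  = ℕₚ.m⊔n≤o⇒n≤o (Nᴬ ℕ.⊔ Nᴮ) (M ℕ.⊔ N) m≥
        closeⁿ  = ℕₚ.m⊔n≤o⇒n≤o (Nᴬ ℕ.⊔ Nᴮ) (M ℕ.⊔ N) n≥
    in
    subst (λ d → ℚ.∣ d ∣ ℚ.< ε)
      (sym (*-rearrange (seq x m) (seq y m) (seq x n) (seq y n)))
      (sum-< (seq x m ℚ.* (seq y m ℚ.- seq y n))
             (seq y n ℚ.* (seq x m ℚ.- seq x n))
        (subst (ℚ.∣ seq x m ℚ.* (seq y m ℚ.- seq y n) ∣ ℚ.<_) Aβ≡
          (scaled-< {p = seq x m} {q = seq y m ℚ.- seq y n} A>0
            (≤A m (ℕₚ.m⊔n≤o⇒m≤o Nᴬ Nᴮ boundsᵐ))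
            (closeʸ m n (ℕₚ.m⊔n≤o⇒n≤o M N closeᵐ) (ℕₚ.m⊔n≤o⇒n≤o M N closeⁿ))))
        (subst (ℚ.∣ seq y n ℚ.* (seq x m ℚ.- seq x n) ∣ ℚ.<_) Bα≡
          (scaled-< {p = seq y n} {q = seq x m ℚ.- seq x n} B>0
            (≤B n (ℕₚ.m⊔n≤o⇒n≤o Nᴬ Nᴮ boundsⁿ))
            (closeˣ m n (ℕₚ.m⊔n≤o⇒m≤o M N closeᵐ) (ℕₚ.m⊔n≤o⇒m≤o M N closeⁿ)))))

------------------------------------------------------------------------
-- Complex numbers

record ℂ : Set where
  constructor _+i_
  field
    re im : ℝ

open ℂ public

infix 4 _≈ᶜ_

_≈ᶜ_ : ℂ → ℂ → Set
z ≈ᶜ w = re z ≈ re w × im z ≈ im w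

0ᶜ 1ᶜ : ℂ
0ᶜ = 0ℝ +i 0ℝ
1ᶜ = 1ℝ +i 0ℝ

infixl 6 _+ᶜ_
infixl 7 _*ᶜ_

_+ᶜ_ : ℂ → ℂ → ℂ
z +ᶜ w = (re z + re w) +i (im z + im w)

_*ᶜ_ : ℂ → ℂ → ℂ
z *ᶜ w = (re z * re w - im z * im w) +i (re z * im w + im z * re w)

-- r = ∣ z ∣, stated without the square root function.
IsModulus : ℂ → ℝ → Set
IsModulus z r = 0ℝ ≤ r × r * r ≈ re z * re z + im z * im z

------------------------------------------------------------------------
-- Eigenvalues and the spectral radius

Matrix : ℕ → Set
Matrix N = Fin N → Fin N → ℂ

sum : ∀ {N} → (Fin N → ℂ) → ℂ
sum = Vector.foldr _+ᶜ_ 0ᶜ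

IsEigenvalue : ∀ {N} → Matrix N → ℂ → Set
IsEigenvalue {N} A μ = Σ (Fin N → ℂ) λ v →
  ¬ (∀ i → v i ≈ᶜ 0ᶜ) × (∀ i → sum (λ j → A i j *ᶜ v j) ≈ᶜ μ *ᶜ v i)

-- r is the maximum modulus of the eigenvalues of A.  This determines r up
-- to _≈_.
IsSpectralRadius : ∀ {N} → Matrix N → ℝ → Set
IsSpectralRadius A r =
  (∃ λ μ → IsEigenvalue A μ × IsModulus μ r) ×
  (∀ μ s → IsEigenvalue A μ → IsModulus μ s → s ≤ r)

------------------------------------------------------------------------
-- Graphs

record Graph (N : ℕ) : Set where
  field
    adj     : Fin N → Fin N → Bool
    adj-sym : ∀ u v → adj u v ≡ adj v u
    irrefl  : ∀ u → adj u u ≡ false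

open Graph public

adjacencyMatrix : ∀ {N} → Graph N → Matrix N
adjacencyMatrix G u v = if adj G u v then 1ᶜ else 0ᶜ

-- Equality of edge sets.
_≐_ : ∀ {N} → Graph N → Graph N → Set
G ≐ H = ∀ u v → adj G u v ≡ adj H u v

_≅_ : ∀ {M N} → Graph M → Graph N → Set
_≅_ {M} {N} G H = Σ (Permutation M N) λ σ →
  ∀ u v → adj G u v ≡ adj H (σ ⟨$⟩ʳ u) (σ ⟨$⟩ʳ v)

infix 4 _≐_ _≅_

-- Each edge is listed once, with its smaller endpoint first; the components
-- other than u and v are propositions.
Edge : ∀ {N} → Graph N → Set
Edge {N} H = Σ (Fin N × Fin N) λ (u , v) → u Fin.< v × adj H u v ≡ true

-- H is taken with vertex set V itself: vertices of V outside V(H) would be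
-- isolated, and do not affect the edges.
IsRainbowCopy : ∀ {N k} → (Fin k → Graph N) → Graph N → Set
IsRainbowCopy {N} {k} 𝓖 H = Σ (Edge H ⤖ Fin k) λ φ →
  ∀ (e : Edge H) → let ((u , v) , _) = e in
    adj (𝓖 (Bijection.to φ e)) u v ≡ true

-- j is the successor of i modulo N.
CyclicSuc : ∀ {N} → Fin N → Fin N → Set
CyclicSuc {N} i j =
  suc (toℕ i) ≡ toℕ j ⊎ (suc (toℕ i) ≡ N × toℕ j ≡ 0)

IsHamiltonCycle : ∀ {N} → Graph N → Set
IsHamiltonCycle {N} H = 3 ℕ.≤ N × Σ (Permutation′ N) λ c →
  ∀ u v → adj H u v ≡ true ⇔
    ∃₂ λ i j → CyclicSuc i j ×
      ((u ≡ c ⟨$⟩ʳ i × v ≡ c ⟨$⟩ʳ j) ⊎ (u ≡ c ⟨$⟩ʳ j × v ≡ c ⟨$⟩ʳ i))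

HasRainbowHamiltonCycle : ∀ {N k} → (Fin k → Graph N) → Set
HasRainbowHamiltonCycle {N} 𝓖 =
  ∃ λ (H : Graph N) → IsHamiltonCycle H × IsRainbowCopy 𝓖 H

------------------------------------------------------------------------
-- Bipartite graphs

-- The bipartition is (X , ∁ X).
separates : ∀ {N} → Subset N → Fin N → Fin N → Bool
separates X u v = lookup X u xor lookup X v

record BipartiteGraph {N : ℕ} (X : Subset N) : Set where
  field
    graph    : Graph N
    crossing : ∀ u v → adj graph u v ≡ true → separates X u v ≡ true

open BipartiteGraph public

private
  separates-sym : ∀ {N} (X : Subset N) u v → separates X u v ≡ separates X v u
  separates-sym X u v = xor-comm (lookup X u) (lookup X v)

  separates-irrefl : ∀ {N} (X : Subset N) u → separates X u u ≡ false
  separates-irrefl X u = xor-same (lookup X u)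

  ∧-true : ∀ a b → a ∧ b ≡ true → a ≡ true
  ∧-true true _ _ = refl

K : ∀ s t → BipartiteGraph (replicate s inside ++ replicate t outside)
K s t = record
  { graph = record
    { adj     = separates X
    ; adj-sym = separates-sym X
    ; irrefl  = separates-irrefl X
    }
  ; crossing = λ _ _ eq → eq
  }
  where X = replicate s inside ++ replicate t outside

quasiComplement : ∀ {N} {X : Subset N} → BipartiteGraph X → BipartiteGraph X
quasiComplement {X = X} G = record
  { graph = record
    { adj     = λ u v → separates X u v ∧ not (adj (graph G) u v)
    ; adj-sym = λ u v →
        cong₂ (λ a b → a ∧ not b) (separates-sym X u v) (adj-sym (graph G) u v)
    ; irrefl  = λ u → cong (_∧ not (adj (graph G) u u)) (separates-irrefl X u)
    }
  ; crossing = λ u v → ∧-true (separates X u v) (not (adj (graph G) u v))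
  }

module _ {M N} {X₁ : Subset M} {X₂ : Subset N}
         (G₁ : BipartiteGraph X₁) (G₂ : BipartiteGraph X₂) where

  ⊔-adj : Fin M ⊎ Fin N → Fin M ⊎ Fin N → Bool
  ⊔-adj (inj₁ u) (inj₁ v) = adj (graph G₁) u v
  ⊔-adj (inj₂ u) (inj₂ v) = adj (graph G₂) u v
  ⊔-adj (inj₁ u) (inj₂ v) = lookup X₁ u xor lookup X₂ v
  ⊔-adj (inj₂ u) (inj₁ v) = lookup X₂ u xor lookup X₁ v

  private
    ⊔-sym : ∀ a b → ⊔-adj a b ≡ ⊔-adj b a
    ⊔-sym (inj₁ u) (inj₁ v) = adj-sym (graph G₁) u v
    ⊔-sym (inj₂ u) (inj₂ v) = adj-sym (graph G₂) u v
    ⊔-sym (inj₁ u) (inj₂ v) = xor-comm (lookup X₁ u) (lookup X₂ v)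
    ⊔-sym (inj₂ u) (inj₁ v) = xor-comm (lookup X₂ u) (lookup X₁ v)

    ⊔-irrefl : ∀ a → ⊔-adj a a ≡ false
    ⊔-irrefl (inj₁ u) = irrefl (graph G₁) u
    ⊔-irrefl (inj₂ u) = irrefl (graph G₂) u

    ⊔-crossing : ∀ a b → ⊔-adj a b ≡ true →
      [ lookup X₁ , lookup X₂ ]′ a xor [ lookup X₁ , lookup X₂ ]′ b ≡ true
    ⊔-crossing (inj₁ u) (inj₁ v) eq = crossing G₁ u v eq
    ⊔-crossing (inj₂ u) (inj₂ v) eq = crossing G₂ u v eq
    ⊔-crossing (inj₁ u) (inj₂ v) eq = eq
    ⊔-crossing (inj₂ u) (inj₁ v) eq = eq

  infixl 6 _⊔_

  _⊔_ : BipartiteGraph (X₁ ++ X₂)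
  _⊔_ = record
    { graph = record
      { adj     = λ u v → ⊔-adj (splitAt M u) (splitAt M v)
      ; adj-sym = λ u v → ⊔-sym (splitAt M u) (splitAt M v)
      ; irrefl  = λ u → ⊔-irrefl (splitAt M u)
      }
    ; crossing = λ u v eq → trans
        (cong₂ _xor_ (lookup-splitAt M X₁ X₂ u) (lookup-splitAt M X₁ X₂ v))
        (⊔-crossing (splitAt M u) (splitAt M v) eq)
    }

-- The part sizes use truncated subtraction; only n ≥ 1 is meaningful.
extremalGraph : ∀ n → Graph ((1 ℕ.+ (n ℕ.∸ 1)) ℕ.+ ((n ℕ.∸ 1) ℕ.+ 1))
extremalGraph n = graph (K 1 (n ℕ.∸ 1) ⊔ quasiComplement (K (n ℕ.∸ 1) 1))

{-# OPTIONS --safe #-}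

-- Summing the Cauchy–Schwarz bounds for an eigenvector over both parts gives ρ(G)² ≤ e(G), while
-- ρ₀² > n(n − 1) for the extremal graph; so every Gᵢ misses at most n − 1 of the n² crossing pairs.
-- Every crossing pair lies on two of the n rotations of a Hamilton cycle of K_{n,n}, so one of them
-- has at most 4n − 4 misses, counted over its 2n edges and the 2n colours.  By Hall's condition its
-- edges then have a rainbow colouring, unless one of its edges is dead, i.e. missing in all colours.
-- There is then only one dead edge yx; averaging over the n − 2 ways to remove it by reversing a
-- segment of the cycle yields a good cycle, unless every Gᵢ misses the same n − 1 pairs, all of
-- them at x or y.  If they are all at x, or all at y, then the Gᵢ are the extremal graph; otherwise
-- exchanging two vertices of the cycle makes some reversal succeed.
module Submission where

open import Defs hiding (_+_; _*_; _≤_; _≈_; -_; _-_; sum)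
open import Data.Fin.Base using (Fin)
open import Data.Fin.Subset using (Subset; ∁; ∣_∣)
open import Data.Nat.Base as ℕ using (ℕ; suc; z≤n; s≤s)
import Data.Nat.Properties as ℕₚ
open import Data.Product.Base using (_×_; _,_)
import Data.Rational.Properties as ℚₚ
open import Relation.Binary.PropositionalEquality using (_≡_; refl)
open import Relation.Nullary.Negation using (¬_)

-- Order and equality of these reals are undecidable, and an eigenvector is only known not to vanish
-- identically, so no inequality may be divided by its norm. The squared norm V is therefore carried
-- as a factor: if a graph had at most n(n - 1) edges, then V ≤ 0 and the vector would vanish. Edge
-- counts are naturals, so this refutation is a bound. For ρ₀ a lower bound suffices, so a single
-- explicit eigenvalue of the extremal graph serves, with no Perron-Frobenius theory. A block of
-- nonzero entries that obstructs a transversal of zeros in a 2n × 2n matrix, other than a full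
-- line, has at least 4n - 2 entries, which leaves room for the average 4n - 4; two dead edges would
-- already cost 4n. Dropping a dead edge frees 2n misses, so the two edges brought in by a reversal
-- may together be missed 2n times, provided neither is dead. All reversals fail only if every
-- colour spends its entire allowance of n - 1 missing pairs on the dead pair and on those candidate
-- edges; hence the rigid exception.

module Labellings where

  open import Algebra.Properties.CommutativeMonoid.Sum ℕₚ.+-0-commutativeMonoid using (sum)
  open import Data.Bool.Base using (Bool; true; false; not; _xor_; _∧_; if_then_else_)
  open import Data.Bool.Properties using (xor-same)
  open import Data.Fin.Base using (Fin; zero; suc; splitAt; join; _↑ˡ_; _↑ʳ_)
  open import Data.Fin.Permutation using (↔⇒≡)
  open import Data.Fin.Properties using (+↔⊎; splitAt-↑ˡ; splitAt-↑ʳ; splitAt-join; join-splitAt)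
  open import Data.Fin.Subset using (Subset; ∁; ∣_∣; inside; outside)
  open import Data.Nat.Base as ℕ using (ℕ; zero; suc)
  open import Data.Product.Base using (Σ; _×_; _,_; proj₁)
  open import Data.Sum.Base as Sum using (_⊎_; inj₁; inj₂; [_,_]′)
  open import Data.Vec.Base using ([]; _∷_; _++_; lookup; replicate)
  open import Data.Vec.Properties using (lookup-replicate; lookup-++ˡ; lookup-++ʳ)
  open import Function.Base using (_∘_)
  open import Function.Bundles using (_↔_; Inverse; mk↔ₛ′)
  open import Function.Construct.Composition using (_↔-∘_)
  open import Function.Construct.Symmetry using (↔-sym)
  open import Relation.Binary.PropositionalEquality using (_≡_; refl; sym; trans; cong; cong₂)
  open import Relation.Nullary.Negation using (contradiction)

  -- Labelled parts, and the extremal graph in coordinates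

  Labelling : ℕ → ℕ → Set
  Labelling n N = (Fin n ⊎ Fin n) ↔ Fin N

  left right : ∀ {n N} → Labelling n N → Fin n → Fin N
  left  L = Inverse.to L ∘ inj₁
  right L = Inverse.to L ∘ inj₂

  -- The pendant vertex may turn up in either part, whereas `pendant` always puts it on the right.
  swapSides : ∀ {n N} → Labelling n N → Labelling n N
  swapSides L = mk↔ₛ′ (Inverse.to L ∘ Sum.swap) (Sum.swap ∘ Inverse.from L)
    (λ v → trans (cong (Inverse.to L) (swap² (Inverse.from L v))) (Inverse.strictlyInverseˡ L v))
    (λ s → trans (cong Sum.swap (Inverse.strictlyInverseʳ L (Sum.swap s))) (swap² s))
    where
    swap² : ∀ {n} (s : Fin n ⊎ Fin n) → Sum.swap (Sum.swap s) ≡ s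
    swap² (inj₁ _) = refl
    swap² (inj₂ _) = refl

  IsBipartite : ∀ {n N} → Graph N → Labelling n N → Set
  IsBipartite G L =
    (∀ a b → adj G (left L a) (left L b) ≡ false) ×
    (∀ a b → adj G (right L a) (right L b) ≡ false)

  ⟦_⟧ : Bool → ℕ
  ⟦ b ⟧ = if b then 1 else 0

  edgeCount : ∀ {n N} → Graph N → Labelling n N → ℕ
  edgeCount G L = sum (λ a → sum (λ b → ⟦ adj G (left L a) (right L b) ⟧))

  -- The biadjacency matrix of the extremal graph: column zero is the vertex of degree one.
  pendant : ∀ {n} → Fin n → Fin n → Bool
  pendant zero    _       = true
  pendant (suc _) zero    = false
  pendant (suc _) (suc _) = true

  module _ (M : ℕ) where

    private
      -- The left part collects the inside vertices of both factors, the right part the outside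
      -- ones. Index zero is the centre of K_{1,M} on the left, and on the right the outside vertex
      -- of the quasi-complement, whose only neighbour is that centre.
      place : Fin (suc M) ⊎ Fin (suc M) → Fin (1 ℕ.+ M) ⊎ Fin (M ℕ.+ 1)
      place (inj₁ zero)    = inj₁ zero
      place (inj₁ (suc i)) = inj₂ (i ↑ˡ 1)
      place (inj₂ zero)    = inj₂ (M ↑ʳ zero)
      place (inj₂ (suc i)) = inj₁ (suc i)

      unplace₂ : Fin M ⊎ Fin 1 → Fin (suc M) ⊎ Fin (suc M)
      unplace₂ (inj₁ i) = inj₁ (suc i)
      unplace₂ (inj₂ _) = inj₂ zero

      unplace : Fin (1 ℕ.+ M) ⊎ Fin (M ℕ.+ 1) → Fin (suc M) ⊎ Fin (suc M)
      unplace (inj₁ zero)    = inj₁ zero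
      unplace (inj₁ (suc i)) = inj₂ (suc i)
      unplace (inj₂ w)       = unplace₂ (splitAt M w)

      place-unplace₂ : ∀ s → place (unplace₂ s) ≡ inj₂ (join M 1 s)
      place-unplace₂ (inj₁ i)    = refl
      place-unplace₂ (inj₂ zero) = refl

      place-unplace : ∀ s → place (unplace s) ≡ s
      place-unplace (inj₁ zero)    = refl
      place-unplace (inj₁ (suc i)) = refl
      place-unplace (inj₂ w)       =
        trans (place-unplace₂ (splitAt M w)) (cong inj₂ (join-splitAt M 1 w))

      unplace-place : ∀ s → unplace (place s) ≡ s
      unplace-place (inj₁ zero)    = refl
      unplace-place (inj₁ (suc i)) = cong unplace₂ (splitAt-↑ˡ M i 1)
      unplace-place (inj₂ zero)    = cong unplace₂ (splitAt-↑ʳ M 1 zero)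
      unplace-place (inj₂ (suc i)) = refl

    extremalLabelling : Labelling (suc M) ((1 ℕ.+ M) ℕ.+ (M ℕ.+ 1))
    extremalLabelling = ↔-sym +↔⊎ ↔-∘ mk↔ₛ′ place unplace place-unplace unplace-place

    private
      E = extremalGraph (suc M)
      L = extremalLabelling
      K₁ = K 1 M
      K₂ = quasiComplement (K M 1)
      X₁ = replicate 1 inside ++ replicate M outside
      X₂ = replicate M inside ++ replicate 1 outside

      adj-place : ∀ s t → adj E (Inverse.to L s) (Inverse.to L t) ≡ ⊔-adj K₁ K₂ (place s) (place t)
      adj-place s t = cong₂ (⊔-adj K₁ K₂)
        (splitAt-join (1 ℕ.+ M) (M ℕ.+ 1) (place s)) (splitAt-join (1 ℕ.+ M) (M ℕ.+ 1) (place t))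

      X₁-suc : ∀ i → lookup X₁ (suc i) ≡ false
      X₁-suc i = lookup-replicate i outside

      X₂-inside : ∀ i → lookup X₂ (i ↑ˡ 1) ≡ true
      X₂-inside i = trans (lookup-++ˡ (replicate M inside) (replicate 1 outside) i) (lookup-replicate i inside)

      X₂-outside : lookup X₂ (M ↑ʳ zero) ≡ false
      X₂-outside = lookup-++ʳ (replicate M inside) (replicate 1 outside) zero

      -- The adjacency here is `b ∧ not b`, since K_{M,1} already joins every separated pair. The
      -- hypothesis gives the bit `b` a name, so that callers pass `refl`.
      within₂ : ∀ u v {b} → lookup X₂ u xor lookup X₂ v ≡ b → adj (graph K₂) u v ≡ false
      within₂ u v {b} eq = trans (cong (λ c → c ∧ not c) eq) (b∧¬b b)
        where
        b∧¬b : ∀ b → b ∧ not b ≡ false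
        b∧¬b true  = refl
        b∧¬b false = refl

    extremal-biadjacency : ∀ a b → adj E (left L a) (right L b) ≡ pendant a b
    extremal-biadjacency zero zero = trans (adj-place (inj₁ zero) (inj₂ zero)) (cong (true xor_) X₂-outside)
    extremal-biadjacency zero (suc j) = trans (adj-place (inj₁ zero) (inj₂ (suc j))) (cong (true xor_) (X₁-suc j))
    extremal-biadjacency (suc i) zero = trans (adj-place (inj₁ (suc i)) (inj₂ zero))
      (within₂ (i ↑ˡ 1) (M ↑ʳ zero) refl)
    extremal-biadjacency (suc i) (suc j) = trans (adj-place (inj₁ (suc i)) (inj₂ (suc j)))
      (cong₂ _xor_ (X₂-inside i) (X₁-suc j))

    extremal-bipartite : IsBipartite E L
    extremal-bipartite = left-false , right-false
      where
      left-false : ∀ a b → adj E (left L a) (left L b) ≡ false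
      left-false zero zero = irrefl E (left L zero)
      left-false zero (suc j) = trans (adj-place (inj₁ zero) (inj₁ (suc j))) (cong (true xor_) (X₂-inside j))
      left-false (suc i) zero = trans (adj-place (inj₁ (suc i)) (inj₁ zero)) (cong (_xor true) (X₂-inside i))
      left-false (suc i) (suc j) = trans (adj-place (inj₁ (suc i)) (inj₁ (suc j)))
        (within₂ (i ↑ˡ 1) (j ↑ˡ 1) refl)
      right-false : ∀ a b → adj E (right L a) (right L b) ≡ false
      right-false zero zero = irrefl E (right L zero)
      right-false zero (suc j) = trans (adj-place (inj₂ zero) (inj₂ (suc j))) (cong₂ _xor_ X₂-outside (X₁-suc j))
      right-false (suc i) zero = trans (adj-place (inj₂ (suc i)) (inj₂ zero)) (cong₂ _xor_ (X₁-suc i) X₂-outside)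
      right-false (suc i) (suc j) = trans (adj-place (inj₂ (suc i)) (inj₂ (suc j))) (cong₂ _xor_ (X₁-suc i) (X₁-suc j))

  -- Enumerating the two sides of a balanced bipartition

  Separates : ∀ {n N} → Subset N → Labelling n N → Set
  Separates X L = (∀ a → lookup X (left L a) ≡ inside) × (∀ b → lookup X (right L b) ≡ outside)

  private
    pushˡ : ∀ {p q N} → (Fin p ⊎ Fin q) ↔ Fin N → (Fin (suc p) ⊎ Fin q) ↔ Fin (suc N)
    pushˡ {p} {q} {N} e = mk↔ₛ′ to from to-from from-to
      where
      to : Fin (suc p) ⊎ Fin q → Fin (suc N)
      to (inj₁ zero)    = zero
      to (inj₁ (suc a)) = suc (Inverse.to e (inj₁ a))
      to (inj₂ b)       = suc (Inverse.to e (inj₂ b))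
      raise : Fin p ⊎ Fin q → Fin (suc p) ⊎ Fin q
      raise (inj₁ a) = inj₁ (suc a)
      raise (inj₂ b) = inj₂ b
      from : Fin (suc N) → Fin (suc p) ⊎ Fin q
      from zero    = inj₁ zero
      from (suc v) = raise (Inverse.from e v)
      to-raise : ∀ s → to (raise s) ≡ suc (Inverse.to e s)
      to-raise (inj₁ a) = refl
      to-raise (inj₂ b) = refl
      to-from : ∀ v → to (from v) ≡ v
      to-from zero    = refl
      to-from (suc v) = trans (to-raise (Inverse.from e v)) (cong suc (Inverse.strictlyInverseˡ e v))
      from-to : ∀ s → from (to s) ≡ s
      from-to (inj₁ zero)    = refl
      from-to (inj₁ (suc a)) = cong raise (Inverse.strictlyInverseʳ e (inj₁ a))
      from-to (inj₂ b)       = cong raise (Inverse.strictlyInverseʳ e (inj₂ b))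

    swap-↔ : ∀ {A B : Set} → (A ⊎ B) ↔ (B ⊎ A)
    swap-↔ = mk↔ₛ′ [ inj₂ , inj₁ ]′ [ inj₂ , inj₁ ]′
      (λ { (inj₁ _) → refl ; (inj₂ _) → refl }) (λ { (inj₁ _) → refl ; (inj₂ _) → refl })

  -- Recursion on the subset, so that both sizes compute. An outside vertex is handled by `pushˡ` as
  -- well, conjugated by exchanging the summands.
  enumerate : ∀ {N} (X : Subset N) → Σ ((Fin ∣ X ∣ ⊎ Fin ∣ ∁ X ∣) ↔ Fin N) λ e →
    (∀ a → lookup X (Inverse.to e (inj₁ a)) ≡ inside) × (∀ b → lookup X (Inverse.to e (inj₂ b)) ≡ outside)
  enumerate [] = mk↔ₛ′ (λ { (inj₁ ()) ; (inj₂ ()) }) (λ ()) (λ ()) (λ { (inj₁ ()) ; (inj₂ ()) }) , (λ ()) , (λ ())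
  enumerate (true ∷ X) =
    let e , e-inside , e-outside = enumerate X
    in pushˡ e , (λ { zero → refl ; (suc a) → e-inside a }) , e-outside
  enumerate (false ∷ X) =
    let e , e-inside , e-outside = enumerate X
    in pushˡ (e ↔-∘ swap-↔) ↔-∘ swap-↔ , e-inside , (λ { zero → refl ; (suc b) → e-outside b })

  -- The bijection of `enumerate` forces ∣X∣ + ∣∁X∣ = N, and balance halves this.
  balanced-labelling : ∀ {n N} (X : Subset N) → ∣ X ∣ ≡ ∣ ∁ X ∣ → N ≡ 2 ℕ.* n → Σ (Labelling n N) (Separates X)
  balanced-labelling {n} {N} X balanced N≡2n =
    resize ∣X∣≡n (trans (sym balanced) ∣X∣≡n) (enumerate X)
    where
    N≡ : ∣ X ∣ ℕ.+ ∣ ∁ X ∣ ≡ N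
    N≡ = ↔⇒≡ (proj₁ (enumerate X) ↔-∘ +↔⊎)
    ∣X∣≡n : ∣ X ∣ ≡ n
    ∣X∣≡n = ℕₚ.*-cancelˡ-≡ ∣ X ∣ n 2 (trans (cong (∣ X ∣ ℕ.+_) (trans (ℕₚ.+-identityʳ ∣ X ∣) balanced)) (trans N≡ N≡2n))
    resize : ∀ {p q} → p ≡ n → q ≡ n → Σ ((Fin p ⊎ Fin q) ↔ Fin N) (λ e →
      (∀ a → lookup X (Inverse.to e (inj₁ a)) ≡ inside) × (∀ b → lookup X (Inverse.to e (inj₂ b)) ≡ outside)) →
      Σ (Labelling n N) (Separates X)
    resize refl refl labelled = labelled

  separated-bipartite : ∀ {n N} {X : Subset N} (G : BipartiteGraph X) (L : Labelling n N) →
                        Separates X L → IsBipartite (graph G) L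
  separated-bipartite {X = X} G L (l , r) = (λ a b → nonadjacent (trans (l a) (sym (l b))))
                                          , (λ a b → nonadjacent (trans (r a) (sym (r b))))
    where
    nonadjacent : ∀ {u v} → lookup X u ≡ lookup X v → adj (graph G) u v ≡ false
    nonadjacent {u} {v} eq with adj (graph G) u v in uv
    ... | false = refl
    ... | true  = contradiction
      (trans (sym (trans (cong (_xor lookup X v) eq) (xor-same (lookup X v)))) (crossing G u v uv)) λ ()

  PendantLabelled : ∀ {n N} → Graph N → Labelling n N → Set
  PendantLabelled G L = ∀ a b → adj G (left L a) (right L b) ≡ pendant a b

  -- A bipartite graph is determined by its biadjacency matrix. Both equality within the family and
  -- isomorphism with the extremal graph are read off from this.
  pendant-unique : ∀ {n N N′} (G : Graph N) (H : Graph N′) (L : Labelling n N) (L′ : Labelling n N′) →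
    IsBipartite G L → IsBipartite H L′ → PendantLabelled G L → PendantLabelled H L′ →
    ∀ s t → adj G (Inverse.to L s) (Inverse.to L t) ≡ adj H (Inverse.to L′ s) (Inverse.to L′ t)
  pendant-unique G H L L′ (l , r) (l′ , r′) p p′ (inj₁ a) (inj₁ b) = trans (l a b) (sym (l′ a b))
  pendant-unique G H L L′ (l , r) (l′ , r′) p p′ (inj₁ a) (inj₂ b) = trans (p a b) (sym (p′ a b))
  pendant-unique G H L L′ (l , r) (l′ , r′) p p′ (inj₂ a) (inj₁ b) =
    trans (adj-sym G _ _) (trans (trans (p b a) (sym (p′ b a))) (adj-sym H _ _))
  pendant-unique G H L L′ (l , r) (l′ , r′) p p′ (inj₂ a) (inj₂ b) = trans (r a b) (sym (r′ a b))

  pendant-≅ : ∀ {n N N′} (G : Graph N) (H : Graph N′) (L : Labelling n N) (L′ : Labelling n N′) →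
    IsBipartite G L → IsBipartite H L′ → PendantLabelled G L → PendantLabelled H L′ → G ≅ H
  pendant-≅ G H L L′ bip bip′ p p′ = L′ ↔-∘ ↔-sym L , λ u v → trans
    (cong₂ (adj G) (sym (Inverse.strictlyInverseˡ L u)) (sym (Inverse.strictlyInverseˡ L v)))
    (pendant-unique G H L L′ bip bip′ p p′ (Inverse.from L u) (Inverse.from L v))

  pendant-≐ : ∀ {n N} (G H : Graph N) (L : Labelling n N) →
    IsBipartite G L → IsBipartite H L → PendantLabelled G L → PendantLabelled H L → G ≐ H
  pendant-≐ G H L bip bip′ p p′ u v = trans
    (cong₂ (adj G) (sym (Inverse.strictlyInverseˡ L u)) (sym (Inverse.strictlyInverseˡ L v)))
    (trans (pendant-unique G H L L bip bip′ p p′ (Inverse.from L u) (Inverse.from L v))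
      (cong₂ (adj H) (Inverse.strictlyInverseˡ L u) (Inverse.strictlyInverseˡ L v)))

open Labellings

module Spectral where

  open Defs using (_+_; _*_; _≤_; _≈_; -_; _-_)
  open import Algebra.Bundles using (CommutativeRing)
  import Algebra.Properties.CommutativeMonoid.Sum ℕₚ.+-0-commutativeMonoid as ℕ-Sum
  open import Algebra.Properties.Semiring.Sum (CommutativeRing.semiring ℚₚ.+-*-commutativeRing)
  open import Data.Bool.Base using (Bool; true; false; if_then_else_)
  open import Data.Fin.Base using (Fin; zero; suc; _↑ˡ_; _↑ʳ_)
  open import Data.Fin.Properties using (+↔⊎; splitAt-↑ˡ; splitAt-↑ʳ)
  open import Data.Integer.Base as ℤ using (+_; -[1+_])
  import Data.Integer.Properties as ℤₚ
  open import Data.Nat.Base as ℕ using (ℕ; zero; suc; z≤n; s≤s)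
  import Data.Nat.Coprimality as Coprimality
  open import Data.Product.Base using (Σ; ∃; _×_; _,_; proj₁; proj₂)
  open import Data.Rational.Base as ℚ using (ℚ; 0ℚ; 1ℚ; ½; mkℚ)
  open import Data.Rational.Solver using (module +-*-Solver)
  import Data.Rational.Unnormalised.Base as ℚᵘ
  import Data.Rational.Unnormalised.Properties as ℚᵘₚ
  open import Data.Sum.Base using (_⊎_; inj₁; inj₂)
  open import Function.Base using (_∘_)
  open import Function.Bundles using (Inverse)
  open import Function.Construct.Composition using (_↔-∘_)
  open import Relation.Binary.PropositionalEquality using (_≡_; refl; sym; trans; cong; cong₂; subst; subst₂)
  open import Relation.Nullary.Decidable.Core using (dec⇒maybe)
  open import Relation.Nullary.Negation using (¬_)
  open import Tactic.RingSolver using (solve-∀)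
  open import Tactic.RingSolver.Core.AlmostCommutativeRing using (AlmostCommutativeRing; fromCommutativeRing)
  open +-*-Solver using (solve; _:=_; _:+_; _:*_; _:-_; :-_)

  -- Limits of rational sequences

  ℚ-ring : AlmostCommutativeRing _ _
  ℚ-ring = fromCommutativeRing ℚₚ.+-*-commutativeRing (λ q → dec⇒maybe (0ℚ ℚₚ.≟ q))

  -- Stated for rational sequences rather than reals: `x ≈ y` is by definition `Null` of the
  -- termwise difference, and ring identities can then be applied term by term.
  Null : (ℕ → ℚ) → Set
  Null a = ∀ ε → 0ℚ ℚ.< ε → ∃ λ N → ∀ n → N ℕ.≤ n → ℚ.∣ a n ∣ ℚ.< ε

  -- The limit inferior is at least 0; the order of the reals is this property of the difference.
  EventuallyNonneg : (ℕ → ℚ) → Set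
  EventuallyNonneg a = ∀ ε → 0ℚ ℚ.< ε → ∃ λ N → ∀ n → N ℕ.≤ n → 0ℚ ℚ.≤ a n ℚ.+ ε

  0≤+ : ∀ {p q} → 0ℚ ℚ.≤ p → 0ℚ ℚ.≤ q → 0ℚ ℚ.≤ p ℚ.+ q
  0≤+ p≥0 q≥0 = ℚₚ.+-mono-≤ p≥0 q≥0

  0≤*ℚ : ∀ {p q} → 0ℚ ℚ.≤ p → 0ℚ ℚ.≤ q → 0ℚ ℚ.≤ p ℚ.* q
  0≤*ℚ {p} {q} p≥0 q≥0 = subst (ℚ._≤ p ℚ.* q) (ℚₚ.*-zeroʳ p)
    (ℚₚ.*-monoˡ-≤-nonNeg p {{ℚ.nonNegative p≥0}} q≥0)

  0≤² : ∀ p → 0ℚ ℚ.≤ p ℚ.* p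
  0≤² p with ℚₚ.≤-total 0ℚ p
  ... | inj₁ p≥0 = 0≤*ℚ p≥0 p≥0
  ... | inj₂ p≤0 = subst (0ℚ ℚ.≤_) (solve 1 (λ x → :- x :* :- x := x :* x) refl p)
    (0≤*ℚ (ℚₚ.neg-antimono-≤ p≤0) (ℚₚ.neg-antimono-≤ p≤0))

  ≤⇒0≤- : ∀ {p q} → p ℚ.≤ q → 0ℚ ℚ.≤ q ℚ.- p
  ≤⇒0≤- {p} {q} p≤q = subst (ℚ._≤ q ℚ.- p) (ℚₚ.+-inverseʳ p) (ℚₚ.+-monoˡ-≤ (ℚ.- p) p≤q)

  0≤-⇒≤ : ∀ {p q} → 0ℚ ℚ.≤ q ℚ.- p → p ℚ.≤ q
  0≤-⇒≤ {p} {q} q-p≥0 = subst₂ ℚ._≤_ (ℚₚ.+-identityˡ p)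
    (solve 2 (λ p q → q :- p :+ p := q) refl p q) (ℚₚ.+-monoˡ-≤ p q-p≥0)

  0<*ℚ : ∀ {p q} → 0ℚ ℚ.< p → 0ℚ ℚ.< q → 0ℚ ℚ.< p ℚ.* q
  0<*ℚ {p} {q} p>0 q>0 = ℚₚ.positive⁻¹ (p ℚ.* q)
    {{ℚₚ.pos*pos⇒pos p {{ℚ.positive p>0}} q {{ℚ.positive q>0}}}}

  0<½ : 0ℚ ℚ.< ½
  0<½ = ℚₚ.positive⁻¹ ½

  halves : ∀ ε → ½ ℚ.* ε ℚ.+ ½ ℚ.* ε ≡ ε
  halves ε = trans (sym (ℚₚ.*-distribʳ-+ ε ½ ½)) (ℚₚ.*-identityˡ ε)

  divide : ∀ {B ε} → 0ℚ ℚ.< B → 0ℚ ℚ.< ε → ∃ λ δ → 0ℚ ℚ.< δ × B ℚ.* δ ≡ ε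
  divide {B} {ε} B>0 ε>0 = ℚ.1/_ B {{nz}} ℚ.* ε
    , 0<*ℚ (ℚₚ.positive⁻¹ (ℚ.1/_ B {{nz}}) {{ℚₚ.1/pos⇒pos B {{pos}}}}) ε>0
    , trans (sym (ℚₚ.*-assoc B (ℚ.1/_ B {{nz}}) ε))
        (trans (cong (ℚ._* ε) (ℚₚ.*-inverseʳ B {{nz}})) (ℚₚ.*-identityˡ ε))
    where
    pos = ℚ.positive B>0
    nz  = ℚₚ.pos⇒nonZero B {{pos}}

  ≤∣∣ : ∀ p → p ℚ.≤ ℚ.∣ p ∣
  ≤∣∣ p with ℚₚ.≤-total 0ℚ p
  ... | inj₁ p≥0 = ℚₚ.≤-reflexive (sym (ℚₚ.0≤p⇒∣p∣≡p p≥0))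
  ... | inj₂ p≤0 = ℚₚ.≤-trans p≤0 (ℚₚ.0≤∣p∣ p)

  ∣∣≤ : ∀ {p q} → p ℚ.≤ q → ℚ.- p ℚ.≤ q → ℚ.∣ p ∣ ℚ.≤ q
  ∣∣≤ {p} p≤q -p≤q with ℚₚ.∣p∣≡p∨∣p∣≡-p p
  ... | inj₁ eq rewrite eq = p≤q
  ... | inj₂ eq rewrite eq = -p≤q

  bounded : ∀ x → ∃ λ B → 0ℚ ℚ.< B × ∃ λ N → ∀ n → N ℕ.≤ n → ℚ.∣ seq x n ∣ ℚ.≤ B
  bounded x with cauchy x 1ℚ (ℚₚ.positive⁻¹ 1ℚ)
  ... | N , close = 1ℚ ℚ.+ ℚ.∣ seq x N ∣
    , ℚₚ.+-mono-<-≤ (ℚₚ.positive⁻¹ 1ℚ) (ℚₚ.0≤∣p∣ (seq x N)) , N , λ n N≤n → begin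
      ℚ.∣ seq x n ∣
        ≡⟨ cong ℚ.∣_∣ (solve 2 (λ a b → a := a :- b :+ b) refl (seq x n) (seq x N)) ⟩
      ℚ.∣ seq x n ℚ.- seq x N ℚ.+ seq x N ∣
        ≤⟨ ℚₚ.∣p+q∣≤∣p∣+∣q∣ (seq x n ℚ.- seq x N) (seq x N) ⟩
      ℚ.∣ seq x n ℚ.- seq x N ∣ ℚ.+ ℚ.∣ seq x N ∣
        ≤⟨ ℚₚ.+-monoˡ-≤ ℚ.∣ seq x N ∣ (ℚₚ.<⇒≤ (close n N N≤n ℕₚ.≤-refl)) ⟩
      1ℚ ℚ.+ ℚ.∣ seq x N ∣ ∎
    where open ℚₚ.≤-Reasoning

  Null-resp : ∀ {a b} → (∀ n → a n ≡ b n) → Null a → Null b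
  Null-resp eq a→0 ε ε>0 with a→0 ε ε>0
  ... | N , small = N , λ n N≤n → subst (λ d → ℚ.∣ d ∣ ℚ.< ε) (eq n) (small n N≤n)

  Null-0 : Null (λ _ → 0ℚ)
  Null-0 ε ε>0 = 0 , λ _ _ → ε>0

  Null-+ : ∀ {a b} → Null a → Null b → Null (λ n → a n ℚ.+ b n)
  Null-+ {a} {b} a→0 b→0 ε ε>0
    with a→0 (½ ℚ.* ε) (0<*ℚ 0<½ ε>0) | b→0 (½ ℚ.* ε) (0<*ℚ 0<½ ε>0)
  ... | M , smallᵃ | N , smallᵇ = M ℕ.⊔ N , λ n n≥ → ℚₚ.≤-<-trans
    (ℚₚ.∣p+q∣≤∣p∣+∣q∣ (a n) (b n))
    (subst (ℚ.∣ a n ∣ ℚ.+ ℚ.∣ b n ∣ ℚ.<_) (halves ε)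
      (ℚₚ.+-mono-< (smallᵃ n (ℕₚ.m⊔n≤o⇒m≤o M N n≥)) (smallᵇ n (ℕₚ.m⊔n≤o⇒n≤o M N n≥))))

  Null-neg : ∀ {a} → Null a → Null (λ n → ℚ.- a n)
  Null-neg {a} a→0 ε ε>0 with a→0 ε ε>0
  ... | N , small = N , λ n N≤n → subst (ℚ._< ε) (sym (ℚₚ.∣-p∣≡∣p∣ (a n))) (small n N≤n)

  Null-*ˡ : ∀ x {a} → Null a → Null (λ n → seq x n ℚ.* a n)
  Null-*ˡ x {a} a→0 ε ε>0 =
    let B , B>0 , M , x≤B = bounded x
        δ , δ>0 , Bδ≡ε    = divide B>0 ε>0
        N , small         = a→0 δ δ>0
    in M ℕ.⊔ N , λ n n≥ → begin-strict
    ℚ.∣ seq x n ℚ.* a n ∣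
      ≡⟨ ℚₚ.∣p*q∣≡∣p∣*∣q∣ (seq x n) (a n) ⟩
    ℚ.∣ seq x n ∣ ℚ.* ℚ.∣ a n ∣
      ≤⟨ ℚₚ.*-monoʳ-≤-nonNeg ℚ.∣ a n ∣ {{ℚₚ.∣-∣-nonNeg (a n)}} (x≤B n (ℕₚ.m⊔n≤o⇒m≤o M N n≥)) ⟩
    B ℚ.* ℚ.∣ a n ∣
      <⟨ ℚₚ.*-monoʳ-<-pos B {{ℚ.positive B>0}} (small n (ℕₚ.m⊔n≤o⇒n≤o M N n≥)) ⟩
    B ℚ.* δ
      ≡⟨ Bδ≡ε ⟩
    ε ∎
    where open ℚₚ.≤-Reasoning

  Nonneg-resp : ∀ {a b} → (∀ n → a n ≡ b n) → EventuallyNonneg a → EventuallyNonneg b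
  Nonneg-resp eq a≥0 ε ε>0 with a≥0 ε ε>0
  ... | N , bound = N , λ n N≤n → subst (λ d → 0ℚ ℚ.≤ d ℚ.+ ε) (eq n) (bound n N≤n)

  pointwise-Nonneg : ∀ {a} → (∀ n → 0ℚ ℚ.≤ a n) → EventuallyNonneg a
  pointwise-Nonneg a≥0 ε ε>0 = 0 , λ n _ → 0≤+ (a≥0 n) (ℚₚ.<⇒≤ ε>0)

  Nonneg-+ : ∀ {a b} → EventuallyNonneg a → EventuallyNonneg b →
             EventuallyNonneg (λ n → a n ℚ.+ b n)
  Nonneg-+ {a} {b} a≥0 b≥0 ε ε>0
    with a≥0 (½ ℚ.* ε) (0<*ℚ 0<½ ε>0) | b≥0 (½ ℚ.* ε) (0<*ℚ 0<½ ε>0)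
  ... | M , boundᵃ | N , boundᵇ = M ℕ.⊔ N , λ n n≥ → subst (0ℚ ℚ.≤_)
    (trans (solve 3 (λ a b e → a :+ e :+ (b :+ e) := a :+ b :+ (e :+ e)) refl
        (a n) (b n) (½ ℚ.* ε))
      (cong (a n ℚ.+ b n ℚ.+_) (halves ε)))
    (0≤+ (boundᵃ n (ℕₚ.m⊔n≤o⇒m≤o M N n≥)) (boundᵇ n (ℕₚ.m⊔n≤o⇒n≤o M N n≥)))

  Null⇒Nonneg : ∀ {a} → Null a → EventuallyNonneg a
  Null⇒Nonneg {a} a→0 ε ε>0 with a→0 ε ε>0
  ... | N , small = N , λ n N≤n → subst (0ℚ ℚ.≤_)
    (solve 2 (λ a e → e :- (:- a) := a :+ e) refl (a n) ε)
    (≤⇒0≤- (ℚₚ.≤-trans (≤∣∣ (ℚ.- a n))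
      (ℚₚ.<⇒≤ (subst (ℚ._< ε) (sym (ℚₚ.∣-p∣≡∣p∣ (a n))) (small n N≤n)))))

  Nonneg-antisym : ∀ {a} → EventuallyNonneg a → EventuallyNonneg (λ n → ℚ.- a n) → Null a
  Nonneg-antisym {a} a≥0 a≤0 ε ε>0
    with a≥0 (½ ℚ.* ε) (0<*ℚ 0<½ ε>0) | a≤0 (½ ℚ.* ε) (0<*ℚ 0<½ ε>0)
  ... | M , lower | N , upper = M ℕ.⊔ N , λ n n≥ → ℚₚ.≤-<-trans
    (∣∣≤ (0≤-⇒≤ (subst (0ℚ ℚ.≤_) (solve 2 (λ a e → :- a :+ e := e :- a) refl (a n) (½ ℚ.* ε))
           (upper n (ℕₚ.m⊔n≤o⇒n≤o M N n≥))))
         (0≤-⇒≤ (subst (0ℚ ℚ.≤_) (solve 2 (λ a e → a :+ e := e :- (:- a)) refl (a n) (½ ℚ.* ε))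
           (lower n (ℕₚ.m⊔n≤o⇒m≤o M N n≥)))))
    (subst₂ ℚ._<_ (ℚₚ.+-identityʳ (½ ℚ.* ε)) (halves ε)
      (ℚₚ.+-monoʳ-< (½ ℚ.* ε) (0<*ℚ 0<½ ε>0)))

  -- From 0 ≤ (a + δ)(b + δ), where δ (a + b + δ) ≤ ε.
  Nonneg-* : ∀ x y → EventuallyNonneg (seq x) → EventuallyNonneg (seq y) →
             EventuallyNonneg (λ n → seq x n ℚ.* seq y n)
  Nonneg-* x y x≥0 y≥0 ε ε>0 =
    let A , A>0 , Nᴬ , x≤A = bounded x
        B , B>0 , Nᴮ , y≤B = bounded y
        C>0                = ℚₚ.+-mono-< (ℚₚ.+-mono-< A>0 B>0) ε>0
        η , η>0 , Cη≡ε     = divide C>0 ε>0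
        δ>0                = 0<⊓ η>0 ε>0
        M , boundˣ         = x≥0 (η ℚ.⊓ ε) δ>0
        N , boundʸ         = y≥0 (η ℚ.⊓ ε) δ>0
    in (Nᴬ ℕ.⊔ Nᴮ) ℕ.⊔ (M ℕ.⊔ N) , λ n n≥ →
      let n≥ᴬᴮ = ℕₚ.m⊔n≤o⇒m≤o (Nᴬ ℕ.⊔ Nᴮ) (M ℕ.⊔ N) n≥
          n≥ᴹᴺ = ℕₚ.m⊔n≤o⇒n≤o (Nᴬ ℕ.⊔ Nᴮ) (M ℕ.⊔ N) n≥
      in estimate C>0 Cη≡ε δ>0 (ℚₚ.p⊓q≤p η ε) (ℚₚ.p⊓q≤q η ε)
        (ℚₚ.≤-trans (≤∣∣ (seq x n)) (x≤A n (ℕₚ.m⊔n≤o⇒m≤o Nᴬ Nᴮ n≥ᴬᴮ)))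
        (ℚₚ.≤-trans (≤∣∣ (seq y n)) (y≤B n (ℕₚ.m⊔n≤o⇒n≤o Nᴬ Nᴮ n≥ᴬᴮ)))
        (boundˣ n (ℕₚ.m⊔n≤o⇒m≤o M N n≥ᴹᴺ)) (boundʸ n (ℕₚ.m⊔n≤o⇒n≤o M N n≥ᴹᴺ))
    where
    0<⊓ : ∀ {p q} → 0ℚ ℚ.< p → 0ℚ ℚ.< q → 0ℚ ℚ.< p ℚ.⊓ q
    0<⊓ {p} {q} p>0 q>0 with ℚₚ.≤-total p q
    ... | inj₁ p≤q = subst (0ℚ ℚ.<_) (sym (ℚₚ.p≤q⇒p⊓q≡p p≤q)) p>0
    ... | inj₂ q≤p = subst (0ℚ ℚ.<_) (sym (ℚₚ.p≥q⇒p⊓q≡q q≤p)) q>0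
    identity : ∀ a b C δ η →
      (a ℚ.+ δ) ℚ.* (b ℚ.+ δ) ℚ.+ δ ℚ.* (C ℚ.- (a ℚ.+ b ℚ.+ δ)) ℚ.+ C ℚ.* (η ℚ.- δ)
      ≡ a ℚ.* b ℚ.+ C ℚ.* η
    identity = solve-∀ ℚ-ring
    estimate : ∀ {a b A B ε δ η} → 0ℚ ℚ.< A ℚ.+ B ℚ.+ ε → (A ℚ.+ B ℚ.+ ε) ℚ.* η ≡ ε →
      0ℚ ℚ.< δ → δ ℚ.≤ η → δ ℚ.≤ ε → a ℚ.≤ A → b ℚ.≤ B →
      0ℚ ℚ.≤ a ℚ.+ δ → 0ℚ ℚ.≤ b ℚ.+ δ → 0ℚ ℚ.≤ a ℚ.* b ℚ.+ ε
    estimate {a} {b} {A} {B} {ε} {δ} {η} C>0 Cη≡ε δ>0 δ≤η δ≤ε a≤A b≤B a+δ≥0 b+δ≥0 =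
      subst (0ℚ ℚ.≤_)
        (trans (identity a b (A ℚ.+ B ℚ.+ ε) δ η) (cong (a ℚ.* b ℚ.+_) Cη≡ε))
        (0≤+ (0≤+ (0≤*ℚ a+δ≥0 b+δ≥0)
                  (0≤*ℚ (ℚₚ.<⇒≤ δ>0) (≤⇒0≤- (ℚₚ.+-mono-≤ (ℚₚ.+-mono-≤ a≤A b≤B) δ≤ε))))
             (0≤*ℚ (ℚₚ.<⇒≤ C>0) (≤⇒0≤- δ≤η)))

  ≤⇒Nonneg : ∀ {x y} → x ≤ y → EventuallyNonneg (λ n → seq y n ℚ.- seq x n)
  ≤⇒Nonneg {x} {y} x≤y ε ε>0 with x≤y ε ε>0
  ... | N , bound = N , λ n N≤n → subst (0ℚ ℚ.≤_)
    (solve 3 (λ a b e → b :+ e :- a := b :- a :+ e) refl (seq x n) (seq y n) ε) (≤⇒0≤- (bound n N≤n))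

  Nonneg⇒≤ : ∀ {x y} → EventuallyNonneg (λ n → seq y n ℚ.- seq x n) → x ≤ y
  Nonneg⇒≤ {x} {y} d≥0 ε ε>0 with d≥0 ε ε>0
  ... | N , bound = N , λ n N≤n → 0≤-⇒≤ (subst (0ℚ ℚ.≤_)
    (solve 3 (λ a b e → b :- a :+ e := b :+ e :- a) refl (seq x n) (seq y n) ε) (bound n N≤n))

  -- The comparison is made at ε/2, because a² ≤ δ² bounds ∣a∣ only weakly while `Null` asks for a
  -- strict inequality.
  square-Null : ∀ {a} → EventuallyNonneg (λ n → ℚ.- (a n ℚ.* a n)) → Null a
  square-Null {a} a²≤0 ε ε>0 with a²≤0 (δ ℚ.* δ) (0<*ℚ δ>0 δ>0)
    where
    δ = ½ ℚ.* ε
    δ>0 = 0<*ℚ 0<½ ε>0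
  ... | N , bound = N , λ n N≤n → ℚₚ.≰⇒> λ ε≤∣a∣ →
    let δ = ½ ℚ.* ε
        δ>0 = 0<*ℚ 0<½ ε>0
        δ<∣a∣ : δ ℚ.< ℚ.∣ a n ∣
        δ<∣a∣ = ℚₚ.<-≤-trans
          (subst₂ ℚ._<_ (ℚₚ.+-identityʳ δ) (halves ε) (ℚₚ.+-monoʳ-< δ δ>0)) ε≤∣a∣
        δ²<a² : δ ℚ.* δ ℚ.< ℚ.∣ a n ∣ ℚ.* ℚ.∣ a n ∣
        δ²<a² = ℚₚ.<-trans (ℚₚ.*-monoʳ-<-pos δ {{ℚ.positive δ>0}} δ<∣a∣)
          (ℚₚ.*-monoˡ-<-pos ℚ.∣ a n ∣ {{ℚ.positive (ℚₚ.<-trans δ>0 δ<∣a∣)}} δ<∣a∣)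
        a²≤δ² : a n ℚ.* a n ℚ.≤ δ ℚ.* δ
        a²≤δ² = 0≤-⇒≤ (subst (0ℚ ℚ.≤_)
          (solve 2 (λ s t → :- s :+ t := t :- s) refl (a n ℚ.* a n) (δ ℚ.* δ)) (bound n N≤n))
    in ℚₚ.<-irrefl refl (ℚₚ.<-≤-trans δ²<a²
         (subst (ℚ._≤ δ ℚ.* δ)
           (trans (sym (ℚₚ.0≤p⇒∣p∣≡p (0≤² (a n)))) (ℚₚ.∣p*q∣≡∣p∣*∣q∣ (a n) (a n))) a²≤δ²))

  -- Natural numbers in ℚ, powers of one half, and bisection

  ι : ℕ → ℚ
  ι zero    = 0ℚ
  ι (suc k) = 1ℚ ℚ.+ ι k

  ι≥0 : ∀ k → 0ℚ ℚ.≤ ι k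
  ι≥0 zero    = ℚₚ.≤-refl
  ι≥0 (suc k) = 0≤+ (ℚₚ.<⇒≤ (ℚₚ.positive⁻¹ 1ℚ)) (ι≥0 k)

  -- The Archimedean property inspects numerators, so the recursive embedding has to be matched with
  -- the literal fraction k/1.
  ι-mkℚ : ∀ k → ι k ≡ mkℚ (+ k) 0 (Coprimality.sym (Coprimality.1-coprimeTo k))
  ι-mkℚ zero    = refl
  ι-mkℚ (suc k) = trans (cong (1ℚ ℚ.+_) (ι-mkℚ k)) (ℚₚ.toℚᵘ-injective
    (ℚᵘₚ.≃-trans (ℚₚ.toℚᵘ-homo-+ 1ℚ k/1)
      (ℚᵘ.*≡* (cong (λ t → ((+ 1) ℤ.+ t) ℤ.* (+ 1)) (ℤₚ.*-identityʳ (+ k))))))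
    where k/1 = mkℚ (+ k) 0 (Coprimality.sym (Coprimality.1-coprimeTo k))

  archimedean : ∀ q → ∃ λ k → q ℚ.≤ ι k
  archimedean (mkℚ (+ a) d c) = a , subst (mkℚ (+ a) d c ℚ.≤_) (sym (ι-mkℚ a))
    (ℚ.*≤* (ℤₚ.*-monoˡ-≤-nonNeg (+ a) (ℤ.+≤+ (s≤s z≤n))))
  archimedean (mkℚ (-[1+ a ]) d c) = 0 , ℚ.*≤* ℤ.-≤+

  ½^ : ℕ → ℚ
  ½^ zero    = 1ℚ
  ½^ (suc k) = ½ ℚ.* ½^ k

  ½^>0 : ∀ k → 0ℚ ℚ.< ½^ k
  ½^>0 zero    = ℚₚ.positive⁻¹ 1ℚ
  ½^>0 (suc k) = 0<*ℚ 0<½ (½^>0 k)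

  -- Bernoulli's inequality 2^k ≥ k + 1, free of division.
  ½^-bound : ∀ k → ½^ k ℚ.* ι (suc k) ℚ.≤ 1ℚ
  ½^-bound zero    = ℚₚ.≤-refl
  ½^-bound (suc k) = ℚₚ.≤-trans (0≤-⇒≤ (subst (0ℚ ℚ.≤_) (difference (½^ k) (ι k))
      (0≤*ℚ (ℚₚ.<⇒≤ 0<½) (0≤*ℚ (ℚₚ.<⇒≤ (½^>0 k)) (ι≥0 k))))) (½^-bound k)
    where
    difference : ∀ h t → ½ ℚ.* (h ℚ.* t) ≡
      h ℚ.* (1ℚ ℚ.+ t) ℚ.- ½ ℚ.* h ℚ.* (1ℚ ℚ.+ (1ℚ ℚ.+ t))
    difference = solve-∀ ℚ-ring

  -- Take k ≥ w/ε; then ½^k w ≤ ε k ½^k < ε (k + 1) ½^k ≤ ε.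
  ½^-small : ∀ w ε → 0ℚ ℚ.< ε → ∃ λ k → ½^ k ℚ.* w ℚ.< ε
  ½^-small w ε ε>0 =
    let r , r>0 , εr≡1 = divide ε>0 (ℚₚ.positive⁻¹ 1ℚ)
        k , wr≤k       = archimedean (w ℚ.* r)
        h>0            = ½^>0 k
        w≤εk : w ℚ.≤ ε ℚ.* ι k
        w≤εk = subst (ℚ._≤ ε ℚ.* ι k)
          (trans (identity w r ε) (trans (cong (w ℚ.*_) εr≡1) (ℚₚ.*-identityʳ w)))
          (ℚₚ.*-monoˡ-≤-nonNeg ε {{ℚ.nonNegative (ℚₚ.<⇒≤ ε>0)}} wr≤k)
    in k , (begin-strict
      ½^ k ℚ.* w
        ≤⟨ ℚₚ.*-monoˡ-≤-nonNeg (½^ k) {{ℚ.nonNegative (ℚₚ.<⇒≤ h>0)}} w≤εk ⟩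
      ½^ k ℚ.* (ε ℚ.* ι k)
        ≡⟨ sym (ℚₚ.+-identityˡ _) ⟩
      0ℚ ℚ.+ ½^ k ℚ.* (ε ℚ.* ι k)
        <⟨ ℚₚ.+-monoˡ-< (½^ k ℚ.* (ε ℚ.* ι k)) (0<*ℚ h>0 ε>0) ⟩
      ½^ k ℚ.* ε ℚ.+ ½^ k ℚ.* (ε ℚ.* ι k)
        ≡⟨ factor (½^ k) ε (ι k) ⟩
      ε ℚ.* (½^ k ℚ.* ι (suc k))
        ≤⟨ ℚₚ.*-monoˡ-≤-nonNeg ε {{ℚ.nonNegative (ℚₚ.<⇒≤ ε>0)}} (½^-bound k) ⟩
      ε ℚ.* 1ℚ
        ≡⟨ ℚₚ.*-identityʳ ε ⟩
      ε ∎)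
    where
    open ℚₚ.≤-Reasoning
    identity : ∀ w r ε → ε ℚ.* (w ℚ.* r) ≡ w ℚ.* (ε ℚ.* r)
    identity = solve-∀ ℚ-ring
    factor : ∀ h ε t → h ℚ.* ε ℚ.+ h ℚ.* (ε ℚ.* t) ≡ ε ℚ.* (h ℚ.* (1ℚ ℚ.+ t))
    factor = solve-∀ ℚ-ring

  -- The sign of `f` at a rational is decidable, so halving works for arbitrary `f`. Both endpoint
  -- sequences are kept: they have the same limit, with f ≤ 0 along the lower and f ≥ 0 along the
  -- upper one, and a continuous `f` must then tend to 0.
  module Bisection (f : ℚ → ℚ) (a₀ b₀ : ℚ) (a₀≤b₀ : a₀ ℚ.≤ b₀)
                   (fa₀≤0 : f a₀ ℚ.≤ 0ℚ) (fb₀≥0 : 0ℚ ℚ.≤ f b₀) where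

    record Bracket (w : ℚ) : Set where
      field
        lower upper : ℚ
        width   : upper ℚ.- lower ≡ w
        f-lower : f lower ℚ.≤ 0ℚ
        f-upper : 0ℚ ℚ.≤ f upper

    open Bracket

    halve : ∀ {w} → 0ℚ ℚ.≤ w → (I : Bracket w) → Σ (Bracket (½ ℚ.* w)) λ J →
            lower I ℚ.≤ lower J × upper J ℚ.≤ upper I
    halve {w} w≥0 I with ℚₚ.≤-total (f (½ ℚ.* (lower I ℚ.+ upper I))) 0ℚ
    ... | inj₁ fm≤0 = record
      { lower = ½ ℚ.* (lower I ℚ.+ upper I) ; upper = upper I
      ; width = trans (upperHalf (lower I) (upper I)) (cong (½ ℚ.*_) (width I))
      ; f-lower = fm≤0 ; f-upper = f-upper I }
      , 0≤-⇒≤ (subst (0ℚ ℚ.≤_) (trans (cong (½ ℚ.*_) (sym (width I))) (lowerHalf (lower I) (upper I)))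
          (0≤*ℚ (ℚₚ.<⇒≤ 0<½) w≥0))
      , ℚₚ.≤-refl
      where
      upperHalf : ∀ a b → b ℚ.- ½ ℚ.* (a ℚ.+ b) ≡ ½ ℚ.* (b ℚ.- a)
      upperHalf = solve-∀ ℚ-ring
      lowerHalf : ∀ a b → ½ ℚ.* (b ℚ.- a) ≡ ½ ℚ.* (a ℚ.+ b) ℚ.- a
      lowerHalf = solve-∀ ℚ-ring
    ... | inj₂ fm≥0 = record
      { lower = lower I ; upper = ½ ℚ.* (lower I ℚ.+ upper I)
      ; width = trans (lowerHalf (lower I) (upper I)) (cong (½ ℚ.*_) (width I))
      ; f-lower = f-lower I ; f-upper = fm≥0 }
      , ℚₚ.≤-refl
      , 0≤-⇒≤ (subst (0ℚ ℚ.≤_) (trans (cong (½ ℚ.*_) (sym (width I))) (upperHalf (lower I) (upper I)))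
          (0≤*ℚ (ℚₚ.<⇒≤ 0<½) w≥0))
      where
      upperHalf : ∀ a b → ½ ℚ.* (b ℚ.- a) ≡ b ℚ.- ½ ℚ.* (a ℚ.+ b)
      upperHalf = solve-∀ ℚ-ring
      lowerHalf : ∀ a b → ½ ℚ.* (a ℚ.+ b) ℚ.- a ≡ ½ ℚ.* (b ℚ.- a)
      lowerHalf = solve-∀ ℚ-ring

    w₀ = b₀ ℚ.- a₀

    width≥0 : ∀ k → 0ℚ ℚ.≤ ½^ k ℚ.* w₀
    width≥0 k = 0≤*ℚ (ℚₚ.<⇒≤ (½^>0 k)) (≤⇒0≤- a₀≤b₀)

    bracket : ∀ k → Bracket (½^ k ℚ.* w₀)
    refine : ∀ k → Σ (Bracket (½ ℚ.* (½^ k ℚ.* w₀))) λ J →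
             lower (bracket k) ℚ.≤ lower J × upper J ℚ.≤ upper (bracket k)
    bracket zero = record { lower = a₀ ; upper = b₀ ; width = sym (ℚₚ.*-identityˡ w₀)
                          ; f-lower = fa₀≤0 ; f-upper = fb₀≥0 }
    -- The width is an index of `Bracket`, so reassociating the product transports the whole record;
    -- the two `-subst` lemmas recover its endpoints.
    bracket (suc k) = subst Bracket (sym (ℚₚ.*-assoc ½ (½^ k) w₀)) (proj₁ (refine k))
    refine k = halve (width≥0 k) (bracket k)

    lower-subst : ∀ {v w} (eq : v ≡ w) I → lower (subst Bracket eq I) ≡ lower I
    lower-subst refl I = refl

    upper-subst : ∀ {v w} (eq : v ≡ w) I → upper (subst Bracket eq I) ≡ upper I
    upper-subst refl I = refl

    nested : ∀ j k → lower (bracket k) ℚ.≤ lower (bracket (j ℕ.+ k)) ×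
                     upper (bracket (j ℕ.+ k)) ℚ.≤ upper (bracket k)
    nested zero    k = ℚₚ.≤-refl , ℚₚ.≤-refl
    nested (suc j) k =
      let eq = sym (ℚₚ.*-assoc ½ (½^ (j ℕ.+ k)) w₀)
          J , ≤J , J≤ = refine (j ℕ.+ k)
          l , u = nested j k
      in ℚₚ.≤-trans l (ℚₚ.≤-trans ≤J (ℚₚ.≤-reflexive (sym (lower-subst eq J))))
       , ℚₚ.≤-trans (ℚₚ.≤-trans (ℚₚ.≤-reflexive (upper-subst eq J)) J≤) u

    nested-≤ : ∀ {k n} → k ℕ.≤ n → lower (bracket k) ℚ.≤ lower (bracket n) ×
                                    upper (bracket n) ℚ.≤ upper (bracket k)
    nested-≤ {k} {n} k≤n = subst
      (λ n → lower (bracket k) ℚ.≤ lower (bracket n) × upper (bracket n) ℚ.≤ upper (bracket k))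
      (ℕₚ.m∸n+n≡m k≤n) (nested (n ℕ.∸ k) k)

    ordered : ∀ k → lower (bracket k) ℚ.≤ upper (bracket k)
    ordered k = 0≤-⇒≤ (subst (0ℚ ℚ.≤_) (sym (width (bracket k))) (width≥0 k))

    within : ∀ k p q → lower (bracket k) ℚ.≤ p → p ℚ.≤ upper (bracket k) →
             lower (bracket k) ℚ.≤ q → q ℚ.≤ upper (bracket k) →
             ℚ.∣ p ℚ.- q ∣ ℚ.≤ ½^ k ℚ.* w₀
    within k p q l≤p p≤u l≤q q≤u = subst (ℚ.∣ p ℚ.- q ∣ ℚ.≤_) (width (bracket k))
      (∣∣≤ (ℚₚ.+-mono-≤ p≤u (ℚₚ.neg-antimono-≤ l≤q))
           (subst (ℚ._≤ upper (bracket k) ℚ.- lower (bracket k)) (flip p q)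
             (ℚₚ.+-mono-≤ q≤u (ℚₚ.neg-antimono-≤ l≤p))))
      where
      flip : ∀ p q → q ℚ.- p ≡ ℚ.- (p ℚ.- q)
      flip = solve-∀ ℚ-ring

    squeezed : (s : ℕ → ℚ) → (∀ k → lower (bracket k) ℚ.≤ s k) → (∀ k → s k ℚ.≤ upper (bracket k)) → ℝ
    squeezed s l≤s s≤u = mkℝ s λ ε ε>0 →
      let k , small = ½^-small w₀ ε ε>0
      in k , λ m n k≤m k≤n → ℚₚ.≤-<-trans
        (within k (s m) (s n)
          (ℚₚ.≤-trans (proj₁ (nested-≤ k≤m)) (l≤s m)) (ℚₚ.≤-trans (s≤u m) (proj₂ (nested-≤ k≤m)))
          (ℚₚ.≤-trans (proj₁ (nested-≤ k≤n)) (l≤s n)) (ℚₚ.≤-trans (s≤u n) (proj₂ (nested-≤ k≤n)))) small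

    root root⁺ : ℝ
    root  = squeezed (λ k → lower (bracket k)) (λ k → ℚₚ.≤-refl) ordered
    root⁺ = squeezed (λ k → upper (bracket k)) ordered (λ k → ℚₚ.≤-refl)

    root⁺≈root : root⁺ ≈ root
    root⁺≈root ε ε>0 =
      let k , small = ½^-small w₀ ε ε>0
      in k , λ n k≤n → ℚₚ.≤-<-trans
        (within k (upper (bracket n)) (lower (bracket n))
          (ℚₚ.≤-trans (proj₁ (nested-≤ k≤n)) (ordered n)) (proj₂ (nested-≤ k≤n))
          (proj₁ (nested-≤ k≤n)) (ℚₚ.≤-trans (ordered n) (proj₂ (nested-≤ k≤n)))) small

    root-≥ : ∀ k → a₀ ℚ.≤ seq root k
    root-≥ k = proj₁ (nested-≤ {0} {k} z≤n)

    f-root≤0 : ∀ k → f (seq root k) ℚ.≤ 0ℚ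
    f-root≤0 k = f-lower (bracket k)

    f-root⁺≥0 : ∀ k → 0ℚ ℚ.≤ f (seq root⁺ k)
    f-root⁺≥0 k = f-upper (bracket k)

  -- Sums over labelled graphs, and the Cauchy-Schwarz bound on eigenvalues

  bit : Bool → ℚ
  bit b = if b then 1ℚ else 0ℚ

  sum-++ : ∀ m {n} (f : Fin (m ℕ.+ n) → ℚ) →
           sum f ≡ sum (λ i → f (i ↑ˡ n)) ℚ.+ sum (λ i → f (m ↑ʳ i))
  sum-++ zero    f = sym (ℚₚ.+-identityˡ _)
  sum-++ (suc m) f = trans (cong (f zero ℚ.+_) (sum-++ m (f ∘ suc)))
    (sym (ℚₚ.+-assoc (f zero) _ _))

  sum-labelled : ∀ {n N} (L : Labelling n N) (f : Fin N → ℚ) →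
                 sum f ≡ sum (f ∘ left L) ℚ.+ sum (f ∘ right L)
  sum-labelled {n} L f = trans (sum-permute f (L ↔-∘ +↔⊎))
    (trans (sum-++ n _) (cong₂ ℚ._+_
      (sum-cong-≗ λ i → cong (f ∘ Inverse.to L) (splitAt-↑ˡ n i n))
      (sum-cong-≗ λ i → cong (f ∘ Inverse.to L) (splitAt-↑ʳ n n i))))

  sum-mono : ∀ {N} {f g : Fin N → ℚ} → (∀ i → f i ℚ.≤ g i) → sum f ℚ.≤ sum g
  sum-mono {zero}  f≤g = ℚₚ.≤-refl
  sum-mono {suc N} f≤g = ℚₚ.+-mono-≤ (f≤g zero) (sum-mono (f≤g ∘ suc))

  sum-zero : ∀ {N} {f : Fin N → ℚ} → (∀ i → f i ≡ 0ℚ) → sum f ≡ 0ℚ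
  sum-zero {N} f≡0 = trans (sum-cong-≗ f≡0) (sum-replicate-zero N)

  sum-const : ∀ {N} {c} → sum {N} (λ _ → c) ≡ ι N ℚ.* c
  sum-const {zero}  {c} = sym (ℚₚ.*-zeroˡ c)
  sum-const {suc N} {c} = trans (cong (c ℚ.+_) (sum-const {N})) (step c (ι N))
    where
    step : ∀ c t → c ℚ.+ t ℚ.* c ≡ (1ℚ ℚ.+ t) ℚ.* c
    step = solve-∀ ℚ-ring

  Null-sum : ∀ {N} {f : Fin N → ℕ → ℚ} → (∀ i → Null (f i)) → Null (λ k → sum (λ i → f i k))
  Null-sum {zero}  f→0 = Null-0
  Null-sum {suc N} f→0 = Null-+ (f→0 zero) (Null-sum (f→0 ∘ suc))

  -- A new coordinate pair (x, y) raises the gap between the two sides by Σ (bᵢ y - rᵢ x)², as in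
  -- Lagrange's identity.
  cauchy-schwarz : ∀ {N} (b r : Fin N → ℚ) →
    let S = sum (λ i → b i ℚ.* r i) in
    S ℚ.* S ℚ.≤ sum (λ i → b i ℚ.* b i) ℚ.* sum (λ i → r i ℚ.* r i)
  cauchy-schwarz {zero}  b r = ℚₚ.≤-refl
  cauchy-schwarz {suc N} b r = 0≤-⇒≤ (subst (0ℚ ℚ.≤_)
    (step (b zero) (r zero) (sum λ i → b (suc i) ℚ.* r (suc i))
      (sum λ i → b (suc i) ℚ.* b (suc i)) (sum λ i → r (suc i) ℚ.* r (suc i)))
    (0≤+ (≤⇒0≤- (cauchy-schwarz (b ∘ suc) (r ∘ suc)))
         (subst (0ℚ ℚ.≤_) (cross N (b ∘ suc) (r ∘ suc)) (squares N (b ∘ suc) (r ∘ suc)))))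
    where
    x = b zero
    y = r zero
    squares : ∀ N (b r : Fin N → ℚ) →
      0ℚ ℚ.≤ sum (λ i → (b i ℚ.* y ℚ.- r i ℚ.* x) ℚ.* (b i ℚ.* y ℚ.- r i ℚ.* x))
    squares zero    b r = ℚₚ.≤-refl
    squares (suc N) b r = 0≤+ (0≤² (b zero ℚ.* y ℚ.- r zero ℚ.* x)) (squares N (b ∘ suc) (r ∘ suc))
    cross : ∀ N (b r : Fin N → ℚ) →
      sum (λ i → (b i ℚ.* y ℚ.- r i ℚ.* x) ℚ.* (b i ℚ.* y ℚ.- r i ℚ.* x))
      ≡ sum (λ i → b i ℚ.* b i) ℚ.* (y ℚ.* y) ℚ.- (x ℚ.* y ℚ.+ x ℚ.* y) ℚ.* sum (λ i → b i ℚ.* r i)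
        ℚ.+ sum (λ i → r i ℚ.* r i) ℚ.* (x ℚ.* x)
    cross zero    b r = base x y
      where
      base : ∀ x y → 0ℚ ≡ 0ℚ ℚ.* (y ℚ.* y) ℚ.- (x ℚ.* y ℚ.+ x ℚ.* y) ℚ.* 0ℚ ℚ.+ 0ℚ ℚ.* (x ℚ.* x)
      base = solve-∀ ℚ-ring
    cross (suc N) b r = trans (cong ((b zero ℚ.* y ℚ.- r zero ℚ.* x) ℚ.* (b zero ℚ.* y ℚ.- r zero ℚ.* x) ℚ.+_)
        (cross N (b ∘ suc) (r ∘ suc)))
      (unfold x y (b zero) (r zero) (sum λ i → b (suc i) ℚ.* b (suc i))
        (sum λ i → b (suc i) ℚ.* r (suc i)) (sum λ i → r (suc i) ℚ.* r (suc i)))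
      where
      unfold : ∀ x y p q B S R →
        (p ℚ.* y ℚ.- q ℚ.* x) ℚ.* (p ℚ.* y ℚ.- q ℚ.* x)
          ℚ.+ (B ℚ.* (y ℚ.* y) ℚ.- (x ℚ.* y ℚ.+ x ℚ.* y) ℚ.* S ℚ.+ R ℚ.* (x ℚ.* x))
        ≡ (p ℚ.* p ℚ.+ B) ℚ.* (y ℚ.* y) ℚ.- (x ℚ.* y ℚ.+ x ℚ.* y) ℚ.* (p ℚ.* q ℚ.+ S)
          ℚ.+ (q ℚ.* q ℚ.+ R) ℚ.* (x ℚ.* x)
      unfold = solve-∀ ℚ-ring
    step : ∀ x y S B R →
      (B ℚ.* R ℚ.- S ℚ.* S) ℚ.+ (B ℚ.* (y ℚ.* y) ℚ.- (x ℚ.* y ℚ.+ x ℚ.* y) ℚ.* S ℚ.+ R ℚ.* (x ℚ.* x))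
      ≡ (x ℚ.* x ℚ.+ B) ℚ.* (y ℚ.* y ℚ.+ R) ℚ.- (x ℚ.* y ℚ.+ S) ℚ.* (x ℚ.* y ℚ.+ S)
    step = solve-∀ ℚ-ring

  sumℝ : ∀ {N} → (Fin N → ℝ) → ℝ
  sumℝ {zero}  f = 0ℝ
  sumℝ {suc N} f = f zero + sumℝ (f ∘ suc)

  seq-sumℝ : ∀ {N} (f : Fin N → ℝ) k → seq (sumℝ f) k ≡ sum (λ i → seq (f i) k)
  seq-sumℝ {zero}  f k = refl
  seq-sumℝ {suc N} f k = cong (seq (f zero) k ℚ.+_) (seq-sumℝ (f ∘ suc) k)

  seq-re-sum : ∀ {N} (f : Fin N → ℂ) k → seq (re (Defs.sum f)) k ≡ sum (λ i → seq (re (f i)) k)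
  seq-re-sum {zero}  f k = refl
  seq-re-sum {suc N} f k = cong (seq (re (f zero)) k ℚ.+_) (seq-re-sum (f ∘ suc) k)

  seq-im-sum : ∀ {N} (f : Fin N → ℂ) k → seq (im (Defs.sum f)) k ≡ sum (λ i → seq (im (f i)) k)
  seq-im-sum {zero}  f k = refl
  seq-im-sum {suc N} f k = cong (seq (im (f zero)) k ℚ.+_) (seq-im-sum (f ∘ suc) k)

  -- The matrix entries are the complex numbers 0 and 1, so they act on real and imaginary parts
  -- separately.
  seq-re-entry : ∀ b z k → seq (re ((if b then 1ᶜ else 0ᶜ) *ᶜ z)) k ≡ bit b ℚ.* seq (re z) k
  seq-re-entry true z k = entry (seq (re z) k) (seq (im z) k)
    where
    entry : ∀ p q → 1ℚ ℚ.* p ℚ.+ ℚ.- (0ℚ ℚ.* q) ≡ 1ℚ ℚ.* p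
    entry = solve-∀ ℚ-ring
  seq-re-entry false z k = entry (seq (re z) k) (seq (im z) k)
    where
    entry : ∀ p q → 0ℚ ℚ.* p ℚ.+ ℚ.- (0ℚ ℚ.* q) ≡ 0ℚ ℚ.* p
    entry = solve-∀ ℚ-ring

  seq-im-entry : ∀ b z k → seq (im ((if b then 1ᶜ else 0ᶜ) *ᶜ z)) k ≡ bit b ℚ.* seq (im z) k
  seq-im-entry true z k = entry (seq (re z) k) (seq (im z) k)
    where
    entry : ∀ p q → 1ℚ ℚ.* q ℚ.+ 0ℚ ℚ.* p ≡ 1ℚ ℚ.* q
    entry = solve-∀ ℚ-ring
  seq-im-entry false z k = entry (seq (re z) k) (seq (im z) k)
    where
    entry : ∀ p q → 0ℚ ℚ.* q ℚ.+ 0ℚ ℚ.* p ≡ 0ℚ ℚ.* q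
    entry = solve-∀ ℚ-ring

  applied : ∀ {N} → Graph N → (Fin N → ℂ) → Fin N → ℂ
  applied G v u = Defs.sum (λ w → adjacencyMatrix G u w *ᶜ v w)

  seq-re-applied : ∀ {N} (G : Graph N) v u k →
    seq (re (applied G v u)) k ≡ sum (λ w → bit (adj G u w) ℚ.* seq (re (v w)) k)
  seq-re-applied G v u k = trans (seq-re-sum (λ w → adjacencyMatrix G u w *ᶜ v w) k)
    (sum-cong-≗ λ w → seq-re-entry (adj G u w) (v w) k)

  seq-im-applied : ∀ {N} (G : Graph N) v u k →
    seq (im (applied G v u)) k ≡ sum (λ w → bit (adj G u w) ℚ.* seq (im (v w)) k)
  seq-im-applied G v u k = trans (seq-im-sum (λ w → adjacencyMatrix G u w *ᶜ v w) k)
    (sum-cong-≗ λ w → seq-im-entry (adj G u w) (v w) k)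

  module _ {n N} (G : Graph N) (L : Labelling n N) (bip : IsBipartite G L) where

    neighbour-sum-left : ∀ a (g : Fin N → ℚ) → sum (λ w → bit (adj G (left L a) w) ℚ.* g w)
      ≡ sum (λ b → bit (adj G (left L a) (right L b)) ℚ.* g (right L b))
    neighbour-sum-left a g = trans (sum-labelled L _) (trans
      (cong (ℚ._+ sum (λ b → bit (adj G (left L a) (right L b)) ℚ.* g (right L b)))
        (sum-zero λ b → trans (cong (λ c → bit c ℚ.* g (left L b)) (proj₁ bip a b))
                              (ℚₚ.*-zeroˡ (g (left L b)))))
      (ℚₚ.+-identityˡ _))

    neighbour-sum-right : ∀ b (g : Fin N → ℚ) → sum (λ w → bit (adj G (right L b) w) ℚ.* g w)
      ≡ sum (λ a → bit (adj G (left L a) (right L b)) ℚ.* g (left L a))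
    neighbour-sum-right b g = trans (sum-labelled L _) (trans
      (cong₂ ℚ._+_ (sum-cong-≗ λ a → cong (λ c → bit c ℚ.* g (left L a)) (adj-sym G _ _))
        (sum-zero λ a → trans (cong (λ c → bit c ℚ.* g (right L a)) (proj₂ bip b a))
                              (ℚₚ.*-zeroˡ (g (right L a)))))
      (ℚₚ.+-identityʳ _))

    seq-re-left : ∀ v a k → seq (re (applied G v (left L a))) k
      ≡ sum (λ b → bit (adj G (left L a) (right L b)) ℚ.* seq (re (v (right L b))) k)
    seq-re-left v a k = trans (seq-re-applied G v (left L a) k)
      (neighbour-sum-left a (λ w → seq (re (v w)) k))

    seq-im-left : ∀ v a k → seq (im (applied G v (left L a))) k
      ≡ sum (λ b → bit (adj G (left L a) (right L b)) ℚ.* seq (im (v (right L b))) k)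
    seq-im-left v a k = trans (seq-im-applied G v (left L a) k)
      (neighbour-sum-left a (λ w → seq (im (v w)) k))

    seq-re-right : ∀ v b k → seq (re (applied G v (right L b))) k
      ≡ sum (λ a → bit (adj G (left L a) (right L b)) ℚ.* seq (re (v (left L a))) k)
    seq-re-right v b k = trans (seq-re-applied G v (right L b) k)
      (neighbour-sum-right b (λ w → seq (re (v w)) k))

    seq-im-right : ∀ v b k → seq (im (applied G v (right L b))) k
      ≡ sum (λ a → bit (adj G (left L a) (right L b)) ℚ.* seq (im (v (left L a))) k)
    seq-im-right v b k = trans (seq-im-applied G v (right L b) k)
      (neighbour-sum-right b (λ w → seq (im (v w)) k))

  sum-minus : ∀ {N} (f g : Fin N → ℚ) → sum (λ i → f i ℚ.- g i) ≡ sum f ℚ.- sum g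
  sum-minus {zero}  f g = refl
  sum-minus {suc N} f g = trans (cong (f zero ℚ.- g zero ℚ.+_) (sum-minus (f ∘ suc) (g ∘ suc)))
    (rearrange (f zero) (g zero) (sum (f ∘ suc)) (sum (g ∘ suc)))
    where
    rearrange : ∀ a b s t → (a ℚ.- b) ℚ.+ (s ℚ.- t) ≡ (a ℚ.+ s) ℚ.- (b ℚ.+ t)
    rearrange = solve-∀ ℚ-ring

  bit-idem : ∀ b → bit b ℚ.* bit b ≡ bit b
  bit-idem true  = refl
  bit-idem false = refl

  norm : ℂ → ℝ
  norm z = re z * re z + im z * im z

  -- In each component a difference of squares is a bounded sum times a null difference, and ∣μw∣² =
  -- ∣μ∣²∣w∣² holds termwise.
  norm-Null : ∀ z μ w → z ≈ᶜ μ *ᶜ w → Null (λ k → seq (norm z) k ℚ.- seq (norm μ) k ℚ.* seq (norm w) k)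
  norm-Null z μ w (re≈ , im≈) = Null-resp
    (λ k → identity (seq (re z) k) (seq (im z) k) (seq (re μ) k) (seq (im μ) k) (seq (re w) k) (seq (im w) k))
    (Null-+ {λ k → seq (re z + re (μ *ᶜ w)) k ℚ.* (seq (re z) k ℚ.- seq (re (μ *ᶜ w)) k)}
            {λ k → seq (im z + im (μ *ᶜ w)) k ℚ.* (seq (im z) k ℚ.- seq (im (μ *ᶜ w)) k)}
      (Null-*ˡ (re z + re (μ *ᶜ w)) re≈) (Null-*ˡ (im z + im (μ *ᶜ w)) im≈))
    where
    identity : ∀ z₁ z₂ μ₁ μ₂ w₁ w₂ →
      (z₁ ℚ.+ (μ₁ ℚ.* w₁ ℚ.+ ℚ.- (μ₂ ℚ.* w₂))) ℚ.* (z₁ ℚ.- (μ₁ ℚ.* w₁ ℚ.+ ℚ.- (μ₂ ℚ.* w₂)))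
        ℚ.+ (z₂ ℚ.+ (μ₁ ℚ.* w₂ ℚ.+ μ₂ ℚ.* w₁)) ℚ.* (z₂ ℚ.- (μ₁ ℚ.* w₂ ℚ.+ μ₂ ℚ.* w₁))
      ≡ (z₁ ℚ.* z₁ ℚ.+ z₂ ℚ.* z₂)
        ℚ.- (μ₁ ℚ.* μ₁ ℚ.+ μ₂ ℚ.* μ₂) ℚ.* (w₁ ℚ.* w₁ ℚ.+ w₂ ℚ.* w₂)
    identity = solve-∀ ℚ-ring

  norm≥0 : ∀ z k → 0ℚ ℚ.≤ seq (norm z) k
  norm≥0 z k = 0≤+ (0≤² (seq (re z) k)) (0≤² (seq (im z) k))

  -- Bits are idempotent, so the first factor of Cauchy-Schwarz becomes the degree of the row.
  row-bound : ∀ {n} (c : Fin n → Bool) (r : Fin n → ℚ) →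
    let S = sum (λ b → bit (c b) ℚ.* r b) in
    S ℚ.* S ℚ.≤ sum (bit ∘ c) ℚ.* sum (λ b → r b ℚ.* r b)
  row-bound c r = subst
    (λ t → sum (λ b → bit (c b) ℚ.* r b) ℚ.* sum (λ b → bit (c b) ℚ.* r b) ℚ.≤ t ℚ.* sum (λ b → r b ℚ.* r b))
    (sum-cong-≗ (bit-idem ∘ c)) (cauchy-schwarz (bit ∘ c) r)

  -- In use `S a` is ∣(Av)ₐ∣² and `m` is ∣μ∣². Each `S a` is at most the degree of `a` times Q, the
  -- squared norm on the opposite part; summing over one part compares e Q with ∣μ∣² P.
  one-sided : ∀ {n} (c : Fin n → Fin n → Bool) (r i p S : Fin n → ℕ → ℚ) (m : ℕ → ℚ) →
    (∀ a k → S a k ≡ sum (λ b → bit (c a b) ℚ.* r b k) ℚ.* sum (λ b → bit (c a b) ℚ.* r b k)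
                 ℚ.+ sum (λ b → bit (c a b) ℚ.* i b k) ℚ.* sum (λ b → bit (c a b) ℚ.* i b k)) →
    (∀ a → Null (λ k → S a k ℚ.- m k ℚ.* p a k)) →
    EventuallyNonneg (λ k →
      sum (λ a → sum (bit ∘ c a)) ℚ.* sum (λ b → r b k ℚ.* r b k ℚ.+ i b k ℚ.* i b k)
      ℚ.- m k ℚ.* sum (λ a → p a k))
  one-sided c r i p S m S≡ S-mp→0 = Nonneg-resp (λ k → total k)
    (Nonneg-+ {λ k → sum (λ a → d a ℚ.* Q k) ℚ.- sum (λ a → S a k)}
      {λ k → sum (λ a → S a k ℚ.- m k ℚ.* p a k)}
      (pointwise-Nonneg (λ k → ≤⇒0≤- (sum-mono (row k)))) (Null⇒Nonneg (Null-sum S-mp→0)))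
    where
    Q : ℕ → ℚ
    Q k = sum (λ b → r b k ℚ.* r b k ℚ.+ i b k ℚ.* i b k)
    d : ∀ a → ℚ
    d a = sum (bit ∘ c a)
    row : ∀ k a → S a k ℚ.≤ d a ℚ.* Q k
    row k a = subst₂ ℚ._≤_ (sym (S≡ a k))
      (trans (sym (ℚₚ.*-distribˡ-+ (d a) (sum (λ b → r b k ℚ.* r b k)) (sum (λ b → i b k ℚ.* i b k))))
        (cong (d a ℚ.*_) (sym (∑-distrib-+ (λ b → r b k ℚ.* r b k) (λ b → i b k ℚ.* i b k)))))
      (ℚₚ.+-mono-≤ (row-bound (c a) (λ b → r b k)) (row-bound (c a) (λ b → i b k)))
    cancel : ∀ x y z → (x ℚ.- y) ℚ.+ (y ℚ.- z) ≡ x ℚ.- z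
    cancel = solve-∀ ℚ-ring
    total : ∀ k → (sum (λ a → d a ℚ.* Q k) ℚ.- sum (λ a → S a k))
        ℚ.+ sum (λ a → S a k ℚ.- m k ℚ.* p a k)
      ≡ sum d ℚ.* Q k ℚ.- m k ℚ.* sum (λ a → p a k)
    total k = trans
      (cong (sum (λ a → d a ℚ.* Q k) ℚ.- sum (λ a → S a k) ℚ.+_) (sum-minus (λ a → S a k) (λ a → m k ℚ.* p a k)))
      (trans (cancel (sum (λ a → d a ℚ.* Q k)) (sum (λ a → S a k)) (sum (λ a → m k ℚ.* p a k)))
        (cong₂ ℚ._-_ (sym (*-distribʳ-sum (Q k) d)) (sym (*-distribˡ-sum (m k) (λ a → p a k)))))

  normSum : ∀ {N} → (Fin N → ℂ) → ℝ
  normSum v = sumℝ (norm ∘ v)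

  edgeTotal : ∀ {n N} → Graph N → Labelling n N → ℚ
  edgeTotal G L = sum (λ a → sum (λ b → bit (adj G (left L a) (right L b))))

  module _ {n N} (G : Graph N) (L : Labelling n N) (bip : IsBipartite G L) where

    -- By Cauchy–Schwarz in each row of the biadjacency matrix and of its transpose.
    eigenvalue-bound : ∀ v μ → (∀ u → applied G v u ≈ᶜ μ *ᶜ v u) →
      EventuallyNonneg (λ k → edgeTotal G L ℚ.* seq (normSum v) k ℚ.- seq (norm μ) k ℚ.* seq (normSum v) k)
    eigenvalue-bound v μ eigen = Nonneg-resp combine
      (Nonneg-+
        {λ k → edgeTotal G L ℚ.* Q k ℚ.- seq (norm μ) k ℚ.* P k}
        {λ k → sum (λ b → sum (λ a → bit (adj G (left L a) (right L b)))) ℚ.* P k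
                 ℚ.- seq (norm μ) k ℚ.* Q k}
        (one-sided (λ a b → adj G (left L a) (right L b))
          (λ b → seq (re (v (right L b)))) (λ b → seq (im (v (right L b))))
          (λ a → seq (norm (v (left L a)))) (λ a → seq (norm (applied G v (left L a)))) (seq (norm μ))
          (λ a k → cong₂ (λ s t → s ℚ.* s ℚ.+ t ℚ.* t)
            (seq-re-left G L bip v a k) (seq-im-left G L bip v a k))
          (λ a → norm-Null (applied G v (left L a)) μ (v (left L a)) (eigen (left L a))))
        (one-sided (λ b a → adj G (left L a) (right L b))
          (λ a → seq (re (v (left L a)))) (λ a → seq (im (v (left L a))))
          (λ b → seq (norm (v (right L b)))) (λ b → seq (norm (applied G v (right L b)))) (seq (norm μ))
          (λ b k → cong₂ (λ s t → s ℚ.* s ℚ.+ t ℚ.* t)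
            (seq-re-right G L bip v b k) (seq-im-right G L bip v b k))
          (λ b → norm-Null (applied G v (right L b)) μ (v (right L b)) (eigen (right L b)))))
      where
      P Q : ℕ → ℚ
      P k = sum (λ a → seq (norm (v (left L a))) k)
      Q k = sum (λ b → seq (norm (v (right L b))) k)
      collect : ∀ e m p q → (e ℚ.* q ℚ.- m ℚ.* p) ℚ.+ (e ℚ.* p ℚ.- m ℚ.* q)
        ≡ e ℚ.* (p ℚ.+ q) ℚ.- m ℚ.* (p ℚ.+ q)
      collect = solve-∀ ℚ-ring
      combine : ∀ k →
        (edgeTotal G L ℚ.* Q k ℚ.- seq (norm μ) k ℚ.* P k)
          ℚ.+ (sum (λ b → sum (λ a → bit (adj G (left L a) (right L b)))) ℚ.* P k
                ℚ.- seq (norm μ) k ℚ.* Q k)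
        ≡ edgeTotal G L ℚ.* seq (normSum v) k ℚ.- seq (norm μ) k ℚ.* seq (normSum v) k
      combine k = trans
        (cong (λ e → (edgeTotal G L ℚ.* Q k ℚ.- seq (norm μ) k ℚ.* P k)
                       ℚ.+ (e ℚ.* P k ℚ.- seq (norm μ) k ℚ.* Q k))
          (∑-comm (λ b a → bit (adj G (left L a) (right L b)))))
        (trans (collect (edgeTotal G L) (seq (norm μ) k) (P k) (Q k))
          (cong (λ V → edgeTotal G L ℚ.* V ℚ.- seq (norm μ) k ℚ.* V)
            (sym (trans (seq-sumℝ (norm ∘ v) k) (sum-labelled L (λ u → seq (norm (v u)) k))))))

  normSum≥0 : ∀ {N} (v : Fin N → ℂ) k → 0ℚ ℚ.≤ seq (normSum v) k
  normSum≥0 {zero}  v k = ℚₚ.≤-refl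
  normSum≥0 {suc N} v k = 0≤+ (norm≥0 (v zero) k) (normSum≥0 (v ∘ suc) k)

  norm≤normSum : ∀ {N} (v : Fin N → ℂ) u k → seq (norm (v u)) k ℚ.≤ seq (normSum v) k
  norm≤normSum {suc N} v zero    k = subst (ℚ._≤ seq (normSum v) k) (ℚₚ.+-identityʳ _)
    (ℚₚ.+-monoʳ-≤ (seq (norm (v zero)) k) (normSum≥0 (v ∘ suc) k))
  norm≤normSum {suc N} v (suc u) k = ℚₚ.≤-trans (norm≤normSum (v ∘ suc) u k)
    (subst (ℚ._≤ seq (normSum v) k) (ℚₚ.+-identityˡ _)
      (ℚₚ.+-monoˡ-≤ (seq (normSum (v ∘ suc)) k) (norm≥0 (v zero) k)))

  -- For a component p of `v u` with companion q, -p² = -V + (V - p² - q²) + q², and the last two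
  -- terms are nonnegative.
  normSum-zero : ∀ {N} (v : Fin N → ℂ) → EventuallyNonneg (λ k → ℚ.- seq (normSum v) k) →
                 ∀ u → v u ≈ᶜ 0ᶜ
  normSum-zero v V≤0 u = component re (λ k → seq (im (v u)) k) (λ k → refl)
                       , component im (λ k → seq (re (v u)) k) (λ k → ℚₚ.+-comm (seq (re (v u)) k ℚ.* seq (re (v u)) k) (seq (im (v u)) k ℚ.* seq (im (v u)) k))
    where
    component : (part : ℂ → ℝ) (other : ℕ → ℚ) →
      (∀ k → seq (norm (v u)) k ≡ seq (part (v u)) k ℚ.* seq (part (v u)) k ℚ.+ other k ℚ.* other k) →
      part (v u) ≈ 0ℝ
    component part other eq = Null-resp (λ k → sym (minus0 (seq (part (v u)) k)))
      (square-Null (Nonneg-resp (λ k → split (seq (normSum v) k) (seq (part (v u)) k) (other k))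
        (Nonneg-+ {λ k → ℚ.- seq (normSum v) k}
          {λ k → seq (normSum v) k ℚ.- (seq (part (v u)) k ℚ.* seq (part (v u)) k ℚ.+ other k ℚ.* other k)
                   ℚ.+ other k ℚ.* other k}
          V≤0 (pointwise-Nonneg λ k → 0≤+ (≤⇒0≤-
          (subst (ℚ._≤ seq (normSum v) k) (eq k) (norm≤normSum v u k))) (0≤² (other k))))))
      where
      minus0 : ∀ p → p ℚ.- 0ℚ ≡ p
      minus0 = solve-∀ ℚ-ring
      split : ∀ V p q → ℚ.- V ℚ.+ (V ℚ.- (p ℚ.* p ℚ.+ q ℚ.* q) ℚ.+ q ℚ.* q) ≡ ℚ.- (p ℚ.* p)
      split = solve-∀ ℚ-ring

  -- With M = n − 1, the eigenvalues of the extremal graph other than 0 are the roots of this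
  -- polynomial: eliminating the entries of an eigenvector gives (t² − 1)(t² − M²) = M t².
  char : ℚ → ℚ → ℚ
  char m t = t ℚ.* t ℚ.* (t ℚ.* t) ℚ.- (m ℚ.* m ℚ.+ m ℚ.+ 1ℚ) ℚ.* (t ℚ.* t) ℚ.+ m ℚ.* m

  char-1 : ∀ m → 0ℚ ℚ.≤ m → char m 1ℚ ℚ.≤ 0ℚ
  char-1 m m≥0 = 0≤-⇒≤ (subst (0ℚ ℚ.≤_) (value m) m≥0)
    where
    value : ∀ m → m ≡ 0ℚ ℚ.- (1ℚ ℚ.* 1ℚ ℚ.* (1ℚ ℚ.* 1ℚ)
                      ℚ.- (m ℚ.* m ℚ.+ m ℚ.+ 1ℚ) ℚ.* (1ℚ ℚ.* 1ℚ) ℚ.+ m ℚ.* m)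
    value = solve-∀ ℚ-ring

  char-1+m : ∀ m → 0ℚ ℚ.≤ m → 0ℚ ℚ.≤ char m (1ℚ ℚ.+ m)
  char-1+m m m≥0 = subst (0ℚ ℚ.≤_) (value m)
    (0≤+ (0≤*ℚ m≥0 (0≤² (1ℚ ℚ.+ m))) (0≤² m))
    where
    value : ∀ m → m ℚ.* ((1ℚ ℚ.+ m) ℚ.* (1ℚ ℚ.+ m)) ℚ.+ m ℚ.* m
      ≡ (1ℚ ℚ.+ m) ℚ.* (1ℚ ℚ.+ m) ℚ.* ((1ℚ ℚ.+ m) ℚ.* (1ℚ ℚ.+ m))
        ℚ.- (m ℚ.* m ℚ.+ m ℚ.+ 1ℚ) ℚ.* ((1ℚ ℚ.+ m) ℚ.* (1ℚ ℚ.+ m)) ℚ.+ m ℚ.* m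
    value = solve-∀ ℚ-ring

  1≤ι : ∀ {M} → 1 ℕ.≤ M → 1ℚ ℚ.≤ ι M
  1≤ι {suc M} _ = subst (ℚ._≤ 1ℚ ℚ.+ ι M) (ℚₚ.+-identityʳ 1ℚ) (ℚₚ.+-monoʳ-≤ 1ℚ (ι≥0 M))

  isEigenvalue : ∀ {N} (G : Graph N) v μ → ¬ (∀ u → v u ≈ᶜ 0ᶜ) →
    (∀ u → applied G v u ≈ᶜ μ *ᶜ v u) → IsEigenvalue (adjacencyMatrix G) μ
  isEigenvalue G v μ v≉0 eigen = v , v≉0 , eigen

  -- An explicit eigenvalue of the extremal graph

  module Extremal (M : ℕ) where

    m : ℚ
    m = ι M

    1≤1+m : 1ℚ ℚ.≤ 1ℚ ℚ.+ m
    1≤1+m = 1≤ι {suc M} (s≤s z≤n)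

    -- The endpoint values are -m and m (1 + m)² + m². For m > 0 the quadratic in t² has roots on
    -- both sides of 1, so starting at 1 selects the larger one and makes μ ≥ 1 immediate.
    open Bisection (char m) 1ℚ (1ℚ ℚ.+ m) 1≤1+m (char-1 m (ι≥0 M)) (char-1+m m (ι≥0 M))
      using (root; root⁺; root⁺≈root; root-≥; f-root≤0; f-root⁺≥0)

    μ μ² : ℝ
    μ  = root
    μ² = μ * μ

    -- Along μ the values are ≤ 0 by construction. Conversely they differ from the values at the
    -- upper endpoints, which are ≥ 0, by the null sequence root⁺ - root times `quotient`, the
    -- divided difference of the quartic.
    char-μ : Null (λ k → char m (seq μ k))
    char-μ = Nonneg-antisym
      (Nonneg-resp (λ k → restore (seq μ k) (seq root⁺ k) m)
        (Nonneg-+ {λ k → char m (seq root⁺ k)}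
          {λ k → seq (- quotient) k ℚ.* (seq root⁺ k ℚ.- seq μ k)}
          (pointwise-Nonneg f-root⁺≥0) (Null⇒Nonneg (Null-*ˡ (- quotient) root⁺≈root))))
      (pointwise-Nonneg λ k → ℚₚ.neg-antimono-≤ (f-root≤0 k))
      where
      quotient : ℝ
      quotient = (root⁺ + μ) * (root⁺ * root⁺ + μ * μ - fromℚ (m ℚ.* m ℚ.+ m ℚ.+ 1ℚ))
      restore : ∀ s t m →
        (t ℚ.* t ℚ.* (t ℚ.* t) ℚ.- (m ℚ.* m ℚ.+ m ℚ.+ 1ℚ) ℚ.* (t ℚ.* t) ℚ.+ m ℚ.* m)
          ℚ.+ ℚ.- ((t ℚ.+ s) ℚ.* (t ℚ.* t ℚ.+ s ℚ.* s ℚ.+ ℚ.- (m ℚ.* m ℚ.+ m ℚ.+ 1ℚ))) ℚ.* (t ℚ.- s)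
        ≡ s ℚ.* s ℚ.* (s ℚ.* s) ℚ.- (m ℚ.* m ℚ.+ m ℚ.+ 1ℚ) ℚ.* (s ℚ.* s) ℚ.+ m ℚ.* m
      restore = solve-∀ ℚ-ring

    -- The eigenvector cleared of denominators. The equations at the left vertices and at the
    -- pendant vertex hold identically in μ; those at the remaining right vertices amount to
    -- `char m μ` = 0.
    weight : Fin (suc M) ⊎ Fin (suc M) → ℝ
    weight (inj₁ zero)    = fromℚ m * μ²
    weight (inj₁ (suc _)) = fromℚ m * (μ² - 1ℝ)
    weight (inj₂ zero)    = fromℚ m * μ
    weight (inj₂ (suc _)) = (μ² - 1ℝ) * μ

    private
      L = extremalLabelling M
      bip = extremal-bipartite M
      μᶜ = μ +i 0ℝ

    vector : Fin ((1 ℕ.+ M) ℕ.+ (M ℕ.+ 1)) → ℂ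
    vector u = weight (Inverse.from L u) +i 0ℝ

    vector-at : ∀ s → vector (Inverse.to L s) ≡ weight s +i 0ℝ
    vector-at s = cong (λ t → weight t +i 0ℝ) (Inverse.strictlyInverseʳ L s)

    im-eigen : ∀ u → im (applied (extremalGraph (suc M)) vector u) ≈ im (μᶜ *ᶜ vector u)
    im-eigen u = Null-resp (λ k → sym (trans
        (cong (ℚ._- seq (im (μᶜ *ᶜ vector u)) k) (trans (seq-im-applied (extremalGraph (suc M)) vector u k)
          (sum-zero λ w → ℚₚ.*-zeroʳ (bit (adj (extremalGraph (suc M)) u w)))))
        (vanish (seq μ k) (seq (re (vector u)) k))))
      Null-0
      where
      vanish : ∀ s t → 0ℚ ℚ.- (s ℚ.* 0ℚ ℚ.+ 0ℚ ℚ.* t) ≡ 0ℚ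
      vanish = solve-∀ ℚ-ring

    re-left : ∀ a k → seq (re (applied (extremalGraph (suc M)) vector (left L a))) k
      ≡ sum (λ b → bit (pendant a b) ℚ.* seq (weight (inj₂ b)) k)
    re-left a k = trans (seq-re-left (extremalGraph (suc M)) L bip vector a k) (sum-cong-≗ λ b →
      cong₂ (λ c z → bit c ℚ.* seq (re z) k) (extremal-biadjacency M a b) (vector-at (inj₂ b)))

    re-right : ∀ b k → seq (re (applied (extremalGraph (suc M)) vector (right L b))) k
      ≡ sum (λ a → bit (pendant a b) ℚ.* seq (weight (inj₁ a)) k)
    re-right b k = trans (seq-re-right (extremalGraph (suc M)) L bip vector b k) (sum-cong-≗ λ a →
      cong₂ (λ c z → bit c ℚ.* seq (re z) k) (extremal-biadjacency M a b) (vector-at (inj₁ a)))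

    sum-multiples : ∀ q t → sum {M} (λ _ → q ℚ.* t) ≡ m ℚ.* (q ℚ.* t)
    sum-multiples q t = sum-const {M} {q ℚ.* t}

    re-eigen-at : ∀ s → re (applied (extremalGraph (suc M)) vector (Inverse.to L s)) ≈ μ * weight s - 0ℝ * 0ℝ
    re-eigen-at (inj₁ zero) = Null-resp (λ k → sym (trans
        (cong (ℚ._- seq (μ * weight (inj₁ zero) - 0ℝ * 0ℝ) k)
          (trans (re-left zero k) (cong (1ℚ ℚ.* (m ℚ.* seq μ k) ℚ.+_)
            (sum-multiples 1ℚ ((seq μ k ℚ.* seq μ k ℚ.+ ℚ.- 1ℚ) ℚ.* seq μ k)))))
        (identity m (seq μ k))))
      Null-0
      where
      identity : ∀ m t → 1ℚ ℚ.* (m ℚ.* t) ℚ.+ m ℚ.* (1ℚ ℚ.* ((t ℚ.* t ℚ.+ ℚ.- 1ℚ) ℚ.* t))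
        ℚ.- (t ℚ.* (m ℚ.* (t ℚ.* t)) ℚ.+ ℚ.- (0ℚ ℚ.* 0ℚ)) ≡ 0ℚ
      identity = solve-∀ ℚ-ring
    re-eigen-at (inj₁ (suc i)) = Null-resp (λ k → sym (trans
        (cong (ℚ._- seq (μ * weight (inj₁ (suc i)) - 0ℝ * 0ℝ) k)
          (trans (re-left (suc i) k) (cong (0ℚ ℚ.* (m ℚ.* seq μ k) ℚ.+_)
            (sum-multiples 1ℚ ((seq μ k ℚ.* seq μ k ℚ.+ ℚ.- 1ℚ) ℚ.* seq μ k)))))
        (identity m (seq μ k))))
      Null-0
      where
      identity : ∀ m t → 0ℚ ℚ.* (m ℚ.* t) ℚ.+ m ℚ.* (1ℚ ℚ.* ((t ℚ.* t ℚ.+ ℚ.- 1ℚ) ℚ.* t))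
        ℚ.- (t ℚ.* (m ℚ.* (t ℚ.* t ℚ.+ ℚ.- 1ℚ)) ℚ.+ ℚ.- (0ℚ ℚ.* 0ℚ)) ≡ 0ℚ
      identity = solve-∀ ℚ-ring
    re-eigen-at (inj₂ zero) = Null-resp (λ k → sym (trans
        (cong (ℚ._- seq (μ * weight (inj₂ zero) - 0ℝ * 0ℝ) k)
          (trans (re-right zero k) (cong (1ℚ ℚ.* (m ℚ.* (seq μ k ℚ.* seq μ k)) ℚ.+_)
            (sum-multiples 0ℚ (m ℚ.* (seq μ k ℚ.* seq μ k ℚ.+ ℚ.- 1ℚ))))))
        (identity m (seq μ k))))
      Null-0
      where
      identity : ∀ m t → 1ℚ ℚ.* (m ℚ.* (t ℚ.* t)) ℚ.+ m ℚ.* (0ℚ ℚ.* (m ℚ.* (t ℚ.* t ℚ.+ ℚ.- 1ℚ)))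
        ℚ.- (t ℚ.* (m ℚ.* t) ℚ.+ ℚ.- (0ℚ ℚ.* 0ℚ)) ≡ 0ℚ
      identity = solve-∀ ℚ-ring
    re-eigen-at (inj₂ (suc j)) = Null-resp (λ k → sym (trans
        (cong (ℚ._- seq (μ * weight (inj₂ (suc j)) - 0ℝ * 0ℝ) k)
          (trans (re-right (suc j) k) (cong (1ℚ ℚ.* (m ℚ.* (seq μ k ℚ.* seq μ k)) ℚ.+_)
            (sum-multiples 1ℚ (m ℚ.* (seq μ k ℚ.* seq μ k ℚ.+ ℚ.- 1ℚ))))))
        (identity m (seq μ k))))
      (Null-neg {λ k → char m (seq μ k)} char-μ)
      where
      identity : ∀ m t → 1ℚ ℚ.* (m ℚ.* (t ℚ.* t)) ℚ.+ m ℚ.* (1ℚ ℚ.* (m ℚ.* (t ℚ.* t ℚ.+ ℚ.- 1ℚ)))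
        ℚ.- (t ℚ.* ((t ℚ.* t ℚ.+ ℚ.- 1ℚ) ℚ.* t) ℚ.+ ℚ.- (0ℚ ℚ.* 0ℚ))
        ≡ ℚ.- (t ℚ.* t ℚ.* (t ℚ.* t) ℚ.- (m ℚ.* m ℚ.+ m ℚ.+ 1ℚ) ℚ.* (t ℚ.* t) ℚ.+ m ℚ.* m)
      identity = solve-∀ ℚ-ring

    eigen : ∀ u → applied (extremalGraph (suc M)) vector u ≈ᶜ μᶜ *ᶜ vector u
    eigen u = subst (λ w → re (applied (extremalGraph (suc M)) vector w) ≈ re (μᶜ *ᶜ vector u))
        (Inverse.strictlyInverseˡ L u) (re-eigen-at (Inverse.from L u))
      , im-eigen u

    μ≥1 : ∀ k → 1ℚ ℚ.≤ seq μ k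
    μ≥1 = root-≥

    μ²≥1 : ∀ k → 1ℚ ℚ.≤ seq μ² k
    μ²≥1 k = 0≤-⇒≤ (subst (0ℚ ℚ.≤_) (identity (seq μ k))
      (0≤*ℚ (≤⇒0≤- (μ≥1 k)) (0≤+ (ℚₚ.≤-trans (ℚₚ.<⇒≤ (ℚₚ.positive⁻¹ 1ℚ)) (μ≥1 k)) (ℚₚ.<⇒≤ (ℚₚ.positive⁻¹ 1ℚ)))))
      where
      identity : ∀ t → (t ℚ.- 1ℚ) ℚ.* (t ℚ.+ 1ℚ) ≡ t ℚ.* t ℚ.- 1ℚ
      identity = solve-∀ ℚ-ring

    -- The entry at the neighbour of the pendant vertex is m μ² ≥ 1.
    vector-nonzero : 1 ℕ.≤ M → ¬ (∀ u → vector u ≈ᶜ 0ᶜ)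
    vector-nonzero M≥1 v≈0 =
      let N , small = proj₁ (subst (_≈ᶜ 0ᶜ) (vector-at (inj₁ zero)) (v≈0 (left L zero))) 1ℚ (ℚₚ.positive⁻¹ 1ℚ)
      in ℚₚ.<-irrefl refl (ℚₚ.<-≤-trans (small N ℕₚ.≤-refl)
           (ℚₚ.≤-trans (large N) (≤∣∣ (m ℚ.* seq μ² N ℚ.- 0ℚ))))
      where
      identity : ∀ m s → (m ℚ.- 1ℚ) ℚ.* s ℚ.+ (s ℚ.- 1ℚ) ≡ m ℚ.* s ℚ.- 0ℚ ℚ.- 1ℚ
      identity = solve-∀ ℚ-ring
      large : ∀ k → 1ℚ ℚ.≤ m ℚ.* seq μ² k ℚ.- 0ℚ
      large k = 0≤-⇒≤ (subst (0ℚ ℚ.≤_) (identity m (seq μ² k))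
        (0≤+ (0≤*ℚ (≤⇒0≤- (1≤ι M≥1)) (0≤² (seq μ k))) (≤⇒0≤- (μ²≥1 k))))

    μ≥0 : 0ℝ ≤ μ
    μ≥0 = Nonneg⇒≤ {0ℝ} {μ} (pointwise-Nonneg {λ k → seq μ k ℚ.- 0ℚ} λ k →
      ≤⇒0≤- {0ℚ} {seq μ k} (ℚₚ.≤-trans {0ℚ} {1ℚ} {seq μ k} (ℚₚ.<⇒≤ (ℚₚ.positive⁻¹ 1ℚ)) (μ≥1 k)))

    μ-modulus : μ * μ ≈ re μᶜ * re μᶜ + im μᶜ * im μᶜ
    μ-modulus = Null-resp (λ k → identity (seq μ k)) Null-0
      where
      identity : ∀ t → 0ℚ ≡ t ℚ.* t ℚ.- (t ℚ.* t ℚ.+ 0ℚ ℚ.* 0ℚ)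
      identity = solve-∀ ℚ-ring

    μ≤spectralRadius : 1 ℕ.≤ M → ∀ ρ → IsSpectralRadius (adjacencyMatrix (extremalGraph (suc M))) ρ → μ ≤ ρ
    μ≤spectralRadius M≥1 ρ (_ , maximal) =
      maximal μᶜ μ (isEigenvalue (extremalGraph (suc M)) vector μᶜ (vector-nonzero M≥1) eigen) (μ≥0 , μ-modulus)

  -- From spectral radii to edge counts

  ι-+ : ∀ a b → ι (a ℕ.+ b) ≡ ι a ℚ.+ ι b
  ι-+ zero    b = sym (ℚₚ.+-identityˡ (ι b))
  ι-+ (suc a) b = trans (cong (1ℚ ℚ.+_) (ι-+ a b)) (sym (ℚₚ.+-assoc 1ℚ (ι a) (ι b)))

  ι-* : ∀ a b → ι (a ℕ.* b) ≡ ι a ℚ.* ι b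
  ι-* zero    b = sym (ℚₚ.*-zeroˡ (ι b))
  ι-* (suc a) b = trans (ι-+ b (a ℕ.* b)) (trans (cong (ι b ℚ.+_) (ι-* a b)) (step (ι a) (ι b)))
    where
    step : ∀ s t → t ℚ.+ s ℚ.* t ≡ (1ℚ ℚ.+ s) ℚ.* t
    step = solve-∀ ℚ-ring

  ι-mono : ∀ {a b} → a ℕ.≤ b → ι a ℚ.≤ ι b
  ι-mono {b = b} z≤n = ι≥0 b
  ι-mono (s≤s a≤b)   = ℚₚ.+-monoʳ-≤ 1ℚ (ι-mono a≤b)

  ι-sum : ∀ {N} (f : Fin N → ℕ) → ι (ℕ-Sum.sum f) ≡ sum (ι ∘ f)
  ι-sum {zero}  f = refl
  ι-sum {suc N} f = trans (ι-+ (f zero) (ℕ-Sum.sum (f ∘ suc))) (cong (ι (f zero) ℚ.+_) (ι-sum (f ∘ suc)))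

  ι-⟦⟧ : ∀ b → ι ⟦ b ⟧ ≡ bit b
  ι-⟦⟧ true  = refl
  ι-⟦⟧ false = refl

  module _ {n N} (G : Graph N) (L : Labelling n N) (bip : IsBipartite G L) where

    ι-edgeCount : ι (edgeCount G L) ≡ edgeTotal G L
    ι-edgeCount = trans (ι-sum (λ a → ℕ-Sum.sum (λ b → ⟦ adj G (left L a) (right L b) ⟧)))
      (sum-cong-≗ λ a → trans (ι-sum (λ b → ⟦ adj G (left L a) (right L b) ⟧))
        (sum-cong-≗ λ b → ι-⟦⟧ (adj G (left L a) (right L b))))

    -- Suppose e ≤ κ = M² + M, and let v belong to an eigenvalue ν of modulus ρ. Then μ ≤ ρ₀ ≤ ρ and
    -- ∣ν∣² V ≤ e V yield (κ - μ²) V ≥ 0, although κ - μ² is negative; so V ≤ 0.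
    edgeCount-bound : ∀ M → 1 ℕ.≤ M → ∀ ρ ρ₀ →
      IsSpectralRadius (adjacencyMatrix G) ρ →
      IsSpectralRadius (adjacencyMatrix (extremalGraph (suc M))) ρ₀ →
      ρ₀ ≤ ρ → M ℕ.* M ℕ.+ M ℕ.< edgeCount G L
    edgeCount-bound M M≥1 ρ ρ₀ ((ν , (v , v≉0 , eig) , (ρ≥0 , ρ²≈)) , _) radius₀ ρ₀≤ρ =
      ℕₚ.≰⇒> λ few → v≉0 (normSum-zero v (V≤0 few))
      where
      open Extremal M

      V : ℝ
      V = normSum v

      V≥0 : ∀ k → 0ℚ ℚ.≤ seq V k
      V≥0 = normSum≥0 v

      e κ : ℚ
      e = edgeTotal G L
      κ = m ℚ.* m ℚ.+ m

      e≤κ : edgeCount G L ℕ.≤ M ℕ.* M ℕ.+ M → e ℚ.≤ κ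
      e≤κ few = subst₂ ℚ._≤_ ι-edgeCount (trans (ι-+ (M ℕ.* M) M) (cong (ℚ._+ m) (ι-* M M))) (ι-mono few)

      μ≤ρ₀ : μ ≤ ρ₀
      μ≤ρ₀ = μ≤spectralRadius M≥1 ρ₀ radius₀

      ρ-μ≥0 : EventuallyNonneg (seq (ρ - μ))
      ρ-μ≥0 = Nonneg-resp (λ k → cancel (seq ρ k) (seq ρ₀ k) (seq μ k))
        (Nonneg-+ {λ k → seq ρ k ℚ.- seq ρ₀ k} {λ k → seq ρ₀ k ℚ.- seq μ k}
          (≤⇒Nonneg {ρ₀} {ρ} ρ₀≤ρ) (≤⇒Nonneg {μ} {ρ₀} μ≤ρ₀))
        where
        cancel : ∀ r r₀ s → (r ℚ.- r₀) ℚ.+ (r₀ ℚ.- s) ≡ r ℚ.+ ℚ.- s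
        cancel = solve-∀ ℚ-ring

      ρ+μ≥0 : EventuallyNonneg (seq (ρ + μ))
      ρ+μ≥0 = Nonneg-resp (λ k → minus0 (seq ρ k) (seq μ k))
        (Nonneg-+ {λ k → seq ρ k ℚ.- 0ℚ} {λ k → seq μ k ℚ.- 0ℚ}
          (≤⇒Nonneg {0ℝ} {ρ} ρ≥0) (≤⇒Nonneg {0ℝ} {μ} μ≥0))
        where
        minus0 : ∀ r s → (r ℚ.- 0ℚ) ℚ.+ (s ℚ.- 0ℚ) ≡ r ℚ.+ s
        minus0 = solve-∀ ℚ-ring

      [ρ²-μ²]V≥0 : EventuallyNonneg (seq ((ρ - μ) * (ρ + μ) * V))
      [ρ²-μ²]V≥0 = Nonneg-* ((ρ - μ) * (ρ + μ)) V (Nonneg-* (ρ - μ) (ρ + μ) ρ-μ≥0 ρ+μ≥0) (pointwise-Nonneg V≥0)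

      -- The four summands are (κ - e) V, (e - ∣ν∣²) V, (∣ν∣² - ρ²) V and (ρ² - μ²) V; the third is
      -- null because ρ is the modulus of ν.
      [κ-μ²]V≥0 : e ℚ.≤ κ → EventuallyNonneg (seq ((fromℚ κ - μ²) * V))
      [κ-μ²]V≥0 e≤κ = Nonneg-resp
        (λ k → identity κ e (seq (norm ν) k) (seq ρ k) (seq μ k) (seq V k))
        (Nonneg-+ {λ k → (κ ℚ.- e) ℚ.* seq V k ℚ.+ (e ℚ.* seq V k ℚ.- seq (norm ν) k ℚ.* seq V k)}
          {λ k → ℚ.- (seq V k ℚ.* (seq ρ k ℚ.* seq ρ k ℚ.- seq (norm ν) k)) ℚ.+ seq ((ρ - μ) * (ρ + μ) * V) k}
          (Nonneg-+ {λ k → (κ ℚ.- e) ℚ.* seq V k} {λ k → e ℚ.* seq V k ℚ.- seq (norm ν) k ℚ.* seq V k}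
            (pointwise-Nonneg λ k → 0≤*ℚ (≤⇒0≤- e≤κ) (V≥0 k)) (eigenvalue-bound G L bip v ν eig))
          (Nonneg-+ {λ k → ℚ.- (seq V k ℚ.* (seq ρ k ℚ.* seq ρ k ℚ.- seq (norm ν) k))} {seq ((ρ - μ) * (ρ + μ) * V)}
            (Null⇒Nonneg (Null-neg {λ k → seq V k ℚ.* (seq ρ k ℚ.* seq ρ k ℚ.- seq (norm ν) k)}
              (Null-*ˡ V ρ²≈)))
            [ρ²-μ²]V≥0))
        where
        identity : ∀ κ e n r s V →
          ((κ ℚ.- e) ℚ.* V ℚ.+ (e ℚ.* V ℚ.- n ℚ.* V))
            ℚ.+ (ℚ.- (V ℚ.* (r ℚ.* r ℚ.- n)) ℚ.+ (r ℚ.+ ℚ.- s) ℚ.* (r ℚ.+ s) ℚ.* V)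
          ≡ (κ ℚ.+ ℚ.- (s ℚ.* s)) ℚ.* V
        identity = solve-∀ ℚ-ring

      -- (μ² − 1)(κ − μ²) = − m on the roots of char.
      V≤0 : edgeCount G L ℕ.≤ M ℕ.* M ℕ.+ M → EventuallyNonneg (λ k → ℚ.- seq V k)
      V≤0 few = Nonneg-resp (λ k → identity m (seq μ k) (seq V k))
        (Nonneg-+ {λ k → seq ((μ² - 1ℝ) * ((fromℚ κ - μ²) * V)) k ℚ.+ seq V k ℚ.* char m (seq μ k)}
          {λ k → (m ℚ.- 1ℚ) ℚ.* seq V k}
          (Nonneg-+ {seq ((μ² - 1ℝ) * ((fromℚ κ - μ²) * V))} {λ k → seq V k ℚ.* char m (seq μ k)}
            (Nonneg-* (μ² - 1ℝ) ((fromℚ κ - μ²) * V)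
              (pointwise-Nonneg λ k → ≤⇒0≤- (μ²≥1 k)) ([κ-μ²]V≥0 (e≤κ few)))
            (Null⇒Nonneg (Null-*ˡ V char-μ)))
          (pointwise-Nonneg λ k → 0≤*ℚ (≤⇒0≤- (1≤ι M≥1)) (V≥0 k)))
        where
        identity : ∀ m t V →
          ((t ℚ.* t ℚ.+ ℚ.- 1ℚ) ℚ.* ((m ℚ.* m ℚ.+ m ℚ.+ ℚ.- (t ℚ.* t)) ℚ.* V)
            ℚ.+ V ℚ.* (t ℚ.* t ℚ.* (t ℚ.* t) ℚ.- (m ℚ.* m ℚ.+ m ℚ.+ 1ℚ) ℚ.* (t ℚ.* t) ℚ.+ m ℚ.* m))
            ℚ.+ (m ℚ.- 1ℚ) ℚ.* V ≡ ℚ.- V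
        identity = solve-∀ ℚ-ring

module Combinatorics where

  open import Algebra.Properties.CommutativeMonoid.Sum ℕₚ.+-0-commutativeMonoid
  open import Axiom.UniquenessOfIdentityProofs using (module Decidable⇒UIP)
  open import Data.Bool.Base using (Bool; true; false; _∨_; if_then_else_)
  open import Data.Bool.Properties using (∨-comm) renaming (_≟_ to _≟ᵇ_)
  open import Data.Fin.Base as Fin using (Fin; zero; suc; toℕ; fromℕ; inject₁; punchIn; punchOut)
  open import Data.Fin.Permutation using (Permutation; Permutation′; permutation; _∘ₚ_; _⟨$⟩ʳ_; _⟨$⟩ˡ_; inverseˡ; inverseʳ; ↔⇒≡; insert; transpose; flip) renaming (id to idₚ)
  open import Data.Fin.Properties using (any?; punchIn-punchOut; fromℕ≢inject₁; toℕ-injective; toℕ-fromℕ; toℕ-inject₁; toℕ<n) renaming (_≟_ to _≟ᶠ_; <-cmp to <-cmpᶠ; <-asym to <-asymᶠ; <-irrelevant to <-irrelevantᶠ; suc-injective to sucᶠ-injective)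
  open import Data.Fin.Relation.Unary.Top using (view; ‵fromℕ; ‵inject₁; view-fromℕ; view-inject₁)
  open import Data.List.Base using (List; []; _∷_; _++_; _ʳ++_; [_]; length; lookup; tabulate)
  open import Data.List.Membership.Propositional using (_∈_)
  open import Data.List.Membership.Propositional.Properties using (∈-lookup; ∈-tabulate⁺; ∈-tabulate⁻; ∈-++⁺ˡ; ∈-++⁺ʳ)
  open import Data.List.Properties using (ʳ++-defn)
  open import Data.List.Relation.Binary.Permutation.Propositional using (_↭_; prep; swap; ↭-refl; ↭-sym; ↭-trans; ↭-reflexive; ↭⇒↭ₛ)
  open import Data.List.Relation.Binary.Permutation.Propositional.Properties using (shift; ↭-reverse; ++⁺ʳ; ∈-resp-↭)
  import Data.List.Relation.Binary.Permutation.Setoid.Properties as Permutationₛ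
  import Data.List.Relation.Unary.All as All
  open import Data.List.Relation.Unary.AllPairs using (_∷_)
  open import Data.List.Relation.Unary.Any using (index)
  open import Data.List.Relation.Unary.Any.Properties using (lookup-index)
  open import Data.List.Relation.Unary.Unique.Propositional using (Unique)
  open import Data.List.Relation.Unary.Unique.Propositional.Properties using (++⁺; tabulate⁺)
  open import Data.Nat.Base using (ℕ; zero; suc; _+_; _*_; _≤_; _<_; z≤n; s≤s; s≤s⁻¹)
  open import Data.Nat.Properties
  open import Data.Nat.Tactic.RingSolver using (solve-∀)
  open import Data.Product.Base using (Σ; ∃; ∃₂; _×_; _,_; proj₁; proj₂)
  open import Data.Sum.Base as Sum using (_⊎_; inj₁; inj₂)
  open import Data.Sum.Properties using (inj₁-injective; inj₂-injective)
  open import Function.Base using (_∘_)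
  open import Function.Bundles using (_⤖_; mk⤖; mk⇔; Bijection; Inverse; mk↔ₛ′)
  open import Relation.Binary.Definitions using (tri<; tri≈; tri>)
  open import Relation.Binary.PropositionalEquality hiding ([_])
  open import Relation.Nullary.Decidable using (dec-true; dec-false; _×-dec_)
  open import Relation.Nullary.Decidable.Core using (Dec; yes; no; does)
  open import Relation.Nullary.Negation using (¬_; contradiction)

  -- Counting with sums of natural numbers

  sum-const : ∀ n c → sum {n} (λ _ → c) ≡ n * c
  sum-const zero    c = refl
  sum-const (suc n) c = cong (c +_) (sum-const n c)

  sum-mono : ∀ {n} {f g : Fin n → ℕ} → (∀ i → f i ≤ g i) → sum f ≤ sum g
  sum-mono {zero}  f≤g = z≤n
  sum-mono {suc n} f≤g = +-mono-≤ (f≤g zero) (sum-mono (f≤g ∘ suc))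

  ≤-sum : ∀ {n} (f : Fin n → ℕ) i → f i ≤ sum f
  ≤-sum f zero    = m≤m+n (f zero) (sum (f ∘ suc))
  ≤-sum f (suc i) = ≤-trans (≤-sum (f ∘ suc) i) (m≤n+m (sum (f ∘ suc)) (f zero))

  sum≡0 : ∀ {n} (f : Fin n → ℕ) → sum f ≡ 0 → ∀ i → f i ≡ 0
  sum≡0 f eq i = n≤0⇒n≡0 (subst (f i ≤_) eq (≤-sum f i))

  sum-<⇒∃ : ∀ {n} (f g : Fin n → ℕ) → sum f < sum g → ∃ λ i → f i < g i
  sum-<⇒∃ {suc n} f g f<g with f zero <? g zero
  ... | yes f₀<g₀ = zero , f₀<g₀
  ... | no  f₀≮g₀ =
    let i , fᵢ<gᵢ = sum-<⇒∃ (f ∘ suc) (g ∘ suc)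
          (+-cancelˡ-< (g zero) _ _ (≤-<-trans (+-monoˡ-≤ (sum (f ∘ suc)) (≮⇒≥ f₀≮g₀)) f<g))
    in suc i , fᵢ<gᵢ

  -- The equality case of termwise comparison, and the source of rigidity later: a pair missed N
  -- times is missed by every colour, and a tight average is attained everywhere.
  sum-tight : ∀ {n} (f g : Fin n → ℕ) → (∀ i → f i ≤ g i) → sum g ≤ sum f → ∀ i → g i ≤ f i
  sum-tight f g f≤g g≤f zero = +-cancelʳ-≤ (sum (f ∘ suc)) _ _
    (≤-trans (+-monoʳ-≤ (g zero) (sum-mono (f≤g ∘ suc))) g≤f)
  sum-tight f g f≤g g≤f (suc i) = sum-tight (f ∘ suc) (g ∘ suc) (f≤g ∘ suc)
    (+-cancelˡ-≤ (f zero) _ _ (≤-trans (+-monoˡ-≤ (sum (g ∘ suc)) (f≤g zero)) g≤f)) i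

  sum-punchIn-≤ : ∀ {n} (f : Fin (suc n) → ℕ) i → sum (f ∘ punchIn i) ≤ sum f
  sum-punchIn-≤ f i = subst (sum (f ∘ punchIn i) ≤_) (sym (sum-remove {i = i} f)) (m≤n+m _ (f i))

  sum-<n⇒∃0 : ∀ {n} (f : Fin n → ℕ) → sum f < n → ∃ λ i → f i ≡ 0
  sum-<n⇒∃0 {n} f f<n =
    let i , fᵢ<1 = sum-<⇒∃ f (λ _ → 1) (subst (sum f <_) (sym (trans (sum-const n 1) (*-identityʳ n))) f<n)
    in i , n<1⇒n≡0 fᵢ<1

  0<sum⇒∃ : ∀ {n} (f : Fin n → ℕ) → 0 < sum f → ∃ λ i → 0 < f i
  0<sum⇒∃ {n} f 0<f = sum-<⇒∃ (λ _ → 0) f (subst (_< sum f) (sym (trans (sum-const n 0) (*-zeroʳ n))) 0<f)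

  -- Transversals of zeros in sparse matrices

  total : ∀ {m n} → (Fin m → Fin n → ℕ) → ℕ
  total B = sum (λ i → sum (B i))

  column : ∀ {m n} → (Fin m → Fin n → ℕ) → Fin n → ℕ
  column B j = sum (λ i → B i j)

  column≤total : ∀ {m n} (B : Fin m → Fin n → ℕ) j → column B j ≤ total B
  column≤total B j = sum-mono (λ i → ≤-sum (B i) j)

  -- A perfect matching among the zero entries; the rows will be cycle edges and the columns
  -- colours.
  Avoidable : ∀ {n} → (Fin n → Fin n → ℕ) → Set
  Avoidable {n} B = ∃ λ (π : Permutation′ n) → ∀ i → B i (π ⟨$⟩ʳ i) ≡ 0

  minor : ∀ {n} → (Fin (suc n) → Fin (suc n) → ℕ) → Fin (suc n) → Fin (suc n) → Fin n → Fin n → ℕ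
  minor B i j a b = B (punchIn i a) (punchIn j b)

  total-minor : ∀ {n} (B : Fin (suc n) → Fin (suc n) → ℕ) i j → B i j ≡ 0 →
                total B ≡ sum (B i) + column B j + total (minor B i j)
  total-minor B i j Bij≡0 = begin
    total B
      ≡⟨ sum-remove {i = i} (λ i → sum (B i)) ⟩
    sum (B i) + sum (λ a → sum (B (punchIn i a)))
      ≡⟨ cong (sum (B i) +_) (sum-cong-≗ (λ a → sum-remove {i = j} (B (punchIn i a)))) ⟩
    sum (B i) + sum (λ a → B (punchIn i a) j + sum (minor B i j a))
      ≡⟨ cong (sum (B i) +_) (∑-distrib-+ (λ a → B (punchIn i a) j) (λ a → sum (minor B i j a))) ⟩
    sum (B i) + (sum (λ a → B (punchIn i a) j) + total (minor B i j))
      ≡⟨ cong (λ c → sum (B i) + (c + total (minor B i j)))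
           (sym (trans (sum-remove {i = i} (λ a → B a j)) (cong (_+ sum (λ a → B (punchIn i a) j)) Bij≡0))) ⟩
    sum (B i) + (column B j + total (minor B i j))
      ≡⟨ +-assoc (sum (B i)) (column B j) (total (minor B i j)) ⟨
    sum (B i) + column B j + total (minor B i j) ∎
    where open ≡-Reasoning

  Avoidable-extend : ∀ {n} (B : Fin (suc n) → Fin (suc n) → ℕ) i j → B i j ≡ 0 →
                     Avoidable (minor B i j) → Avoidable B
  Avoidable-extend B i j Bij≡0 (π , avoids) = insert i j π , avoids′
    where
    avoids′ : ∀ a → B a (insert i j π ⟨$⟩ʳ a) ≡ 0
    avoids′ a with i ≟ᶠ a
    ... | yes refl = Bij≡0
    ... | no  i≢a  = subst (λ c → B c (punchIn j (π ⟨$⟩ʳ punchOut i≢a)) ≡ 0)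
                       (punchIn-punchOut i≢a) (avoids (punchOut i≢a))

  minor-≤ : ∀ {n} (B : Fin (suc n) → Fin (suc n) → ℕ) i j → B i j ≡ 0 → ∀ r s →
            r ≤ sum (B i) + column B j → total B ≤ r + s → total (minor B i j) ≤ s
  minor-≤ B i j Bij≡0 r s r≤ total≤ = +-cancelˡ-≤ r _ _
    (≤-trans (+-monoˡ-≤ (total (minor B i j)) r≤)
      (≤-trans (≤-reflexive (sym (total-minor B i j Bij≡0))) total≤))

  -- A row of sum at least 2 works with any of its zeros. Otherwise a nonzero row i has sum 1 and
  -- another row is nonzero in some column j. If Bᵢⱼ = 0, row and column contribute one each; if
  -- not, column j already holds two and has a zero, its sum being less than its length.
  crossed-zero : ∀ {n} (B : Fin (suc n) → Fin (suc n) → ℕ) →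
    (∀ i → sum (B i) < suc n) → (∀ j → column B j < suc n) → 2 ≤ total B →
    ∃₂ λ i j → B i j ≡ 0 × 2 ≤ sum (B i) + column B j
  crossed-zero {n} B rows columns 2≤B with 0<sum⇒∃ (λ i → sum (B i)) (≤-trans (s≤s z≤n) 2≤B)
  ... | i , 1≤row with 2 ≤? sum (B i)
  ... | yes 2≤row = let j , Bij≡0 = sum-<n⇒∃0 (B i) (rows i)
                    in i , j , Bij≡0 , ≤-trans 2≤row (m≤m+n _ _)
  ... | no 2≰row with 0<sum⇒∃ (λ a → sum (B (punchIn i a))) others
    where
    others : 0 < sum (λ a → sum (B (punchIn i a)))
    others = +-cancelˡ-≤ 1 _ _ (≤-trans 2≤B (≤-trans (≤-reflexive (sum-remove {i = i} (λ i → sum (B i))))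
      (+-monoˡ-≤ _ (s≤s⁻¹ (≰⇒> 2≰row)))))
  ... | a , 1≤rowₐ with 0<sum⇒∃ (B (punchIn i a)) 1≤rowₐ
  ... | j , 1≤Baj with B i j in Bij
  ... | zero = i , j , Bij , +-mono-≤ 1≤row (≤-trans 1≤Baj (≤-sum (λ i → B i j) (punchIn i a)))
  ... | suc b =
    let i′ , Bi′j≡0 = sum-<n⇒∃0 (λ i → B i j) (columns j)
    in i′ , j , Bi′j≡0 , ≤-trans 2≤column (m≤n+m (column B j) (sum (B i′)))
    where
    2≤column : 2 ≤ column B j
    2≤column = subst (2 ≤_) (sym (sum-remove {i = i} (λ i → B i j)))
      (+-mono-≤ (subst (1 ≤_) (sym Bij) (s≤s z≤n)) (≤-trans 1≤Baj (≤-sum (λ a → B (punchIn i a) j) a)))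

  -- With side n = 2 + k the total is at most 2(n - 1) - 1, one less than the smallest obstruction
  -- other than a full line. Passing to a minor lowers this bound by 2, which dictates the choice of
  -- the zero.
  Hall : ℕ → Set
  Hall k = ∀ (B : Fin (2 + k) → Fin (2 + k) → ℕ) →
    (∀ i → sum (B i) < 2 + k) → (∀ j → column B j < 2 + k) → total B ≤ suc (k + k) → Avoidable B

  -- The side is 3 + k. Deleting lines of joint weight 2 + k leaves a total of at most k + 1, less
  -- than the side of the minor, so its line conditions are automatic.
  Hall-heavy : ∀ {k} → Hall k → ∀ B i j → B i j ≡ 0 → 2 + k ≤ sum (B i) + column B j →
               total B ≤ suc (suc k + suc k) → Avoidable B
  Hall-heavy {k} hall B i j Bij≡0 heavy few = Avoidable-extend B i j Bij≡0 (hall (minor B i j)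
    (λ a → s≤s (≤-trans (≤-sum (λ a → sum (minor B i j a)) a) sparse))
    (λ b → s≤s (≤-trans (column≤total (minor B i j) b) sparse))
    (≤-trans sparse (s≤s (m≤m+n k k))))
    where
    sparse : total (minor B i j) ≤ suc k
    sparse = minor-≤ B i j Bij≡0 (2 + k) (suc k) heavy few

  -- All lines already fit the smaller side, so only the total has to drop.
  Hall-light : ∀ {k} → Hall k → ∀ B i j → B i j ≡ 0 →
               (∀ i → sum (B i) < 2 + k) → (∀ j → column B j < 2 + k) →
               total (minor B i j) ≤ suc (k + k) → Avoidable B
  Hall-light hall B i j Bij≡0 rows columns few = Avoidable-extend B i j Bij≡0 (hall (minor B i j)
    (λ a → ≤-<-trans (sum-punchIn-≤ (B (punchIn i a)) j) (rows (punchIn i a)))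
    (λ b → ≤-<-trans (sum-punchIn-≤ (λ a → B a (punchIn j b)) i) (columns (punchIn j b)))
    few)

  -- A failure of Hall's condition is an all-nonzero s × t block with s + t = n + 1, which has at
  -- least 2(n − 1) entries unless it is a full row or a full column.
  hall : ∀ k → Hall k
  hall zero B _ _ few with B zero zero + B (suc zero) (suc zero) ≟ 0
  ... | yes diagonal≡0 = idₚ , λ { zero       → m+n≡0⇒m≡0 (B zero zero) diagonal≡0
                                 ; (suc zero) → m+n≡0⇒n≡0 (B zero zero) diagonal≡0 }
  ... | no  diagonal≢0 = transpose zero (suc zero) , λ
      { zero       → m+n≡0⇒m≡0 (B zero (suc zero)) (n≤0⇒n≡0 antidiagonal≤0)
      ; (suc zero) → m+n≡0⇒n≡0 (B zero (suc zero)) (n≤0⇒n≡0 antidiagonal≤0) }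
    where
    rearrange : ∀ a b c d → (a + d) + (b + c) ≡ (a + (b + 0)) + ((c + (d + 0)) + 0)
    rearrange = solve-∀
    antidiagonal≤0 : B zero (suc zero) + B (suc zero) zero ≤ 0
    antidiagonal≤0 = +-cancelˡ-≤ 1 _ _ (≤-trans (+-monoˡ-≤ _ (n≢0⇒n>0 diagonal≢0))
      (≤-trans (≤-reflexive (rearrange (B zero zero) _ _ _)) few))
  hall (suc k) B rows columns few
    with any? (λ i → 2 + k ≤? sum (B i)) | any? (λ j → 2 + k ≤? column B j)
  ... | yes (i , heavy) | _ =
    let j , Bij≡0 = sum-<n⇒∃0 (B i) (rows i)
    in Hall-heavy (hall k) B i j Bij≡0 (≤-trans heavy (m≤m+n (sum (B i)) (column B j))) few
  ... | no _ | yes (j , heavy) =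
    let i , Bij≡0 = sum-<n⇒∃0 (λ i → B i j) (columns j)
    in Hall-heavy (hall k) B i j Bij≡0 (≤-trans heavy (m≤n+m (column B j) (sum (B i)))) few
  ... | no rows≱ | no columns≱ with total B ≤? suc (k + k)
  ... | yes fewer =
    let j , Bij≡0 = sum-<n⇒∃0 (B zero) (rows zero)
    in Hall-light (hall k) B zero j Bij≡0 (λ i → ≰⇒> λ h → rows≱ (i , h)) (λ j → ≰⇒> λ h → columns≱ (j , h))
         (minor-≤ B zero j Bij≡0 0 (suc (k + k)) z≤n fewer)
  -- The total is now at least 2k + 2, hence at least 2, and the bound falls from 2k + 3 to 2k + 1.
  ... | no many =
    let i , j , Bij≡0 , 2≤ = crossed-zero B rows columns (≤-trans (s≤s (s≤s z≤n)) (≰⇒> many))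
    in Hall-light (hall k) B i j Bij≡0 (λ i → ≰⇒> λ h → rows≱ (i , h)) (λ j → ≰⇒> λ h → columns≱ (j , h))
         (minor-≤ B i j Bij≡0 2 (suc (k + k)) 2≤ (≤-trans few (≤-reflexive (cong (2 +_) (+-suc k k)))))

  -- Hamilton cycles from permutations of positions

  cyclic : ∀ {M} → Permutation′ (suc M)
  cyclic {M} = permutation next previous next-previous previous-next
    where
    next : ∀ {M} → Fin (suc M) → Fin (suc M)
    next i with view i
    ... | ‵fromℕ     = zero
    ... | ‵inject₁ j = suc j
    -- Defined on constructors so that `flip cyclic` computes; the table in `column-star` relies on
    -- this.
    previous : ∀ {M} → Fin (suc M) → Fin (suc M)
    previous zero    = fromℕ _
    previous (suc j) = inject₁ j
    next-previous : ∀ {M} (i : Fin (suc M)) → next (previous i) ≡ i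
    next-previous {M} zero rewrite view-fromℕ M   = refl
    next-previous (suc j)  rewrite view-inject₁ j = refl
    previous-next : ∀ {M} (i : Fin (suc M)) → previous (next i) ≡ i
    previous-next i with view i
    ... | ‵fromℕ     = refl
    ... | ‵inject₁ j = refl

  cyclic-fromℕ : ∀ M → cyclic ⟨$⟩ʳ fromℕ M ≡ zero
  cyclic-fromℕ M = inverseʳ cyclic {zero}

  cyclic-inject₁ : ∀ {M} (j : Fin M) → cyclic ⟨$⟩ʳ inject₁ j ≡ suc j
  cyclic-inject₁ j = inverseʳ cyclic {suc j}

  cyclic-CyclicSuc : ∀ {M} (i : Fin (suc M)) → CyclicSuc i (cyclic ⟨$⟩ʳ i)
  cyclic-CyclicSuc {M} i with view i
  ... | ‵fromℕ     = inj₂ (cong suc (toℕ-fromℕ M) , refl)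
  ... | ‵inject₁ j = inj₁ (cong suc (toℕ-inject₁ j))

  CyclicSuc-unique : ∀ {N} {i j k : Fin N} → CyclicSuc i j → CyclicSuc i k → j ≡ k
  CyclicSuc-unique {k = k} (inj₁ p) (inj₁ q) = toℕ-injective (trans (sym p) q)
  CyclicSuc-unique {j = j} (inj₁ p) (inj₂ (q , _)) = contradiction (trans (sym p) q) (<⇒≢ (toℕ<n j))
  CyclicSuc-unique {k = k} (inj₂ (p , _)) (inj₁ q) = contradiction (trans (sym q) p) (<⇒≢ (toℕ<n k))
  CyclicSuc-unique (inj₂ (_ , p)) (inj₂ (_ , q)) = toℕ-injective (trans p (sym q))

  CyclicSuc-irrefl : ∀ {N} {i : Fin N} → 2 ≤ N → ¬ CyclicSuc i i
  CyclicSuc-irrefl _   (inj₁ p)       = 1+n≢n p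
  CyclicSuc-irrefl 2≤N (inj₂ (p , q)) = <⇒≢ 2≤N (trans (cong suc (sym q)) p)

  -- On two vertices the successor relation is symmetric. From three on, a cycle edge has one
  -- direction and hence one position.
  CyclicSuc-asym : ∀ {N} {i j : Fin N} → 3 ≤ N → CyclicSuc i j → ¬ CyclicSuc j i
  CyclicSuc-asym {i = i} _ (inj₁ p) (inj₁ q) =
    <⇒≢ (m≤n+m (suc (toℕ i)) 1) (trans (sym q) (cong suc (sym p)))
  CyclicSuc-asym 3≤N (inj₁ p) (inj₂ (q , r)) =
    <⇒≢ 3≤N (trans (cong suc (trans (cong suc (sym r)) p)) q)
  CyclicSuc-asym 3≤N (inj₂ (p , r)) (inj₁ q) =
    <⇒≢ 3≤N (trans (cong suc (trans (cong suc (sym r)) q)) p)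
  CyclicSuc-asym 3≤N (inj₂ (p , _)) (inj₂ (_ , q)) =
    <⇒≢ (≤-trans (s≤s (s≤s z≤n)) 3≤N) (trans (cong suc (sym q)) p)

  module _ {M} (3≤N : 3 ≤ suc M) (c : Permutation′ (suc M)) where

    private
      N = suc M
      s : Fin N → Fin N
      s = cyclic ⟨$⟩ʳ_
      position : Fin N → Fin N
      position = c ⟨$⟩ˡ_
      Next : Fin N → Fin N → Set
      Next u v = s (position u) ≡ position v
      next? : ∀ u v → Dec (Next u v)
      next? u v = s (position u) ≟ᶠ position v

      s≢ : ∀ i → s i ≢ i
      s≢ i eq = CyclicSuc-irrefl (≤-trans (s≤s (s≤s z≤n)) 3≤N) (subst (CyclicSuc i) eq (cyclic-CyclicSuc i))

      s²≢ : ∀ i → s (s i) ≢ i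
      s²≢ i eq = CyclicSuc-asym 3≤N (cyclic-CyclicSuc i) (subst (CyclicSuc (s i)) eq (cyclic-CyclicSuc (s i)))

      joined : Fin N → Fin N → Bool
      joined u v = does (next? u v) ∨ does (next? v u)

      joined⇒ : ∀ u v → joined u v ≡ true → Next u v ⊎ Next v u
      joined⇒ u v eq with next? u v | next? v u
      ... | yes uv | _      = inj₁ uv
      ... | no _   | yes vu = inj₂ vu

      ⇒joined : ∀ u v → Next u v → joined u v ≡ true
      ⇒joined u v uv rewrite dec-true (next? u v) uv = refl

      joined-irrefl : ∀ u → joined u u ≡ false
      joined-irrefl u rewrite dec-false (next? u u) (s≢ (position u)) = refl

    cycleGraph : Graph N
    cycleGraph = record
      { adj = joined ; adj-sym = λ u v → ∨-comm (does (next? u v)) (does (next? v u)) ; irrefl = joined-irrefl }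

    private
      next-at : ∀ i → Next (c ⟨$⟩ʳ i) (c ⟨$⟩ʳ s i)
      next-at i = trans (cong s (inverseˡ c)) (sym (inverseˡ c))

      start : ∀ {u v} → Next u v → u ≡ c ⟨$⟩ʳ position u × v ≡ c ⟨$⟩ʳ s (position u)
      start uv = sym (inverseʳ c) , trans (sym (inverseʳ c)) (cong (c ⟨$⟩ʳ_) (sym uv))

    cycleGraph-isHamiltonCycle : IsHamiltonCycle cycleGraph
    cycleGraph-isHamiltonCycle = 3≤N , c , λ u v → mk⇔ (to u v) (from u v)
      where
      to : ∀ u v → joined u v ≡ true → ∃₂ λ i j → CyclicSuc i j ×
        ((u ≡ c ⟨$⟩ʳ i × v ≡ c ⟨$⟩ʳ j) ⊎ (u ≡ c ⟨$⟩ʳ j × v ≡ c ⟨$⟩ʳ i))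
      to u v eq with joined⇒ u v eq
      ... | inj₁ uv = position u , s (position u) , cyclic-CyclicSuc (position u) , inj₁ (start uv)
      ... | inj₂ vu = position v , s (position v) , cyclic-CyclicSuc (position v)
                    , inj₂ (proj₂ (start vu) , proj₁ (start vu))
      at : ∀ i j → CyclicSuc i j → joined (c ⟨$⟩ʳ i) (c ⟨$⟩ʳ j) ≡ true
      at i j i→j rewrite CyclicSuc-unique i→j (cyclic-CyclicSuc i) = ⇒joined _ _ (next-at i)
      from : ∀ u v → (∃₂ λ i j → CyclicSuc i j ×
        ((u ≡ c ⟨$⟩ʳ i × v ≡ c ⟨$⟩ʳ j) ⊎ (u ≡ c ⟨$⟩ʳ j × v ≡ c ⟨$⟩ʳ i))) → joined u v ≡ true
      from u v (i , j , i→j , inj₁ (refl , refl)) = at i j i→j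
      from u v (i , j , i→j , inj₂ (refl , refl)) = trans (adj-sym cycleGraph u v) (at i j i→j)

    private
      -- An `Edge` lists its smaller endpoint first, whatever the direction of the cycle; this
      -- recovers the position of the endpoint that comes first along `c`.
      first : Fin N → Fin N → Fin N
      first u v with next? u v
      ... | yes _ = position u
      ... | no  _ = position v

      edgePosition : Edge cycleGraph → Fin N
      edgePosition ((u , v) , _) = first u v

      first-ends : ∀ u v → Next u v ⊎ Next v u →
        (u ≡ c ⟨$⟩ʳ first u v × v ≡ c ⟨$⟩ʳ s (first u v)) ⊎ (v ≡ c ⟨$⟩ʳ first u v × u ≡ c ⟨$⟩ʳ s (first u v))
      first-ends u v next with next? u v
      first-ends u v _         | yes uv = inj₁ (start uv)
      first-ends u v (inj₁ uv) | no ¬uv = contradiction uv ¬uv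
      first-ends u v (inj₂ vu) | no _   = inj₂ (start vu)

      ends : ∀ (e : Edge cycleGraph) → let ((u , v) , _) = e in
        (u ≡ c ⟨$⟩ʳ edgePosition e × v ≡ c ⟨$⟩ʳ s (edgePosition e)) ⊎
        (v ≡ c ⟨$⟩ʳ edgePosition e × u ≡ c ⟨$⟩ʳ s (edgePosition e))
      ends ((u , v) , _ , eq) = first-ends u v (joined⇒ u v eq)

      edge-≡ : ∀ (e f : Edge cycleGraph) → proj₁ e ≡ proj₁ f → e ≡ f
      edge-≡ (uv , u<v , p) (.uv , u<v′ , p′) refl =
        cong₂ (λ x y → uv , x , y) (<-irrelevantᶠ u<v u<v′) (Decidable⇒UIP.≡-irrelevant _≟ᵇ_ p p′)

      edgePosition-injective : ∀ {e f} → edgePosition e ≡ edgePosition f → e ≡ f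
      edgePosition-injective {e} {f} eq with ends e | ends f
      ... | inj₁ (u≡ , v≡) | inj₁ (u′≡ , v′≡) = edge-≡ e f (cong₂ _,_
        (trans u≡ (trans (cong (c ⟨$⟩ʳ_) eq) (sym u′≡))) (trans v≡ (trans (cong (λ i → c ⟨$⟩ʳ s i) eq) (sym v′≡))))
      ... | inj₂ (v≡ , u≡) | inj₂ (v′≡ , u′≡) = edge-≡ e f (cong₂ _,_
        (trans u≡ (trans (cong (λ i → c ⟨$⟩ʳ s i) eq) (sym u′≡))) (trans v≡ (trans (cong (c ⟨$⟩ʳ_) eq) (sym v′≡))))
      -- One position read in opposite directions would order the same two vertices both ways.
      ... | inj₁ (u≡ , v≡) | inj₂ (v′≡ , u′≡) = contradiction
        (subst₂ Fin._<_ (trans u≡ (trans (cong (c ⟨$⟩ʳ_) eq) (sym v′≡)))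
          (trans v≡ (trans (cong (λ i → c ⟨$⟩ʳ s i) eq) (sym u′≡))) (proj₁ (proj₂ e)))
        (<-asymᶠ (proj₁ (proj₂ f)))
      ... | inj₂ (v≡ , u≡) | inj₁ (u′≡ , v′≡) = contradiction
        (subst₂ Fin._<_ (trans u≡ (trans (cong (λ i → c ⟨$⟩ʳ s i) eq) (sym v′≡)))
          (trans v≡ (trans (cong (c ⟨$⟩ʳ_) eq) (sym u′≡))) (proj₁ (proj₂ e)))
        (<-asymᶠ (proj₁ (proj₂ f)))

      c-injective : ∀ {i j} → c ⟨$⟩ʳ i ≡ c ⟨$⟩ʳ j → i ≡ j
      c-injective eq = trans (sym (inverseˡ c)) (trans (cong (c ⟨$⟩ˡ_) eq) (inverseˡ c))

      edgePosition-at : ∀ e i → (proj₁ e ≡ (c ⟨$⟩ʳ i , c ⟨$⟩ʳ s i)) ⊎ (proj₁ e ≡ (c ⟨$⟩ʳ s i , c ⟨$⟩ʳ i)) →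
                        edgePosition e ≡ i
      edgePosition-at e i (inj₁ refl) with ends e
      ... | inj₁ (u≡ , _)  = sym (c-injective u≡)
      ... | inj₂ (v≡ , u≡) = contradiction (trans (cong s (c-injective v≡)) (sym (c-injective u≡))) (s²≢ i)
      edgePosition-at e i (inj₂ refl) with ends e
      ... | inj₂ (v≡ , _)  = sym (c-injective v≡)
      ... | inj₁ (u≡ , v≡) = contradiction (trans (cong s (c-injective u≡)) (sym (c-injective v≡))) (s²≢ i)

      edgePosition-surjective : ∀ i → ∃ λ e → edgePosition e ≡ i
      edgePosition-surjective i with <-cmpᶠ (c ⟨$⟩ʳ i) (c ⟨$⟩ʳ s i)
      ... | tri< u<v _ _ = let e = _ , u<v , ⇒joined _ _ (next-at i) in e , edgePosition-at e i (inj₁ refl)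
      ... | tri≈ _ u≡v _ = contradiction (sym (c-injective u≡v)) (s≢ i)
      ... | tri> _ _ v<u =
        let e = _ , v<u , trans (adj-sym cycleGraph _ _) (⇒joined _ _ (next-at i))
        in e , edgePosition-at e i (inj₂ refl)

    -- Edges correspond to positions, so a colouring can be given as a permutation of positions.
    rainbowHamiltonCycle : (𝓖 : Fin N → Graph N) (φ : Permutation′ N) →
      (∀ i → adj (𝓖 (φ ⟨$⟩ʳ i)) (c ⟨$⟩ʳ i) (c ⟨$⟩ʳ s i) ≡ true) → HasRainbowHamiltonCycle 𝓖
    rainbowHamiltonCycle 𝓖 φ present = cycleGraph , cycleGraph-isHamiltonCycle , colouring , coloured
      where
      φ-injective : ∀ {i j} → φ ⟨$⟩ʳ i ≡ φ ⟨$⟩ʳ j → i ≡ j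
      φ-injective eq = trans (sym (inverseˡ φ)) (trans (cong (φ ⟨$⟩ˡ_) eq) (inverseˡ φ))
      colouring : Edge cycleGraph ⤖ Fin N
      colouring = mk⤖ {to = λ e → φ ⟨$⟩ʳ edgePosition e}
        ( edgePosition-injective ∘ φ-injective
        , λ k → let e , eq = edgePosition-surjective (φ ⟨$⟩ˡ k)
                in e , λ { refl → trans (cong (φ ⟨$⟩ʳ_) eq) (inverseʳ φ) })
      coloured : ∀ (e : Edge cycleGraph) → let ((u , v) , _) = e in adj (𝓖 (Bijection.to colouring e)) u v ≡ true
      coloured e@((u , v) , _) with ends e
      ... | inj₁ (u≡ , v≡) = trans (cong₂ (adj (𝓖 (φ ⟨$⟩ʳ edgePosition e))) u≡ v≡) (present (edgePosition e))
      ... | inj₂ (v≡ , u≡) = trans (adj-sym (𝓖 (φ ⟨$⟩ʳ edgePosition e)) u v)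
        (trans (cong₂ (adj (𝓖 (φ ⟨$⟩ʳ edgePosition e))) v≡ u≡) (present (edgePosition e)))

  -- Closed walks as vertex lists

  sum-cyclic : ∀ {M} (g : Fin (suc M) → Fin (suc M) → ℕ) →
    sum (λ i → g i (cyclic ⟨$⟩ʳ i)) ≡ sum (λ j → g (inject₁ j) (suc j)) + g (fromℕ M) zero
  sum-cyclic {M} g = trans (sum-init-last (λ i → g i (cyclic ⟨$⟩ʳ i))) (cong₂ _+_
    (sum-cong-≗ λ j → cong (g (inject₁ j)) (cyclic-inject₁ j)) (cong (g (fromℕ M)) (cyclic-fromℕ M)))

  module _ {V : Set} where

    -- The weight `f` stays generic: the same identities serve the misses of one colour, of all
    -- colours together, and the dead edges.
    walk : (V → V → ℕ) → V → List V → V → ℕ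
    walk f u []      v = f u v
    walk f u (w ∷ l) v = f u w + walk f w l v

    walk-++ : ∀ f u l w r v → walk f u (l ++ w ∷ r) v ≡ walk f u l w + walk f w r v
    walk-++ f u []      w r v = refl
    walk-++ f u (x ∷ l) w r v = trans (cong (f u x +_) (walk-++ f x l w r v)) (sym (+-assoc (f u x) _ _))

    walk-ʳ++ : ∀ f → (∀ u v → f u v ≡ f v u) → ∀ a l u r v →
               walk f a (l ʳ++ u ∷ r) v ≡ walk f u l a + walk f u r v
    walk-ʳ++ f f-sym a []      u r v = cong (_+ walk f u r v) (f-sym a u)
    walk-ʳ++ f f-sym a (x ∷ l) u r v = trans (walk-ʳ++ f f-sym a l x (u ∷ r) v)
      (trans (cong (λ t → walk f x l a + (t + walk f u r v)) (f-sym x u))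
        (trans (sym (+-assoc (walk f x l a) (f u x) (walk f u r v)))
          (cong (_+ walk f u r v) (+-comm (walk f x l a) (f u x)))))

    walk-lookup : ∀ f u l v →
      sum (λ j → f (lookup (u ∷ l) (inject₁ j)) (lookup l j)) + f (lookup (u ∷ l) (fromℕ (length l))) v
      ≡ walk f u l v
    walk-lookup f u []      v = refl
    walk-lookup f u (w ∷ l) v = trans (+-assoc (f u w) _ _) (cong (f u w +_) (walk-lookup f w l v))

    cycle-lookup : ∀ f u l →
      sum (λ i → f (lookup (u ∷ l) i) (lookup (u ∷ l) (cyclic ⟨$⟩ʳ i))) ≡ walk f u l u
    cycle-lookup f u l = trans (sum-cyclic (λ i j → f (lookup (u ∷ l) i) (lookup (u ∷ l) j)))
      (walk-lookup f u l u)

    lookup-injective : ∀ {l : List V} → Unique l → ∀ i j → lookup l i ≡ lookup l j → i ≡ j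
    lookup-injective (u∉ ∷ _) zero    zero    eq = refl
    lookup-injective (u∉ ∷ _) zero    (suc j) eq = contradiction eq (All.lookup u∉ (∈-lookup j))
    lookup-injective (u∉ ∷ _) (suc i) zero    eq = contradiction (sym eq) (All.lookup u∉ (∈-lookup i))
    lookup-injective (_ ∷ un) (suc i) (suc j) eq = cong suc (lookup-injective un i j eq)

  -- Cycles are handled as lists because a segment reversal is then a list permutation; the
  -- permutation of positions is recovered afterwards.
  Spanning : ∀ {N} → List (Fin N) → Set
  Spanning l = Unique l × ∀ v → v ∈ l

  Spanning-resp-↭ : ∀ {N} {k l : List (Fin N)} → k ↭ l → Spanning k → Spanning l
  Spanning-resp-↭ k↭l (unique , all) =
    Permutationₛ.Unique-resp-↭ (setoid _) (↭⇒↭ₛ k↭l) unique , λ v → ∈-resp-↭ k↭l (all v)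

  spanning⇒permutation : ∀ {N} {l : List (Fin N)} → Spanning l → Permutation (length l) N
  spanning⇒permutation {l = l} (unique , all) = permutation (lookup l) (λ v → index (all v))
    (λ v → sym (lookup-index (all v)))
    (λ i → lookup-injective unique (index (all (lookup l i))) i (sym (lookup-index (all (lookup l i)))))

  -- Misses, dead edges and rainbow colourings

  indicator : ∀ {P : Set} → Dec P → ℕ
  indicator (yes _) = 1
  indicator (no _)  = 0

  module Colours {N} (𝓖 : Fin N → Graph N) where

    miss : Fin N → Fin N → Fin N → ℕ
    miss k u v = if adj (𝓖 k) u v then 0 else 1

    misses : Fin N → Fin N → ℕ
    misses u v = sum (λ k → miss k u v)

    dead : Fin N → Fin N → ℕ
    dead u v = indicator (N ≤? misses u v)

    miss-sym : ∀ k u v → miss k u v ≡ miss k v u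
    miss-sym k u v = cong (if_then 0 else 1) (adj-sym (𝓖 k) u v)

    misses-sym : ∀ u v → misses u v ≡ misses v u
    misses-sym u v = sum-cong-≗ (λ k → miss-sym k u v)

    dead-sym : ∀ u v → dead u v ≡ dead v u
    dead-sym u v = cong (λ d → indicator (N ≤? d)) (misses-sym u v)

    miss≤1 : ∀ k u v → miss k u v ≤ 1
    miss≤1 k u v with adj (𝓖 k) u v
    ... | true  = z≤n
    ... | false = s≤s z≤n

    miss≡0⇒adj : ∀ k u v → miss k u v ≡ 0 → adj (𝓖 k) u v ≡ true
    miss≡0⇒adj k u v eq with adj (𝓖 k) u v
    ... | true = refl

    misses≤N : ∀ u v → misses u v ≤ N
    misses≤N u v = ≤-trans (sum-mono (λ k → miss≤1 k u v)) (≤-reflexive (trans (sum-const N 1) (*-identityʳ N)))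

    dead≡0⇒misses<N : ∀ u v → dead u v ≡ 0 → misses u v < N
    dead≡0⇒misses<N u v eq with N ≤? misses u v
    ... | no N≰ = ≰⇒> N≰

    1≤dead⇒N≤misses : ∀ u v → 1 ≤ dead u v → N ≤ misses u v
    1≤dead⇒N≤misses u v 1≤ with N ≤? misses u v
    ... | yes N≤ = N≤

    misses<N⇒dead≡0 : ∀ u v → misses u v < N → dead u v ≡ 0
    misses<N⇒dead≡0 u v <N with N ≤? misses u v
    ... | yes N≤ = contradiction N≤ (<⇒≱ <N)
    ... | no  _  = refl

    N≤misses⇒dead≡1 : ∀ u v → N ≤ misses u v → dead u v ≡ 1
    N≤misses⇒dead≡1 u v N≤ with N ≤? misses u v
    ... | yes _  = refl
    ... | no  N≰ = contradiction N≤ N≰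

    N*dead≤misses : ∀ u v → N * dead u v ≤ misses u v
    N*dead≤misses u v with N ≤? misses u v
    ... | yes N≤ = ≤-trans (≤-reflexive (*-identityʳ N)) N≤
    ... | no _   = ≤-trans (≤-reflexive (*-zeroʳ N)) z≤n

    N≤misses⇒1≤miss : ∀ u v → N ≤ misses u v → ∀ k → 1 ≤ miss k u v
    N≤misses⇒1≤miss u v N≤ = sum-tight (λ k → miss k u v) (λ _ → 1) (λ k → miss≤1 k u v)
      (≤-trans (≤-reflexive (trans (sum-const N 1) (*-identityʳ N))) N≤)

  module _ {k} (3≤N : 3 ≤ 2 + k) (𝓖 : Fin (2 + k) → Graph (2 + k)) where

    open Colours 𝓖

    -- Rows are the edges of the closed walk, columns the colours. An edge that is not dead is a row
    -- of sum below N, so these are the hypotheses of `hall`.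
    rainbow-spanning : ∀ u l → Spanning (u ∷ l) →
      (∀ j → walk (miss j) u l u < 2 + k) → walk dead u l u ≡ 0 →
      walk misses u l u ≤ suc (k + k) → HasRainbowHamiltonCycle 𝓖
    rainbow-spanning u l spanning columns alive few = go c
      (λ j → subst (_< 2 + k) (sym (cycle-lookup (miss j) u l)) (columns j))
      (trans (cycle-lookup dead u l) alive)
      (subst (_≤ suc (k + k)) (sym (cycle-lookup misses u l)) few)
      where
      c : Permutation (suc (length l)) (2 + k)
      c = spanning⇒permutation spanning
      -- The length of the list is generalised, so that comparing cardinalities can identify it with
      -- 2 + k.
      go : ∀ {m} (c : Permutation (suc m) (2 + k)) →
        (∀ j → sum (λ i → miss j (c ⟨$⟩ʳ i) (c ⟨$⟩ʳ (cyclic ⟨$⟩ʳ i))) < 2 + k) →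
        sum (λ i → dead (c ⟨$⟩ʳ i) (c ⟨$⟩ʳ (cyclic ⟨$⟩ʳ i))) ≡ 0 →
        sum (λ i → misses (c ⟨$⟩ʳ i) (c ⟨$⟩ʳ (cyclic ⟨$⟩ʳ i))) ≤ suc (k + k) →
        HasRainbowHamiltonCycle 𝓖
      go c columns alive few with ↔⇒≡ c
      ... | refl =
        let φ , present = hall k (λ i j → miss j (c ⟨$⟩ʳ i) (c ⟨$⟩ʳ (cyclic ⟨$⟩ʳ i)))
              (λ i → dead≡0⇒misses<N _ _ (sum≡0 (λ i → dead (c ⟨$⟩ʳ i) (c ⟨$⟩ʳ (cyclic ⟨$⟩ʳ i))) alive i))
              columns few
        in rainbowHamiltonCycle 3≤N c 𝓖 φ (λ i → miss≡0⇒adj (φ ⟨$⟩ʳ i) _ _ (present i))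

  -- Alternating cycles and segment reversal

  middle : ∀ {m} → Fin m → Fin (2 + m)
  middle j = suc (inject₁ j)

  last : ∀ {n} → Fin (suc n)
  last {n} = fromℕ n

  module _ {V : Set} where

    interleave : ∀ {n} → (Fin n → V) → (Fin n → V) → List V
    interleave {zero}  x y = []
    interleave {suc n} x y = x zero ∷ y zero ∷ interleave (x ∘ suc) (y ∘ suc)

    interleave-last : ∀ {n} (x y : Fin (suc n) → V) → ∃ λ l → interleave x y ≡ l ++ [ y last ]
    interleave-last {zero}  x y = x zero ∷ [] , refl
    interleave-last {suc n} x y =
      let l , eq = interleave-last (x ∘ suc) (y ∘ suc)
      in x zero ∷ y zero ∷ l , cong (λ l → x zero ∷ y zero ∷ l) eq

    interleave-split : ∀ {n} (x y : Fin (suc n) → V) (j : Fin n) → ∃₂ λ a b →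
      interleave x y ≡ a ++ x (inject₁ j) ∷ y (inject₁ j) ∷ b ++ [ y last ]
    interleave-split {suc n} x y zero =
      let b , eq = interleave-last (x ∘ suc) (y ∘ suc)
      in [] , b , cong (λ l → x zero ∷ y zero ∷ l) eq
    interleave-split {suc n} x y (suc j) =
      let a , b , eq = interleave-split (x ∘ suc) (y ∘ suc) j
      in x zero ∷ y zero ∷ a , b , cong (λ l → x zero ∷ y zero ∷ l) eq

    -- The weight of the cycle x₀ y₀ x₁ y₁ ..., closing from the last y back to x₀.
    cost : ∀ {n} → (V → V → ℕ) → (Fin (suc n) → V) → (Fin (suc n) → V) → ℕ
    cost f x y = sum (λ i → f (x i) (y i)) + sum (λ i → f (y i) (x (cyclic ⟨$⟩ʳ i)))

    walk-interleave : ∀ {n} f (x y : Fin (suc n) → V) v →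
      walk f (x zero) (y zero ∷ interleave (x ∘ suc) (y ∘ suc)) v
      ≡ sum (λ i → f (x i) (y i)) + (sum (λ j → f (y (inject₁ j)) (x (suc j))) + f (y last) v)
    walk-interleave {zero} f x y v = cong (_+ f (y zero) v) (sym (+-identityʳ (f (x zero) (y zero))))
    walk-interleave {suc n} f x y v = trans
      (cong (λ t → f (x zero) (y zero) + (f (y zero) (x (suc zero)) + t))
        (walk-interleave f (x ∘ suc) (y ∘ suc) v))
      (rearrange (f (x zero) (y zero)) (f (y zero) (x (suc zero))) _ _ _)
      where
      rearrange : ∀ a b c d e → a + (b + (c + (d + e))) ≡ (a + c) + ((b + d) + e)
      rearrange = solve-∀

    closed-interleave : ∀ {n} f (x y : Fin (suc n) → V) →
      walk f (x zero) (y zero ∷ interleave (x ∘ suc) (y ∘ suc)) (x zero) ≡ cost f x y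
    closed-interleave f x y = trans (walk-interleave f x y (x zero))
      (cong (sum (λ i → f (x i) (y i)) +_) (sym (sum-cyclic (λ i j → f (y i) (x j)))))

    -- Reversing the initial segment x₀ y₀ … xⱼ replaces the edges xⱼ yⱼ and y_last x₀ by
    -- x₀ yⱼ and y_last xⱼ.
    two-opt : ∀ {m} (x y : Fin (2 + m) → V) (j : Fin m) → ∃₂ λ u l →
      (interleave x y ↭ u ∷ l) ×
      (∀ f → (∀ u v → f u v ≡ f v u) →
        walk f u l u + (f (x (middle j)) (y (middle j)) + f (y last) (x zero))
        ≡ cost f x y + (f (x zero) (y (middle j)) + f (y last) (x (middle j))))
    two-opt {m} x y j =
      let a , b , eq = interleave-split (x ∘ suc) (y ∘ suc) j in
      xⱼ , (y zero ∷ a) ʳ++ x zero ∷ yⱼ ∷ b ++ [ y last ]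
      , ↭-trans (↭-reflexive (cong (λ l → x zero ∷ y zero ∷ l) eq))
          (↭-trans (prep (x zero) (shift xⱼ (y zero ∷ a) (yⱼ ∷ b ++ [ y last ])))
            (↭-trans (swap (x zero) xⱼ ↭-refl) (prep xⱼ (reversed (y zero ∷ a) b))))
      , λ f f-sym → trans
          (cong (_+ (f xⱼ yⱼ + f (y last) (x zero)))
            (trans (walk-ʳ++ f f-sym xⱼ (y zero ∷ a) (x zero) (yⱼ ∷ b ++ [ y last ]) xⱼ)
              (cong (λ t → walk f (x zero) (y zero ∷ a) xⱼ + (f (x zero) yⱼ + t)) (walk-++ f yⱼ b (y last) [] xⱼ))))
          (trans (exchange (walk f (x zero) (y zero ∷ a) xⱼ) (f (x zero) yⱼ) (walk f yⱼ b (y last))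
                   (f (y last) xⱼ) (f xⱼ yⱼ) (f (y last) (x zero)))
            (cong (_+ (f (x zero) yⱼ + f (y last) xⱼ)) (sym (trans
              (sym (closed-interleave f x y))
              (trans (cong (λ l → walk f (x zero) (y zero ∷ l) (x zero)) eq)
                (trans (walk-++ f (x zero) (y zero ∷ a) xⱼ (yⱼ ∷ b ++ [ y last ]) (x zero))
                  (cong (λ t → walk f (x zero) (y zero ∷ a) xⱼ + (f xⱼ yⱼ + t))
                    (walk-++ f yⱼ b (y last) [] (x zero)))))))))
      where
      xⱼ = x (middle j)
      yⱼ = y (middle j)
      exchange : ∀ p q r s t w → p + (q + (r + s)) + (t + w) ≡ p + (t + (r + w)) + (q + s)
      exchange = solve-∀
      reversed : ∀ a b → x zero ∷ a ++ yⱼ ∷ b ++ [ y last ] ↭ a ʳ++ x zero ∷ yⱼ ∷ b ++ [ y last ]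
      reversed a b = ↭-sym (↭-trans (↭-reflexive (ʳ++-defn a))
        (↭-trans (++⁺ʳ (x zero ∷ yⱼ ∷ b ++ [ y last ]) (↭-reverse a))
          (shift (x zero) a (yⱼ ∷ b ++ [ y last ]))))

    interleave-↭ : ∀ {n} (x y : Fin n → V) → tabulate x ++ tabulate y ↭ interleave x y
    interleave-↭ {zero}  x y = ↭-refl
    interleave-↭ {suc n} x y = prep (x zero) (↭-trans (shift (y zero) (tabulate (x ∘ suc)) (tabulate (y ∘ suc)))
      (prep (y zero) (interleave-↭ (x ∘ suc) (y ∘ suc))))

    grid : ∀ {m n} → (V → V → ℕ) → (Fin m → V) → (Fin n → V) → ℕ
    grid f x y = total (λ i j → f (x i) (y j))

    grid-permute : ∀ {m n} f (x : Fin m → V) (y : Fin n → V) (π : Permutation′ m) (τ : Permutation′ n) →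
      grid f (x ∘ (π ⟨$⟩ʳ_)) (y ∘ (τ ⟨$⟩ʳ_)) ≡ grid f x y
    grid-permute f x y π τ = trans
      (sum-cong-≗ λ i → sym (sum-permute (λ j → f (x (π ⟨$⟩ʳ i)) (y j)) τ))
      (sym (sum-permute (λ i → sum (λ j → f (x i) (y j))) π))

    grid-swap : ∀ {m n} f → (∀ u v → f u v ≡ f v u) → (x : Fin m → V) (y : Fin n → V) → grid f y x ≡ grid f x y
    grid-swap f f-sym x y = trans (∑-comm (λ j i → f (y j) (x i)))
      (sum-cong-≗ λ i → sum-cong-≗ λ j → f-sym (y j) (x i))

    -- The edges xᵢyᵢ are distinct crossing pairs, and so are the turns yᵢxᵢ₊₁.
    cost≤2grid : ∀ {n} f → (∀ u v → f u v ≡ f v u) → (x y : Fin (suc n) → V) →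
      cost f x y ≤ grid f x y + grid f x y
    cost≤2grid f f-sym x y = +-mono-≤ (sum-mono λ i → ≤-sum (λ j → f (x i) (y j)) i)
      (≤-trans (sum-mono λ i → ≤-sum (λ j → f (y i) (x j)) (cyclic ⟨$⟩ʳ i)) (≤-reflexive (grid-swap f f-sym x y)))

  -- Rotations of one part against the other

  rotation : ∀ {n} → ℕ → Permutation′ (suc n)
  rotation zero    = idₚ
  rotation (suc k) = rotation k ∘ₚ cyclic

  module _ {n : ℕ} where

    private
      rot : ℕ → Fin (suc n) → Fin (suc n)
      rot k = rotation k ⟨$⟩ʳ_

    rotation-+ : ∀ j k i → rot j (rot k i) ≡ rot (j + k) i
    rotation-+ zero    k i = refl
    rotation-+ (suc j) k i = cong (cyclic ⟨$⟩ʳ_) (rotation-+ j k i)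

    toℕ-rotation-zero : ∀ k → k < suc n → toℕ (rot k zero) ≡ k
    toℕ-rotation-zero zero    _   = refl
    toℕ-rotation-zero (suc k) k<n with cyclic-CyclicSuc (rot k zero)
    ... | inj₁ eq       = trans (sym eq) (cong suc (toℕ-rotation-zero k (<-trans (n<1+n k) k<n)))
    ... | inj₂ (eq , _) = contradiction
      (trans (cong suc (sym (toℕ-rotation-zero k (<-trans (n<1+n k) k<n)))) eq) (<⇒≢ k<n)

    rotation-zero : ∀ i → rot (toℕ i) zero ≡ i
    rotation-zero i = toℕ-injective (toℕ-rotation-zero (toℕ i) (toℕ<n i))

    -- Both sides are i + j modulo the length; by this symmetry a sum over rotations becomes a sum
    -- over points.
    rotation-comm : ∀ i j → rot (toℕ i) j ≡ rot (toℕ j) i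
    rotation-comm i j = begin
      rot (toℕ i) j                   ≡⟨ cong (rot (toℕ i)) (rotation-zero j) ⟨
      rot (toℕ i) (rot (toℕ j) zero)  ≡⟨ rotation-+ (toℕ i) (toℕ j) zero ⟩
      rot (toℕ i + toℕ j) zero        ≡⟨ cong (λ k → rot k zero) (+-comm (toℕ i) (toℕ j)) ⟩
      rot (toℕ j + toℕ i) zero        ≡⟨ rotation-+ (toℕ j) (toℕ i) zero ⟨
      rot (toℕ j) (rot (toℕ i) zero)  ≡⟨ cong (rot (toℕ j)) (rotation-zero i) ⟩
      rot (toℕ j) i                   ∎
      where open ≡-Reasoning

    rotation-cyclic : ∀ k i → rot k (cyclic ⟨$⟩ʳ i) ≡ cyclic ⟨$⟩ʳ rot k i
    rotation-cyclic zero    i = refl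
    rotation-cyclic (suc k) i = cong (cyclic ⟨$⟩ʳ_) (rotation-cyclic k i)

    -- Starting just after i makes i the last index, which brings any turn to the closing position.
    rotation-last : ∀ i → rot (suc (toℕ i)) last ≡ i
    rotation-last i = trans (sym (rotation-cyclic (toℕ i) last))
      (trans (cong (rot (toℕ i)) (cyclic-fromℕ n)) (rotation-zero i))

    -- Every crossing pair lies on exactly two of the n rotated cycles.
    sum-cost-rotations : ∀ {V : Set} f → (∀ u v → f u v ≡ f v u) → (x y : Fin (suc n) → V) →
      sum (λ (r : Fin (suc n)) → cost f x (y ∘ rot (toℕ r))) ≡ grid f x y + grid f x y
    sum-cost-rotations f f-sym x y = trans
      (∑-distrib-+ {n = suc n} (λ r → sum (λ i → f (x i) (y (rot (toℕ r) i))))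
                               (λ r → sum (λ i → f (y (rot (toℕ r) i)) (x (cyclic ⟨$⟩ʳ i)))))
      (cong₂ _+_ (shifted (λ i v → f (x i) v))
        (trans (shifted (λ i v → f v (x (cyclic ⟨$⟩ʳ i))))
          (trans (sum-cong-≗ λ i → sum-cong-≗ λ j → f-sym (y j) (x (cyclic ⟨$⟩ʳ i)))
            (sym (sum-permute (λ i → sum (λ j → f (x i) (y j))) cyclic)))))
      where
      shifted : (g : Fin (suc n) → _ → ℕ) →
        sum (λ (r : Fin (suc n)) → sum (λ i → g i (y (rot (toℕ r) i)))) ≡ total (λ i j → g i (y j))
      shifted g = trans (∑-comm {m = suc n} (λ r i → g i (y (rot (toℕ r) i))))
        (sum-cong-≗ λ i → trans (sum-cong-≗ λ r → cong (g i ∘ y) (rotation-comm r i))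
          (sym (sum-permute (λ j → g i (y j)) (rotation (toℕ i)))))

    cost-rotation : ∀ {V : Set} f (x y : Fin (suc n) → V) k → cost f (x ∘ rot k) (y ∘ rot k) ≡ cost f x y
    cost-rotation f x y k = cong₂ _+_
      (sym (sum-permute (λ i → f (x i) (y i)) (rotation k)))
      (trans (sum-cong-≗ λ i → cong (λ j → f (y (rot k i)) (x j)) (rotation-cyclic k i))
        (sym (sum-permute (λ i → f (y i) (x (cyclic ⟨$⟩ʳ i))) (rotation k))))

    -- The same cycle read from y₀. It exchanges the two kinds of edges, so a dead xᵢyᵢ can be
    -- treated as a dead turn.
    cost-half-turn : ∀ {V : Set} f (x y : Fin (suc n) → V) → cost f y (x ∘ (cyclic ⟨$⟩ʳ_)) ≡ cost f x y
    cost-half-turn f x y = trans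
      (cong (sum (λ i → f (y i) (x (cyclic ⟨$⟩ʳ i))) +_) (sym (sum-permute (λ i → f (x i) (y i)) cyclic)))
      (+-comm (sum (λ i → f (y i) (x (cyclic ⟨$⟩ʳ i)))) (sum (λ i → f (x i) (y i))))

  relabel : ∀ {n N} → Labelling n N → Permutation′ n → Permutation′ n → Labelling n N
  relabel L π τ = mk↔ₛ′ (Inverse.to L ∘ Sum.map (π ⟨$⟩ʳ_) (τ ⟨$⟩ʳ_)) (Sum.map (π ⟨$⟩ˡ_) (τ ⟨$⟩ˡ_) ∘ Inverse.from L)
    (λ v → trans (cong (Inverse.to L) (forth (Inverse.from L v))) (Inverse.strictlyInverseˡ L v))
    (λ s → trans (cong (Sum.map (π ⟨$⟩ˡ_) (τ ⟨$⟩ˡ_)) (Inverse.strictlyInverseʳ L (Sum.map (π ⟨$⟩ʳ_) (τ ⟨$⟩ʳ_) s))) (back s))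
    where
    forth : ∀ s → Sum.map (π ⟨$⟩ʳ_) (τ ⟨$⟩ʳ_) (Sum.map (π ⟨$⟩ˡ_) (τ ⟨$⟩ˡ_) s) ≡ s
    forth (inj₁ a) = cong inj₁ (inverseʳ π)
    forth (inj₂ b) = cong inj₂ (inverseʳ τ)
    back : ∀ s → Sum.map (π ⟨$⟩ˡ_) (τ ⟨$⟩ˡ_) (Sum.map (π ⟨$⟩ʳ_) (τ ⟨$⟩ʳ_) s) ≡ s
    back (inj₁ a) = cong inj₁ (inverseˡ π)
    back (inj₂ b) = cong inj₂ (inverseˡ τ)

  labelling-spanning : ∀ {n N} (L : Labelling n N) → Spanning (interleave (left L) (right L))
  labelling-spanning L = Spanning-resp-↭ (interleave-↭ (left L) (right L))
    ( ++⁺ (tabulate⁺ (inj₁-injective ∘ injective)) (tabulate⁺ (inj₂-injective ∘ injective)) disjoint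
    , λ v → subst (_∈ tabulate (left L) ++ tabulate (right L)) (Inverse.strictlyInverseˡ L v)
              (listed (Inverse.from L v)))
    where
    injective : ∀ {s t} → Inverse.to L s ≡ Inverse.to L t → s ≡ t
    injective eq = trans (sym (Inverse.strictlyInverseʳ L _))
      (trans (cong (Inverse.from L) eq) (Inverse.strictlyInverseʳ L _))
    listed : ∀ s → Inverse.to L s ∈ tabulate (left L) ++ tabulate (right L)
    listed (inj₁ a) = ∈-++⁺ˡ (∈-tabulate⁺ a)
    listed (inj₂ b) = ∈-++⁺ʳ (tabulate (left L)) (∈-tabulate⁺ b)
    disjoint : ∀ {v} → ¬ (v ∈ tabulate (left L) × v ∈ tabulate (right L))
    disjoint (v∈l , v∈r) with ∈-tabulate⁻ v∈l | ∈-tabulate⁻ v∈r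
    ... | a , refl | b , eq with injective eq
    ... | ()

  -- Everything outside row zero and column `last`, together with the corners (zero, zero) and
  -- (last, last) of these lines, which are edges of the cycle and not candidates for a reversal.
  offCross : ∀ {m} → (Fin (2 + m) → Fin (2 + m) → ℕ) → ℕ
  offCross F = F zero zero + (total (λ i j → F (suc i) (inject₁ j)) + F last last)

  total-cross : ∀ {m} (F : Fin (2 + m) → Fin (2 + m) → ℕ) →
    total F ≡ F zero last + sum (λ j → F zero (middle j) + F (middle j) last) + offCross F
  total-cross {m} F = begin
    sum (F zero) + sum (λ i → sum (F (suc i)))
      ≡⟨ cong₂ _+_ (cong (F zero zero +_) (sum-init-last (F zero ∘ suc)))
           (trans (sum-cong-≗ λ i → sum-init-last (F (suc i)))
             (trans (∑-distrib-+ (λ i → sum (λ j → F (suc i) (inject₁ j))) (λ i → F (suc i) last))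
               (cong (total inner +_) (sum-init-last (λ i → F (suc i) last))))) ⟩
    F zero zero + (sum (λ j → F zero (middle j)) + F zero last)
      + (total inner + (sum (λ j → F (middle j) last) + F last last))
      ≡⟨ rearrange (F zero zero) (sum (λ j → F zero (middle j))) (F zero last) (total inner)
           (sum (λ j → F (middle j) last)) (F last last) ⟩
    F zero last + (sum (λ j → F zero (middle j)) + sum (λ j → F (middle j) last)) + offCross F
      ≡⟨ cong (λ t → F zero last + t + offCross F)
           (sym (∑-distrib-+ (λ j → F zero (middle j)) (λ j → F (middle j) last))) ⟩
    F zero last + sum (λ j → F zero (middle j) + F (middle j) last) + offCross F ∎
    where
    open ≡-Reasoning
    inner : Fin (suc m) → Fin (suc m) → ℕ
    inner i j = F (suc i) (inject₁ j)
    rearrange : ∀ a p q t r l → a + (p + q) + (t + (r + l)) ≡ q + (p + r) + (a + (t + l))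
    rearrange = solve-∀

  ∀-or-∃ : ∀ {n} {P Q : Fin n → Set} → (∀ i → P i ⊎ Q i) → (∀ i → P i) ⊎ ∃ Q
  ∀-or-∃ {zero}  _ = inj₁ λ ()
  ∀-or-∃ {suc n} p⊎q with p⊎q zero | ∀-or-∃ (p⊎q ∘ suc)
  ... | inj₂ q | _              = inj₂ (zero , q)
  ... | inj₁ _ | inj₂ (i , q)   = inj₂ (suc i , q)
  ... | inj₁ p | inj₁ ps        = inj₁ λ { zero → p ; (suc i) → ps i }

  -- A family in which every colour misses few pairs

  module Family (m : ℕ) (𝓖 : Fin (2 + (suc m + suc m)) → Graph (2 + (suc m + suc m))) where

    open Colours 𝓖

    -- With n = m + 2 this is N = 2n and k = 2n - 2. The form 2 + k is the one `Hall` asks for, and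
    -- k + k is 4n - 4.
    k N : ℕ
    k = suc m + suc m
    N = 2 + k

    Few : Labelling (2 + m) N → Set
    Few L = ∀ c → grid (miss c) (left L) (right L) ≤ suc m

    Few-relabel : ∀ L π τ → Few L → Few (relabel L π τ)
    Few-relabel L π τ few c = ≤-trans (≤-reflexive (grid-permute (miss c) (left L) (right L) π τ)) (few c)

    Few-swapSides : ∀ L → Few L → Few (swapSides L)
    Few-swapSides L few c = ≤-trans (≤-reflexive (grid-swap (miss c) (miss-sym c) (left L) (right L))) (few c)

    grid-misses : ∀ L → Few L → grid misses (left L) (right L) ≤ N * suc m
    grid-misses L few = begin
      grid misses x y
        ≡⟨ sum-cong-≗ (λ i → ∑-comm (λ j c → miss c (x i) (y j))) ⟩
      sum (λ i → sum (λ c → sum (λ j → miss c (x i) (y j))))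
        ≡⟨ ∑-comm (λ i c → sum (λ j → miss c (x i) (y j))) ⟩
      sum (λ c → grid (miss c) x y)
        ≤⟨ sum-mono few ⟩
      sum {N} (λ _ → suc m)
        ≡⟨ sum-const N (suc m) ⟩
      N * suc m ∎
      where
      open ≤-Reasoning
      x = left L
      y = right L

    -- A dead edge accounts for N misses, and two of them would exceed k + k = 2N - 4.
    cost-dead : ∀ (x y : Fin (2 + m) → Fin N) → cost misses x y ≤ k + k → cost dead x y ≤ 1
    cost-dead x y cheap = s≤s⁻¹ (*-cancelˡ-< N (cost dead x y) 2 (≤-<-trans scaled
      (≤-<-trans cheap (subst (k + k <_) (double k) (m<n+m (k + k) {4} (s≤s z≤n))))))
      where
      double : ∀ k → 4 + (k + k) ≡ (2 + k) * 2
      double = solve-∀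
      pairs : ∀ {n} (u v : Fin n → Fin N) → N * sum (λ i → dead (u i) (v i)) ≤ sum (λ i → misses (u i) (v i))
      pairs {zero}  u v = ≤-reflexive (*-zeroʳ N)
      pairs {suc n} u v = ≤-trans (≤-reflexive (*-distribˡ-+ N (dead (u zero) (v zero)) _))
        (+-mono-≤ (N*dead≤misses (u zero) (v zero)) (pairs (u ∘ suc) (v ∘ suc)))
      scaled : N * cost dead x y ≤ cost misses x y
      scaled = ≤-trans (≤-reflexive (*-distribˡ-+ N (sum (λ i → dead (x i) (y i))) _))
        (+-mono-≤ (pairs x y) (pairs y (x ∘ (cyclic ⟨$⟩ʳ_))))

    3≤N : 3 ≤ N
    3≤N = s≤s (s≤s (s≤s z≤n))

    cost-miss : ∀ L → Few L → ∀ c → cost (miss c) (left L) (right L) ≤ k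
    cost-miss L few c = ≤-trans (cost≤2grid (miss c) (miss-sym c) (left L) (right L)) (+-mono-≤ (few c) (few c))

    rainbow-direct : ∀ L → Few L → cost misses (left L) (right L) ≤ k + k →
                     cost dead (left L) (right L) ≡ 0 → HasRainbowHamiltonCycle 𝓖
    rainbow-direct L few cheap alive = rainbow-spanning 3≤N 𝓖
      (left L zero) (right L zero ∷ interleave (left L ∘ suc) (right L ∘ suc)) (labelling-spanning L)
      (λ c → subst (_< N) (sym (closed-interleave (miss c) (left L) (right L)))
        (≤-<-trans (cost-miss L few c) (m<n+m k {2} (s≤s z≤n))))
      (trans (closed-interleave dead (left L) (right L)) alive)
      (subst (_≤ suc (k + k)) (sym (closed-interleave misses (left L) (right L))) (≤-trans cheap (n≤1+n (k + k))))

    module _ (L : Labelling (2 + m) N) where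

      private
        x y : Fin (2 + m) → Fin N
        x = left L
        y = right L

      -- Neither edge brought in by the reversal is dead, and together they are missed at most as
      -- often as the dead edge they replace.
      Improving : Fin m → Set
      Improving j = misses (x zero) (y (middle j)) < N × misses (y last) (x (middle j)) < N ×
                    misses (x zero) (y (middle j)) + misses (y last) (x (middle j)) ≤ N

      improving? : ∀ j → Dec (Improving j)
      improving? j = (_ <? _) ×-dec ((_ <? _) ×-dec (_ ≤? _))

      -- Removing the closing edge gains one miss per colour, one dead edge and N misses in all. The
      -- new edges cost at most two misses per colour, no dead edge and N misses in all.
      rainbow-improved : Few L → cost misses x y ≤ k + k → N ≤ misses (y last) (x zero) →
                         ∀ j → Improving j → HasRainbowHamiltonCycle 𝓖
      rainbow-improved few cheap closing j (x₀yⱼ , yₗxⱼ , new) =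
        let u , l , ↭l , change = two-opt x y j in
        rainbow-spanning 3≤N 𝓖 u l (Spanning-resp-↭ ↭l (labelling-spanning L))
          (λ c → s≤s (shortened (miss c) u l 1 (suc k) (change (miss c) (miss-sym c)) (N≤misses⇒1≤miss (y last) (x zero) closing c)
            (≤-trans (+-mono-≤ (cost-miss L few c) (+-mono-≤ (miss≤1 c _ _) (miss≤1 c _ _)))
              (≤-reflexive (+-comm k 2)))))
          (n≤0⇒n≡0 (shortened dead u l 1 0 (change dead dead-sym)
            (≤-reflexive (sym (N≤misses⇒dead≡1 (y last) (x zero) closing)))
            (+-mono-≤ (cost-dead x y cheap) (≤-reflexive (cong₂ _+_ (misses<N⇒dead≡0 _ _ x₀yⱼ) (misses<N⇒dead≡0 _ _ yₗxⱼ))))))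
          (≤-trans (shortened misses u l N (k + k) (change misses misses-sym) closing
            (≤-trans (+-mono-≤ cheap new) (≤-reflexive (+-comm (k + k) N)))) (n≤1+n (k + k)))
        where
        shortened : ∀ f u l s t →
          walk f u l u + (f (x (middle j)) (y (middle j)) + f (y last) (x zero))
            ≡ cost f x y + (f (x zero) (y (middle j)) + f (y last) (x (middle j))) →
          s ≤ f (y last) (x zero) →
          cost f x y + (f (x zero) (y (middle j)) + f (y last) (x (middle j))) ≤ s + t → walk f u l u ≤ t
        shortened f u l s t eq s≤ ≤s+t = +-cancelˡ-≤ s (walk f u l u) t
          (≤-trans (≤-reflexive (+-comm s (walk f u l u)))
            (≤-trans (+-monoʳ-≤ (walk f u l u) (≤-trans s≤ (m≤n+m (f (y last) (x zero)) (f (x (middle j)) (y (middle j))))))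
              (≤-trans (≤-reflexive eq) ≤s+t)))

      -- The two ways in which the reversal at j is blocked when all counts are tight: one of its
      -- new edges is dead, the other is present in every colour.
      Row Column : Fin m → Set
      Row j    = N ≤ misses (x zero) (y (middle j)) × misses (x (middle j)) (y last) ≡ 0
      Column j = N ≤ misses (x (middle j)) (y last) × misses (x zero) (y (middle j)) ≡ 0

      record Cross : Set where
        field
          arms   : ∀ j → Row j ⊎ Column j
          origin : misses (x zero) (y zero) ≡ 0
          inner  : ∀ i j → misses (x (suc i)) (y (inject₁ j)) ≡ 0
          corner : misses (x last) (y last) ≡ 0

      -- If no 2-opt move helps, the row of x₀ and the column of y_last account for all n − 1
      -- pairs missed by each colour.
      cross : Few L → N ≤ misses (y last) (x zero) → (∀ j → ¬ Improving j) → Cross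
      cross few closing stuck = record
        { arms   = arms
        ; origin = none (x zero) (y zero) λ c → n≤0⇒n≡0 (≤-trans (m≤m+n _ _) (off≤0 c))
        ; inner  = λ i j → none (x (suc i)) (y (inject₁ j)) λ c → n≤0⇒n≡0
            (≤-trans (≤-sum (λ j → miss c (x (suc i)) (y (inject₁ j))) j)
              (≤-trans (≤-sum (λ i → sum (λ j → miss c (x (suc i)) (y (inject₁ j)))) i)
                (≤-trans (m≤m+n _ _) (≤-trans (m≤n+m _ (miss c (x zero) (y zero))) (off≤0 c)))))
        ; corner = none (x last) (y last) λ c → n≤0⇒n≡0
            (≤-trans (m≤n+m _ (total (λ i j → miss c (x (suc i)) (y (inject₁ j)))))
              (≤-trans (m≤n+m _ (miss c (x zero) (y zero))) (off≤0 c)))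
        }
        where
        none : ∀ u v → (∀ c → miss c u v ≡ 0) → misses u v ≡ 0
        none u v zeros = trans (sum-cong-≗ zeros) (sum-replicate-zero N)

        F : Fin N → Fin (2 + m) → Fin (2 + m) → ℕ
        F c i j = miss c (x i) (y j)

        arm : Fin N → Fin m → ℕ
        arm c j = miss c (x zero) (y (middle j)) + miss c (x (middle j)) (y last)

        arm-total : Fin m → ℕ
        arm-total j = misses (x zero) (y (middle j)) + misses (x (middle j)) (y last)

        -- The closing pair uses up one of the at most m + 1 pairs missed by colour c.
        arms+off≤m : ∀ c → sum (arm c) + offCross (F c) ≤ m
        arms+off≤m c = +-cancelˡ-≤ 1 _ _ (≤-trans
          (≤-trans (+-monoˡ-≤ _ (≤-trans (N≤misses⇒1≤miss (y last) (x zero) closing c)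
                                         (≤-reflexive (miss-sym c (y last) (x zero)))))
            (≤-reflexive (trans (sym (+-assoc (F c zero last) (sum (arm c)) (offCross (F c))))
                                (sym (total-cross (F c))))))
          (few c))

        arm-total≤ : sum arm-total ≤ sum {m} (λ _ → N)
        arm-total≤ = begin
          sum arm-total
            ≡⟨ sum-cong-≗ (λ j → sym (∑-distrib-+ (λ c → miss c (x zero) (y (middle j)))
                                                  (λ c → miss c (x (middle j)) (y last)))) ⟩
          sum (λ j → sum (λ c → arm c j))
            ≡⟨ ∑-comm (λ j c → arm c j) ⟩
          sum (λ c → sum (arm c))
            ≤⟨ sum-mono (λ c → ≤-trans (m≤m+n (sum (arm c)) (offCross (F c))) (arms+off≤m c)) ⟩
          sum {N} (λ _ → m)
            ≡⟨ sum-const N m ⟩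
          N * m
            ≡⟨ *-comm N m ⟩
          m * N
            ≡⟨ sum-const m N ⟨
          sum {m} (λ _ → N) ∎
          where open ≤-Reasoning

        flip-last : ∀ j → misses (y last) (x (middle j)) ≡ misses (x (middle j)) (y last)
        flip-last j = misses-sym (y last) (x (middle j))

        -- Two new edges with fewer than N misses together are not dead and would improve.
        N≤arm-total : ∀ j → N ≤ arm-total j
        N≤arm-total j with misses (x zero) (y (middle j)) <? N
        ... | no  p≮N = ≤-trans (≮⇒≥ p≮N) (m≤m+n _ _)
        ... | yes p<N with misses (y last) (x (middle j)) <? N
        ... | no  q≮N = ≤-trans (≮⇒≥ q≮N) (≤-trans (≤-reflexive (flip-last j))
                (m≤n+m (misses (x (middle j)) (y last)) (misses (x zero) (y (middle j)))))
        ... | yes q<N = ≮⇒≥ λ p+q<N → stuck j (p<N , q<N , ≤-trans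
                (≤-reflexive (cong (misses (x zero) (y (middle j)) +_) (flip-last j))) (<⇒≤ p+q<N))

        -- The mean over the m positions is at most N while every term is at least N.
        arm-total≤N : ∀ j → arm-total j ≤ N
        arm-total≤N = sum-tight (λ _ → N) arm-total N≤arm-total arm-total≤

        -- At a sum of N two edges that are not dead would improve, so one edge takes all N misses
        -- and leaves none to the other.
        arms : ∀ j → Row j ⊎ Column j
        arms j with misses (x zero) (y (middle j)) <? N
        ... | no  p≮N = inj₁ (≮⇒≥ p≮N , n≤0⇒n≡0 (+-cancelˡ-≤ N _ _
                (≤-trans (+-monoˡ-≤ (misses (x (middle j)) (y last)) (≮⇒≥ p≮N)) (≤-trans (arm-total≤N j) (≤-reflexive (sym (+-identityʳ N)))))))
        ... | yes p<N with misses (y last) (x (middle j)) <? N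
        ... | yes q<N = contradiction (p<N , q<N , ≤-trans
                (≤-reflexive (cong (misses (x zero) (y (middle j)) +_) (flip-last j))) (arm-total≤N j)) (stuck j)
        ... | no  q≮N = inj₂ (N≤q , n≤0⇒n≡0 (+-cancelʳ-≤ N _ _
                (≤-trans (+-monoʳ-≤ (misses (x zero) (y (middle j))) N≤q) (arm-total≤N j))))
          where
          N≤q : N ≤ misses (x (middle j)) (y last)
          N≤q = ≤-trans (≮⇒≥ q≮N) (≤-reflexive (flip-last j))

        1≤arm : ∀ c j → 1 ≤ arm c j
        1≤arm c j with arms j
        ... | inj₁ (N≤p , _) = ≤-trans (N≤misses⇒1≤miss _ _ N≤p c) (m≤m+n _ _)
        ... | inj₂ (N≤q , _) = ≤-trans (N≤misses⇒1≤miss _ _ N≤q c)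
          (m≤n+m (miss c (x (middle j)) (y last)) (miss c (x zero) (y (middle j))))

        -- Each arm position already takes one of the m pairs left to colour c.
        off≤0 : ∀ c → offCross (F c) ≤ 0
        off≤0 c = +-cancelˡ-≤ m _ _ (≤-trans
          (+-monoˡ-≤ (offCross (F c)) (≤-trans
            (≤-reflexive (sym (trans (sum-const m 1) (*-identityʳ m)))) (sum-mono (1≤arm c))))
          (≤-trans (arms+off≤m c) (≤-reflexive (sym (+-identityʳ m)))))

    PendantLabelling : Set
    PendantLabelling = Σ (Labelling (2 + m) N) λ L → (∀ c → IsBipartite (𝓖 c) L) ×
      (∀ c a b → adj (𝓖 c) (left L a) (right L b) ≡ pendant a b)

    present : ∀ u v → misses u v ≡ 0 → ∀ c → adj (𝓖 c) u v ≡ true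
    present u v none c = miss≡0⇒adj c u v (sum≡0 (λ c → miss c u v) none c)

    absent : ∀ u v → N ≤ misses u v → ∀ c → adj (𝓖 c) u v ≡ false
    absent u v all c with adj (𝓖 c) u v | N≤misses⇒1≤miss u v all c
    ... | false | _ = refl

    IsBipartite-swapSides : ∀ G (L : Labelling (2 + m) N) → IsBipartite G L → IsBipartite G (swapSides L)
    IsBipartite-swapSides G L (l , r) = r , l

    IsBipartite-relabel : ∀ G (L : Labelling (2 + m) N) π τ → IsBipartite G L → IsBipartite G (relabel L π τ)
    IsBipartite-relabel G L π τ (l , r) =
      (λ a b → l (π ⟨$⟩ʳ a) (π ⟨$⟩ʳ b)) , (λ a b → r (τ ⟨$⟩ʳ a) (τ ⟨$⟩ʳ b))

    module _ (L : Labelling (2 + m) N) (bip : ∀ c → IsBipartite (𝓖 c) L)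
             (closing : N ≤ misses (right L last) (left L zero)) (C : Cross L) where

      open Cross C

      private
        x y : Fin (2 + m) → Fin N
        x = left L
        y = right L

      -- x₀ keeps only the neighbour y₀, so it is the pendant vertex; it lies on the left, hence the
      -- exchange of sides.
      row-star : (∀ j → Row L j) → PendantLabelling
      row-star rows = swapSides L , (λ c → IsBipartite-swapSides (𝓖 c) L (bip c)) , table
        where
        table : ∀ c a b → adj (𝓖 c) (y a) (x b) ≡ pendant a b
        table c zero zero = trans (adj-sym (𝓖 c) (y zero) (x zero)) (present (x zero) (y zero) origin c)
        table c zero (suc i) = trans (adj-sym (𝓖 c) (y zero) (x (suc i))) (present (x (suc i)) (y zero) (inner i zero) c)
        table c (suc j) zero with view j
        ... | ‵fromℕ      = absent (y last) (x zero) closing c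
        ... | ‵inject₁ j′ = trans (adj-sym (𝓖 c) (y (middle j′)) (x zero))
                              (absent (x zero) (y (middle j′)) (proj₁ (rows j′)) c)
        table c (suc j) (suc i) with view j
        ... | ‵inject₁ j′ = trans (adj-sym (𝓖 c) (y (middle j′)) (x (suc i)))
                              (present (x (suc i)) (y (middle j′)) (inner i (suc j′)) c)
        ... | ‵fromℕ with view i
        ... | ‵fromℕ      = trans (adj-sym (𝓖 c) (y last) (x last)) (present (x last) (y last) corner c)
        ... | ‵inject₁ i′ = trans (adj-sym (𝓖 c) (y last) (x (middle i′)))
                              (present (x (middle i′)) (y last) (proj₂ (rows i′)) c)

      -- The last y keeps only the last x; turning both parts back by one step puts this pair at
      -- index zero.
      column-star : (∀ j → Column L j) → PendantLabelling
      column-star columns = relabel L (flip cyclic) (flip cyclic)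
        , (λ c → IsBipartite-relabel (𝓖 c) L (flip cyclic) (flip cyclic) (bip c)) , table
        where
        table : ∀ c a b → adj (𝓖 c) (x (flip cyclic ⟨$⟩ʳ a)) (y (flip cyclic ⟨$⟩ʳ b)) ≡ pendant a b
        table c zero zero = present (x last) (y last) corner c
        table c zero (suc b) = present (x last) (y (inject₁ b)) (inner last b) c
        table c (suc zero) zero = trans (adj-sym (𝓖 c) (x zero) (y last)) (absent (y last) (x zero) closing c)
        table c (suc (suc a)) zero = absent (x (middle a)) (y last) (proj₁ (columns a)) c
        table c (suc (suc a)) (suc b) = present (x (middle a)) (y (inject₁ b)) (inner (inject₁ a) b) c
        table c (suc zero) (suc zero) = present (x zero) (y zero) origin c
        table c (suc zero) (suc (suc b)) = present (x zero) (y (middle b)) (proj₂ (columns b)) c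

      -- Exchanging the labels of yᵢ and yⱼ keeps every edge of the cycle but the closing one
      -- present in all colours, and makes the 2-opt move at j succeed.
      rainbow-mixed : Few L → ∀ i j → Column L i → Row L j → HasRainbowHamiltonCycle 𝓖
      rainbow-mixed few i j (_ , x₀yᵢ) (_ , xⱼyₗ) = rainbow-improved L′ (Few-relabel L idₚ τ few) cheap
        (subst (λ b → N ≤ misses (y b) (x zero)) (sym τ-last) closing) j
        (subst (_< N) (sym new₁) 0<N , subst (_< N) (sym new₂) 0<N , ≤-trans (≤-reflexive (cong₂ _+_ new₁ new₂)) z≤n)
        where
        τ : Permutation′ (2 + m)
        τ = transpose (middle j) (middle i)
        L′ : Labelling (2 + m) N
        L′ = relabel L idₚ τ
        0<N : 0 < N
        0<N = s≤s z≤n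

        τ-fixes : ∀ b → b ≢ middle j → b ≢ middle i → τ ⟨$⟩ʳ b ≡ b
        τ-fixes b b≢j b≢i with b ≟ᶠ middle j
        ... | yes b≡j = contradiction b≡j b≢j
        ... | no _ with b ≟ᶠ middle i
        ... | yes b≡i = contradiction b≡i b≢i
        ... | no _    = refl

        τ-zero : τ ⟨$⟩ʳ zero ≡ zero
        τ-zero = τ-fixes zero (λ ()) (λ ())

        τ-last : τ ⟨$⟩ʳ last ≡ last
        τ-last = τ-fixes last (fromℕ≢inject₁ ∘ sucᶠ-injective) (fromℕ≢inject₁ ∘ sucᶠ-injective)

        τ-middle : τ ⟨$⟩ʳ middle j ≡ middle i
        τ-middle with inject₁ j ≟ᶠ inject₁ j
        ... | yes _   = refl
        ... | no  j≢j = contradiction refl j≢j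

        -- τ fixes `last`, so by injectivity no other index is sent there.
        τ-inject₁ : ∀ b → ∃ λ b′ → τ ⟨$⟩ʳ inject₁ b ≡ inject₁ b′
        τ-inject₁ b with τ ⟨$⟩ʳ inject₁ b in eq
        ... | c with view c
        ... | ‵inject₁ b′ = b′ , refl
        ... | ‵fromℕ = contradiction
          (sym (trans (sym (inverseˡ τ {inject₁ b})) (trans (cong (τ ⟨$⟩ˡ_) (trans eq (sym τ-last))) (inverseˡ τ {last}))))
          fromℕ≢inject₁

        new₁ : misses (x zero) (y (τ ⟨$⟩ʳ middle j)) ≡ 0
        new₁ = trans (cong (λ b → misses (x zero) (y b)) τ-middle) x₀yᵢ

        new₂ : misses (y (τ ⟨$⟩ʳ last)) (x (middle j)) ≡ 0
        new₂ = trans (cong (λ b → misses (y b) (x (middle j))) τ-last)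
          (trans (misses-sym (y last) (x (middle j))) xⱼyₗ)

        inner′ : ∀ a b → misses (x (suc a)) (y (τ ⟨$⟩ʳ inject₁ b)) ≡ 0
        inner′ a b = let b′ , eq = τ-inject₁ b in trans (cong (λ b → misses (x (suc a)) (y b)) eq) (inner a b′)

        -- Only the closing edge can be missed, so the cost is at most N = 2 + k, and k ≥ 2.
        cheap : cost misses x (y ∘ (τ ⟨$⟩ʳ_)) ≤ k + k
        cheap = ≤-trans (+-mono-≤ (≤-reflexive diagonal)
            (≤-trans (≤-reflexive turning) (misses≤N (y (τ ⟨$⟩ʳ last)) (x zero))))
          (+-monoˡ-≤ k (s≤s (≤-trans (s≤s z≤n) (m≤n+m (suc m) m))))
          where
          diagonal : sum (λ a → misses (x a) (y (τ ⟨$⟩ʳ a))) ≡ 0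
          diagonal = trans (sum-cong-≗ at) (sum-replicate-zero (2 + m))
            where
            at : ∀ a → misses (x a) (y (τ ⟨$⟩ʳ a)) ≡ 0
            at zero = trans (cong (λ b → misses (x zero) (y b)) τ-zero) origin
            at (suc a) with view a
            ... | ‵fromℕ      = trans (cong (λ b → misses (x last) (y b)) τ-last) corner
            ... | ‵inject₁ a′ = inner′ (inject₁ a′) (suc a′)
          turning : sum (λ a → misses (y (τ ⟨$⟩ʳ a)) (x (cyclic ⟨$⟩ʳ a))) ≡ misses (y (τ ⟨$⟩ʳ last)) (x zero)
          turning = trans (sum-cyclic (λ a b → misses (y (τ ⟨$⟩ʳ a)) (x b)))
            (cong (_+ misses (y (τ ⟨$⟩ʳ last)) (x zero)) (trans
              (sum-cong-≗ λ a → trans (misses-sym (y (τ ⟨$⟩ʳ inject₁ a)) (x (suc a))) (inner′ a a))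
              (sum-replicate-zero (suc m))))


    -- For n = 2 there is no reversal to try, and the vacuous `Row` case recognises the path on four
    -- vertices.
    dead-closing : ∀ L → (∀ c → IsBipartite (𝓖 c) L) → Few L → cost misses (left L) (right L) ≤ k + k →
      N ≤ misses (right L last) (left L zero) → HasRainbowHamiltonCycle 𝓖 ⊎ PendantLabelling
    dead-closing L bip few cheap closing with any? (improving? L)
    ... | yes (j , improving) = inj₁ (rainbow-improved L few cheap closing j improving)
    ... | no  stuck = conclude (∀-or-∃ (Cross.arms C)) (∀-or-∃ (Sum.swap ∘ Cross.arms C))
      where
      C : Cross L
      C = cross L few closing (λ j improving → stuck (j , improving))
      conclude : (∀ j → Row L j) ⊎ (∃ λ j → Column L j) → (∀ j → Column L j) ⊎ (∃ λ j → Row L j) →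
                 HasRainbowHamiltonCycle 𝓖 ⊎ PendantLabelling
      conclude (inj₁ rows) _ = inj₂ (row-star L bip closing C rows)
      conclude _ (inj₁ columns) = inj₂ (column-star L bip closing C columns)
      conclude (inj₂ (i , columnᵢ)) (inj₂ (j , rowⱼ)) =
        inj₁ (rainbow-mixed L bip closing C few i j columnᵢ rowⱼ)

    -- Rotating both parts together preserves the cycle and moves turn i to the closing position.
    dead-turn : ∀ L → (∀ c → IsBipartite (𝓖 c) L) → Few L → cost misses (left L) (right L) ≤ k + k →
      ∀ i → N ≤ misses (right L i) (left L (cyclic ⟨$⟩ʳ i)) → HasRainbowHamiltonCycle 𝓖 ⊎ PendantLabelling
    dead-turn L bip few cheap i dead-i = dead-closing (relabel L ρ ρ)
      (λ c → IsBipartite-relabel (𝓖 c) L ρ ρ (bip c)) (Few-relabel L ρ ρ few)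
      (≤-trans (≤-reflexive (cost-rotation misses (left L) (right L) (suc (toℕ i)))) cheap)
      (subst₂ (λ a b → N ≤ misses (right L a) (left L b)) (sym (rotation-last i)) (sym ρ-zero) dead-i)
      where
      ρ : Permutation′ (2 + m)
      ρ = rotation (suc (toℕ i))
      ρ-zero : ρ ⟨$⟩ʳ zero ≡ cyclic ⟨$⟩ʳ i
      ρ-zero = cong (cyclic ⟨$⟩ʳ_) (rotation-zero i)

    rainbow-or-pendant : ∀ L → (∀ c → IsBipartite (𝓖 c) L) → Few L → HasRainbowHamiltonCycle 𝓖 ⊎ PendantLabelling
    rainbow-or-pendant L bip few =
      let r , cheap = sum-<⇒∃ rotated (λ _ → suc (k + k)) average in rainbow-rotated r (s≤s⁻¹ cheap)
      where
      rotated : Fin (2 + m) → ℕ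
      rotated r = cost misses (left L) (right L ∘ (rotation (toℕ r) ⟨$⟩ʳ_))
      -- 2N(n - 1) = n(4n - 4). Comparing strictly with 4n - 3 turns the mean into a rotation of
      -- cost at most 4n - 4.
      average : sum rotated < sum {2 + m} (λ _ → suc (k + k))
      average = begin-strict
        sum rotated
          ≡⟨ sum-cost-rotations misses misses-sym (left L) (right L) ⟩
        grid misses (left L) (right L) + grid misses (left L) (right L)
          ≤⟨ +-mono-≤ (grid-misses L few) (grid-misses L few) ⟩
        N * suc m + N * suc m
          ≡⟨ count m ⟩
        (2 + m) * (k + k)
          <⟨ *-monoʳ-< (2 + m) (n<1+n (k + k)) ⟩
        (2 + m) * suc (k + k)
          ≡⟨ sum-const (2 + m) (suc (k + k)) ⟨
        sum {2 + m} (λ _ → suc (k + k)) ∎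
        where
        open ≤-Reasoning
        count : ∀ m → (2 + (suc m + suc m)) * suc m + (2 + (suc m + suc m)) * suc m
          ≡ (2 + m) * ((suc m + suc m) + (suc m + suc m))
        count = solve-∀
      rainbow-rotated : ∀ r → rotated r ≤ k + k → HasRainbowHamiltonCycle 𝓖 ⊎ PendantLabelling
      rainbow-rotated r cheap = search (sum (λ i → dead (x i) (y i)) ≟ 0)
                                       (sum (λ i → dead (y i) (x (cyclic ⟨$⟩ʳ i))) ≟ 0)
        where
        L′ L″ : Labelling (2 + m) N
        L′ = relabel L idₚ (rotation (toℕ r))
        L″ = relabel (swapSides L′) idₚ cyclic
        few′ : Few L′
        few′ = Few-relabel L idₚ (rotation (toℕ r)) few
        bip′ : ∀ c → IsBipartite (𝓖 c) L′
        bip′ c = IsBipartite-relabel (𝓖 c) L idₚ (rotation (toℕ r)) (bip c)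
        x y : Fin (2 + m) → Fin N
        x = left L′
        y = right L′
        search : Dec (sum (λ i → dead (x i) (y i)) ≡ 0) → Dec (sum (λ i → dead (y i) (x (cyclic ⟨$⟩ʳ i))) ≡ 0) →
                 HasRainbowHamiltonCycle 𝓖 ⊎ PendantLabelling
        search (yes alive) (yes alive′) = inj₁ (rainbow-direct L′ few′ cheap (cong₂ _+_ alive alive′))
        search _ (no ¬alive) =
          let i , dead-i = 0<sum⇒∃ (λ i → dead (y i) (x (cyclic ⟨$⟩ʳ i))) (n≢0⇒n>0 ¬alive)
          in dead-turn L′ bip′ few′ cheap i (1≤dead⇒N≤misses (y i) (x (cyclic ⟨$⟩ʳ i)) dead-i)
        search (no ¬alive) _ =
          let i , dead-i = 0<sum⇒∃ (λ i → dead (x i) (y i)) (n≢0⇒n>0 ¬alive)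
          in dead-turn L″
            (λ c → IsBipartite-relabel (𝓖 c) (swapSides L′) idₚ cyclic (IsBipartite-swapSides (𝓖 c) L′ (bip′ c)))
            (Few-relabel (swapSides L′) idₚ cyclic (Few-swapSides L′ few′))
            (≤-trans (≤-reflexive (cost-half-turn misses x y)) cheap)
            -- Turn j of `L″` joins the x and y of index j + 1, hence the step back.
            (cyclic ⟨$⟩ˡ i)
            (subst (λ j → N ≤ misses (x j) (y j)) (sym (inverseʳ cyclic {i})) (1≤dead⇒N≤misses (x i) (y i) dead-i))

  -- From edge counts to the rainbow cycle

  missing-few : ∀ {M N} (𝓖 : Fin N → Graph N) (L : Labelling (suc M) N) c →
    M * M + M < edgeCount (𝓖 c) L → grid (Colours.miss 𝓖 c) (left L) (right L) ≤ M
  missing-few {M} 𝓖 L c many = +-cancelˡ-≤ (suc (M * M + M)) _ _ (begin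
    suc (M * M + M) + grid (miss c) (left L) (right L)
      ≤⟨ +-monoˡ-≤ _ many ⟩
    edgeCount (𝓖 c) L + grid (miss c) (left L) (right L)
      ≡⟨ ∑-distrib-+ (λ a → sum (λ b → ⟦ edge a b ⟧)) (λ a → sum (λ b → miss c (left L a) (right L b))) ⟨
    sum (λ a → sum (λ b → ⟦ edge a b ⟧) + sum (λ b → miss c (left L a) (right L b)))
      ≡⟨ sum-cong-≗ (λ a → trans
           (sym (∑-distrib-+ (λ b → ⟦ edge a b ⟧) (λ b → miss c (left L a) (right L b))))
           (trans (sum-cong-≗ λ b → complementary (edge a b)) (sum-const (suc M) 1))) ⟩
    sum {suc M} (λ _ → suc M * 1)
      ≡⟨ sum-const (suc M) (suc M * 1) ⟩
    suc M * (suc M * 1)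
      ≡⟨ square M ⟩
    suc (M * M + M) + M ∎)
    where
    open ≤-Reasoning
    open Colours 𝓖
    edge : Fin (suc M) → Fin (suc M) → Bool
    edge a b = adj (𝓖 c) (left L a) (right L b)
    complementary : ∀ b → ⟦ b ⟧ + (if b then 0 else 1) ≡ 1
    complementary true  = refl
    complementary false = refl
    square : ∀ M → suc M * (suc M * 1) ≡ suc (M * M + M) + M
    square = solve-∀

  rainbow-in-dense-family : ∀ m {N} → N ≡ 2 * (2 + m) → (𝓖 : Fin N → Graph N) (L : Labelling (2 + m) N) →
    (∀ c → IsBipartite (𝓖 c) L) → (∀ c → suc m * suc m + suc m < edgeCount (𝓖 c) L) →
    ¬ ((∀ i j → 𝓖 i ≐ 𝓖 j) × (∀ i → 𝓖 i ≅ extremalGraph (2 + m))) →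
    HasRainbowHamiltonCycle 𝓖
  rainbow-in-dense-family m N≡2n = at (trans N≡2n (double m))
    where
    double : ∀ m → 2 * (2 + m) ≡ 2 + (suc m + suc m)
    double = solve-∀
    -- The two forms of 2n are not definitionally equal, so N stays a variable until the equation is
    -- matched.
    at : ∀ {N} → N ≡ 2 + (suc m + suc m) → (𝓖 : Fin N → Graph N) (L : Labelling (2 + m) N) →
      (∀ c → IsBipartite (𝓖 c) L) → (∀ c → suc m * suc m + suc m < edgeCount (𝓖 c) L) →
      ¬ ((∀ i j → 𝓖 i ≐ 𝓖 j) × (∀ i → 𝓖 i ≅ extremalGraph (2 + m))) →
      HasRainbowHamiltonCycle 𝓖
    at refl 𝓖 L bip many nonextremal =
      conclude (Family.rainbow-or-pendant m 𝓖 L bip (λ c → missing-few 𝓖 L c (many c)))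
      where
      conclude : HasRainbowHamiltonCycle 𝓖 ⊎ Family.PendantLabelling m 𝓖 → HasRainbowHamiltonCycle 𝓖
      conclude (inj₁ rainbow) = rainbow
      conclude (inj₂ (L′ , bip′ , pendants)) = contradiction
        ( (λ i j → pendant-≐ (𝓖 i) (𝓖 j) L′ (bip′ i) (bip′ j) (pendants i) (pendants j))
        , (λ i → pendant-≅ (𝓖 i) (extremalGraph (2 + m)) L′ (extremalLabelling (suc m)) (bip′ i)
                   (extremal-bipartite (suc m)) (pendants i) (extremal-biadjacency (suc m))) )
        nonextremal

open Spectral using (edgeCount-bound)
open Combinatorics using (rainbow-in-dense-family)
open Defs using (_≤_)

theorem1p6 : ∀ (n : ℕ) → 2 ℕ.≤ n →
    (X : Subset (2 ℕ.* n)) → ∣ X ∣ ≡ ∣ ∁ X ∣ →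
    (𝓖 : Fin (2 ℕ.* n) → BipartiteGraph X) →
    (ρ : Fin (2 ℕ.* n) → ℝ) → (∀ i → IsSpectralRadius (adjacencyMatrix (graph (𝓖 i))) (ρ i)) →
    (ρ₀ : ℝ) → IsSpectralRadius (adjacencyMatrix (extremalGraph n)) ρ₀ →
    (∀ i → ρ₀ ≤ ρ i) →
    ¬ ((∀ i j → graph (𝓖 i) ≐ graph (𝓖 j)) × (∀ i → graph (𝓖 i) ≅ extremalGraph n)) →
    HasRainbowHamiltonCycle (λ i → graph (𝓖 i))
theorem1p6 (suc (suc m)) (s≤s (s≤s z≤n)) X balanced 𝓖 ρ radius ρ₀ radius₀ ρ₀≤ρ nonextremal =
  let L , separated = balanced-labelling X balanced refl
      bip i = separated-bipartite (𝓖 i) L separated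
  in rainbow-in-dense-family m refl (λ i → graph (𝓖 i)) L bip
       (λ i → edgeCount-bound (graph (𝓖 i)) L (bip i) (suc m) (s≤s z≤n) (ρ i) ρ₀ (radius i) radius₀ (ρ₀≤ρ i))
       nonextremal
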